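{- Let $n$ be a positive integer and let $s$ be an integer with $9 \leq s \leq 88$. Then the polynomial $$g_1(x) = n!\sum_{j=0}^{n}\binom{n+s-j}{n-j}\frac{x^j}{j!}$$ is irreducible over $\mathbb{Q}$.
   Context: $g_1(x)=g_1(x,n,s)$ is a monic polynomial of degree $n$ with integer coefficients; it equals $n!\,(-1)^n L_n^{(-n-s-1)}(x)$, where $L_n^{(\alpha)}(x)=\sum_{j=0}^{n}\frac{(n+\alpha)(n-1+\alpha)\cdots(j+1+\alpha)}{j!(n-j)!}(-x)^j$ is the generalised Laguerre polynomial. -}

module Defs where

open import Data.Nat using (ℕ; zero; suc; _+_; _∸_; _!)
open import Data.Nat.Properties using (_!≢0)
open import Data.Nat.Combinatorics using (_C_)
open import Data.Integer using (+_)
open import Data.Rational using (ℚ; 0ℚ; _/_) renaming (_+_ to _+ℚ_; _*_ to _*ℚ_)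
open import Data.List using (List; []; _∷_; map; upTo)
open import Data.Product using (Σ; _×_; ∃-syntax)
open import Relation.Binary.PropositionalEquality using (_≡_; _≢_)
open import Relation.Nullary using (¬_)
open import Data.Nat using (_≤_)

-- Polynomials over ℚ are represented by coefficient lists
-- [a₀, a₁, a₂, …] meaning a₀ + a₁ x + a₂ x² + ⋯ (trailing zeros allowed).
Poly : Set
Poly = List ℚ

coeff : Poly → ℕ → ℚ
coeff []       _       = 0ℚ
coeff (a ∷ f)  zero    = a
coeff (a ∷ f)  (suc k) = coeff f k

convSum : (ℕ → ℚ) → (ℕ → ℚ) → ℕ → ℚ
convSum f g k = go k
  where
  go : ℕ → ℚ
  go zero    = f 0 *ℚ g k
  go (suc i) = go i +ℚ (f (suc i) *ℚ g (k ∸ suc i))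

IsProduct : Poly → Poly → Poly → Set
IsProduct f h g = ∀ k → convSum (coeff f) (coeff h) k ≡ coeff g k

NonConstant : Poly → Set
NonConstant f = ∃[ k ] (1 ≤ k × coeff f k ≢ 0ℚ)

-- irreducible over ℚ: nonconstant (hence a non-zero non-unit), and in every
-- factorisation g = f * h one factor is constant (i.e. a unit, as g ≠ 0).
IrreducibleOverℚ : Poly → Set
IrreducibleOverℚ g =
  NonConstant g × (∀ f h → IsProduct f h g → ¬ (NonConstant f × NonConstant h))

g₁coeff : ℕ → ℕ → ℕ → ℚ
g₁coeff n s j = (+ (n ! * ((n + s ∸ j) C (n ∸ j)))) / (j !)
  where
  open Data.Nat using (_*_)
  instance _ = j !≢0

g₁ : ℕ → ℕ → Poly
g₁ n s = map (g₁coeff n s) (upTo (suc n))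

-- Write a_i = C(n,i)(s+1)⋯(s+i) for the coefficient of x^(n−i) in g₁, and S for the base-p digit sum.
-- By Legendre's formula (p−1)·v_p(a_i) = i − S(n) + S(n−i) + (S(s) + S(i) − S(s+i)), so the p-adic
-- Newton polygon of g₁ is governed by digits.  If q is a power of p and r = n mod q satisfies r + s < q,
-- then apart from r roots the polygon consists of edges whose lengths are multiples of q; hence a factor
-- of degree k has k mod q ≤ r.  By Kummer's theorem C(n,k) then divides lcm(1,…,s+k) and
-- lcm(1,…,s)·C(k+s,k), which is impossible for 187 ≤ k ≤ n/2 and bounds n for every smaller k.
--
-- A second criterion excludes degree k as soon as some prime p > k divides all a_i with i ≥ k while all
-- slopes are < 1/k.  It removes most primes from C(n,k), so that for each s and k the remaining n can be
-- listed as divisors of an explicit number and tested one by one.  For k = 1 only odd n have to be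
-- listed: up to normalisation g₁(x) = E (x+U)ⁿ for a gamma distributed U, and expanding (x+U)^(n/2) in
-- Laguerre polynomials of U writes g₁ as a positive sum of squares when n is even.  The few cases that
-- survive are settled by individual Newton polygons or by reduction modulo a small prime.
module Submission where

open import Defs
open import Data.Nat using (ℕ; _≤_)

-- The polygon itself is never built. An edge is seen through a weight α ν(a_j) + β j: the last
-- index at which it is least is additive over products (Dumas), and taking α divisible by p - 1
-- turns all weights into digit sums, so that only natural numbers are compared. The index i runs
-- down from the leading coefficient.
--
-- The condition r + s < q keeps the carries of s + i, for i ≤ r, below q; above q only the polygon
-- of the truncated exponential series, the case s = 0, is left.
--
-- The obstacle is small k. Divisibility by lcm(1,...,s+k) leaves far too many n, and the escape is
-- a feedback: a bound for n limits the carries in n + s, few carries let the second criterion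
-- exclude primes from C(n,k), and fewer primes lower the bound. For k = 1 the prime 2 escapes,
-- since the criterion then asks for no carry at all in base 2; hence the positivity argument for
-- even n.
--
-- From k = 6 on, s is replaced by 88 in the bounds and all s are searched together. There s + k is
-- at most 88 + 186 = 274, which fixes the range of the primes.

-- Digit sums in base p and their behaviour under addition and borrowing.

module DigitSums where
  open import Data.Nat
  open import Data.Nat.Properties
  open import Data.Nat.DivMod
  open import Data.Nat.Divisibility
  open import Data.Nat.Induction using (<-rec)
  open import Data.Nat.Tactic.RingSolver using (solve-∀)
  open import Data.Product
  open import Data.Sum using (inj₁; inj₂)
  open import Data.Empty using (⊥-elim)
  open import Relation.Nullary
  open import Relation.Binary.PropositionalEquality

  divmod-unique : ∀ n d y → d < suc n → ((d + y * suc n) % suc n ≡ d) × ((d + y * suc n) / suc n ≡ y)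
  divmod-unique n d y d< = trans ([m+kn]%n≡m%n d y (suc n)) (m<n⇒m%n≡m d<)
    , trans (+-distrib-/-∣ʳ d (divides y refl)) (cong₂ _+_ (m<n⇒m/n≡0 d<) (m*n/n≡m y (suc n)))

  data DivView (n : ℕ) : ℕ → Set where
    dv : ∀ d y → d < suc n → DivView n (d + y * suc n)

  divView : ∀ n x → DivView n x
  divView n x = subst (DivView n) (sym (m≡m%n+[m/n]*n x (suc n))) (dv (x % suc n) (x / suc n) (m%n<n x (suc n)))

  -- The second argument is fuel. Each division makes a positive number smaller, so fuel x suffices
  -- for x; `dsumF-irr` makes any larger choice equivalent.
  dsumF : ℕ → ℕ → ℕ → ℕ
  dsumF p₁ zero    x       = 0
  dsumF p₁ (suc f) zero    = 0
  dsumF p₁ (suc f) (suc x) = suc x % suc p₁ + dsumF p₁ f (suc x / suc p₁)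

  -- The base is given through p - 2, so that p ≥ 2 and p - 1 ≥ 1 hold by form.
  module Digits (p₂ : ℕ) where
    p₁ p : ℕ
    p₁ = suc p₂
    p  = suc p₁

    1<p : 1 < p
    1<p = s≤s (s≤s z≤n)

    S : ℕ → ℕ
    S x = dsumF p₁ x x

    dsumF-irr : ∀ f g x → x ≤ f → x ≤ g → dsumF p₁ f x ≡ dsumF p₁ g x
    dsumF-irr zero    zero    zero    _ _ = refl
    dsumF-irr zero    (suc g) zero    _ _ = refl
    dsumF-irr (suc f) zero    zero    _ _ = refl
    dsumF-irr (suc f) (suc g) zero    _ _ = refl
    dsumF-irr (suc f) (suc g) (suc x) (s≤s a) (s≤s b) =
      cong (suc x % p +_) (dsumF-irr f g (suc x / p) (lem a) (lem b))
      where
      lem : ∀ {h} → x ≤ h → suc x / p ≤ h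
      lem x≤h = ≤-trans (≤-pred (m/n<m (suc x) p 1<p)) x≤h

    S-unfold : ∀ x → S x ≡ x % p + S (x / p)
    S-unfold zero    = refl
    S-unfold (suc x) = cong (suc x % p +_) (dsumF-irr x (suc x / p) (suc x / p) (≤-pred (m/n<m (suc x) p 1<p)) ≤-refl)

    S-digit : ∀ d y → d < p → S (d + y * p) ≡ d + S y
    S-digit d y d< with divmod-unique p₁ d y d<
    ... | e₁ , e₂ = trans (S-unfold (d + y * p)) (cong₂ (λ a b → a + S b) e₁ e₂)

    S-small : ∀ d → d < p → S d ≡ d
    S-small d d< = trans (cong S (sym (+-identityʳ d))) (trans (S-digit d 0 d<) (+-identityʳ d))

    y<dy : ∀ d y → y ≢ 0 → y < d + y * p
    y<dy d zero    ne = ⊥-elim (ne refl)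
    y<dy d (suc y) _  = ≤-trans (m<m*n (suc y) p 1<p) (m≤n+m _ d)

    digit-rec : (P : ℕ → Set) → P 0 → (∀ d y → d < p → P y → P (d + y * p)) → ∀ x → P x
    digit-rec P z step = <-rec P go
      where
      go : ∀ x → (∀ {y} → y < x → P y) → P x
      go x rec with divView p₁ x
      ... | dv zero    zero d< = z
      ... | dv (suc d) zero d< = step (suc d) 0 d< z
      ... | dv d (suc y)    d< = step d (suc y) d< (rec (y<dy d (suc y) λ ()))

    -- Either the last digit rises by one, or it was p - 1, drops to 0 and passes the increment on
    -- to the quotient.
    S-suc : ∀ x → S (suc x) ≤ suc (S x)
    S-suc = digit-rec _ (≤-reflexive (S-small 1 1<p)) step
      where
      step : ∀ d y → d < p → S (suc y) ≤ suc (S y) → S (suc (d + y * p)) ≤ suc (S (d + y * p))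
      step d y d< ih with m≤n⇒m<n∨m≡n d<
      ... | inj₁ sd<p = ≤-reflexive (trans (S-digit (suc d) y sd<p) (cong suc (sym (S-digit d y d<))))
      ... | inj₂ refl = begin
        S (p + y * p)         ≡⟨ S-digit 0 (suc y) (s≤s z≤n) ⟩
        S (suc y)             ≤⟨ ih ⟩
        suc (S y)             ≤⟨ s≤s (m≤n+m (S y) d) ⟩
        suc (d + S y)         ≡⟨ cong suc (S-digit d y d<) ⟨
        suc (S (d + y * p))   ∎
        where open ≤-Reasoning

    S≤id : ∀ x → S x ≤ x
    S≤id zero    = z≤n
    S≤id (suc x) = ≤-trans (S-suc x) (s≤s (S≤id x))

    n<p^n : ∀ x → x < p ^ x
    n<p^n zero    = s≤s z≤n
    n<p^n (suc x) = <-≤-trans (s≤s (n<p^n x)) (≤-trans (≤-reflexive (cong suc (sym (*-identityˡ (p ^ x)))))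
      (≤-trans (+-monoˡ-≤ (1 * p ^ x) (m^n>0 p x)) (*-monoˡ-≤ (p ^ x) 1<p)))

    -- A carry trades p units in one place for one unit in the next, so addition can only lose digit
    -- sum.
    S-sub : ∀ x y → S (x + y) ≤ S x + S y
    S-sub = digit-rec _ (λ y → ≤-refl) step
      where
      open ≤-Reasoning
      step : ∀ d x → d < p → (∀ y → S (x + y) ≤ S x + S y) → ∀ y → S (d + x * p + y) ≤ S (d + x * p) + S y
      step d x d< ih y' with divView p₁ y'
      ... | dv e y e< with (d + e) <? p
      ...   | yes de<p = begin
        S (d + x * p + (e + y * p)) ≡⟨ cong S (arr d (x) e y p) ⟩
        S ((d + e) + (x + y) * p)   ≡⟨ S-digit (d + e) (x + y) de<p ⟩
        d + e + S (x + y)           ≤⟨ +-monoʳ-≤ (d + e) (ih y) ⟩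
        d + e + (S x + S y)         ≡⟨ arr₂ d e (S x) (S y) ⟩
        (d + S x) + (e + S y)       ≡⟨ cong₂ _+_ (S-digit d x d<) (S-digit e y e<) ⟨
        S (d + x * p) + S (e + y * p) ∎
        where
        arr : ∀ d x e y q → d + x * q + (e + y * q) ≡ (d + e) + (x + y) * q
        arr = solve-∀
        arr₂ : ∀ d e a b → d + e + (a + b) ≡ (d + a) + (e + b)
        arr₂ = solve-∀
      ...   | no  de≮p = begin
        S (d + x * p + (e + y * p)) ≡⟨ cong S eq ⟩
        S (c + suc (x + y) * p)     ≡⟨ S-digit c (suc (x + y)) c<p ⟩
        c + S (suc (x + y))         ≤⟨ +-monoʳ-≤ c (≤-trans (S-suc (x + y)) (s≤s (ih y))) ⟩
        c + suc (S x + S y)         ≤⟨ bound ⟩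
        (d + S x) + (e + S y)       ≡⟨ cong₂ _+_ (S-digit d x d<) (S-digit e y e<) ⟨
        S (d + x * p) + S (e + y * p) ∎
        where
        c = (d + e) ∸ p
        p≤de : p ≤ d + e
        p≤de = ≮⇒≥ de≮p
        cp : c + p ≡ d + e
        cp = m∸n+n≡m p≤de
        c<p : c < p
        c<p = +-cancelʳ-< p c p (subst (_< p + p) (sym cp) (+-mono-< d< e<))
        arr : ∀ d x e y q → d + x * q + (e + y * q) ≡ (d + e) + (x + y) * q
        arr = solve-∀
        arr₃ : ∀ c q z → (c + q) + z * q ≡ c + suc z * q
        arr₃ = solve-∀
        eq : d + x * p + (e + y * p) ≡ c + suc (x + y) * p
        eq = trans (arr d x e y p) (trans (cong (_+ (x + y) * p) (sym cp)) (arr₃ c p (x + y)))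
        arr₄ : ∀ d e a b → d + e + (a + b) ≡ (d + a) + (e + b)
        arr₄ = solve-∀
        bound : c + suc (S x + S y) ≤ (d + S x) + (e + S y)
        bound = begin
          c + suc (S x + S y)   ≡⟨ +-suc c _ ⟩
          suc c + (S x + S y)   ≤⟨ +-monoˡ-≤ (S x + S y) (≤-trans (≤-trans (≤-reflexive (+-comm 1 c)) (+-monoʳ-≤ c (s≤s z≤n))) (≤-reflexive cp)) ⟩
          d + e + (S x + S y)   ≡⟨ arr₄ d e (S x) (S y) ⟩
          (d + S x) + (e + S y) ∎

    S-split : ∀ a x y → x < p ^ a → S (x + y * p ^ a) ≡ S x + S y
    S-split zero    zero y _ = cong S (*-identityʳ y)
    S-split zero    (suc x) y (s≤s ())
    S-split (suc a) x' y x< with divView p₁ x'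
    ... | dv d x d< = begin
      S (d + x * p + y * (p * p ^ a)) ≡⟨ cong S (arr d x y p (p ^ a)) ⟩
      S (d + (x + y * p ^ a) * p)     ≡⟨ S-digit d (x + y * p ^ a) d< ⟩
      d + S (x + y * p ^ a)           ≡⟨ cong (d +_) (S-split a x y x<pa) ⟩
      d + (S x + S y)                 ≡⟨ +-assoc d (S x) (S y) ⟨
      (d + S x) + S y                 ≡⟨ cong (_+ S y) (S-digit d x d<) ⟨
      S (d + x * p) + S y             ∎
      where
      open ≡-Reasoning
      arr : ∀ d x y q Q → d + x * q + y * (q * Q) ≡ d + (x + y * Q) * q
      arr = solve-∀
      x<pa : x < p ^ a
      x<pa = *-cancelʳ-< p x (p ^ a) (≤-<-trans (m≤n+m (x * p) d) (subst (d + x * p <_) (*-comm p (p ^ a)) x<))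

    S-pos : ∀ x → 0 < x → 0 < S x
    S-pos = digit-rec _ (λ ()) step
      where
      step : ∀ d y → d < p → (0 < y → 0 < S y) → 0 < d + y * p → 0 < S (d + y * p)
      step zero    zero    d< ih ()
      step zero    (suc y) d< ih _ = subst (0 <_) (sym (S-digit 0 (suc y) d<)) (ih (s≤s z≤n))
      step (suc d) y       d< ih _ = subst (0 <_) (sym (S-digit (suc d) y d<)) (s≤s z≤n)

    -- Subtracting i₀ > r from q + r borrows from the top digit.  Dropping the digits of i₀ that
    -- belong to the last run of borrows lowers the digit sum of the difference.
    borrow : ∀ a r i₀ → r < i₀ → i₀ < p ^ a →
      ∃₂ λ i j → i ≤ r × i₀ ≡ i + j × S i₀ ≡ S i + S j × S (r ∸ i) < S (p ^ a + r ∸ i₀)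
    borrow zero r (suc i₀) r< (s≤s ())
    borrow (suc a) r i₀ r<i i<Q = go (r / Q) (r % Q) (i₀ / Q) (i₀ % Q) (m%n<n r Q) (m%n<n i₀ Q)
          (m≡m%n+[m/n]*n r Q) (m≡m%n+[m/n]*n i₀ Q)
      where
      Q = p ^ a
      instance
        Q≢0 : NonZero Q
        Q≢0 = m^n≢0 p a
      Goal : ℕ → ℕ → Set
      Goal r i₀ = ∃₂ λ i j → i ≤ r × i₀ ≡ i + j × S i₀ ≡ S i + S j × S (r ∸ i) < S (p ^ suc a + r ∸ i₀)
      ∸-eq : ∀ x y z → x ≡ z + y → x ∸ y ≡ z
      ∸-eq x y z e = trans (cong (_∸ y) e) (m+n∸n≡m z y)
      go : ∀ rt rl it il → rl < Q → il < Q → r ≡ rl + rt * Q → i₀ ≡ il + it * Q → Goal r i₀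
      go rt rl it il rl< il< er ei = case-split
        where
        it<p : it < p
        it<p = *-cancelʳ-< Q it p (≤-<-trans (m≤n+m (it * Q) il) (subst (_< p * Q) ei i<Q))
        case-split : Goal r i₀
        case-split with il ≤? rl
        -- The top digit receives no borrow from below, so the last run of borrows is the top digit
        -- alone: it becomes j, and the low digits of i₀ are kept as i.
        ... | yes il≤rl = il , it * Q , subst (il ≤_) (sym er) (≤-trans il≤rl (m≤m+n rl _)) , ei
              , trans (cong S ei) (trans (S-split a il it il<) (cong (S il +_) (sym (S-split a 0 it (m^n>0 p a)))))
              , subst₂ _<_ (sym e₁) (sym e₂) (+-monoʳ-< (S (rl ∸ il)) rt<)
          where
          rt<it : rt < it
          rt<it = *-cancelʳ-< Q rt it (+-cancelˡ-< rl _ _ (<-≤-trans (subst₂ _<_ er ei r<i) (+-monoˡ-≤ (it * Q) il≤rl)))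
          low< : rl ∸ il < Q
          low< = ≤-<-trans (m∸n≤m rl il) rl<
          zt = p + rt ∸ it
          zt+ : zt + it ≡ p + rt
          zt+ = m∸n+n≡m (≤-trans (<⇒≤ it<p) (m≤m+n p rt))
          zt<p : zt < p
          zt<p = +-cancelʳ-< it zt p (subst (_< p + it) (sym zt+) (+-monoʳ-< p rt<it))
          rt< : rt < zt
          rt< = +-cancelʳ-< it rt zt (subst (rt + it <_) (trans (+-comm rt p) (sym zt+)) (+-monoʳ-< rt it<p))
          e₁ : S (r ∸ il) ≡ S (rl ∸ il) + rt
          e₁ = trans (cong S (trans (cong (_∸ il) (trans er (+-comm rl _))) (trans (+-∸-assoc (rt * Q) il≤rl) (+-comm (rt * Q) _))))
                 (trans (S-split a (rl ∸ il) rt low<) (cong (S (rl ∸ il) +_) (S-small rt (<-trans rt<it it<p))))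
          e₂ : S (p ^ suc a + r ∸ i₀) ≡ S (rl ∸ il) + zt
          e₂ = trans (cong S (∸-eq _ i₀ ((rl ∸ il) + zt * Q) eqz))
                 (trans (S-split a (rl ∸ il) zt low<) (cong (S (rl ∸ il) +_) (S-small zt zt<p)))
            where
            open ≡-Reasoning
            a₁ : ∀ P Q l t → P * Q + (l + t * Q) ≡ l + (P + t) * Q
            a₁ = solve-∀
            a₂ : ∀ x z i Q l → (x + l) + (z + i) * Q ≡ (x + z * Q) + (l + i * Q)
            a₂ = solve-∀
            eqz : p ^ suc a + r ≡ ((rl ∸ il) + zt * Q) + i₀
            eqz = begin
              p * Q + r                          ≡⟨ cong (p * Q +_) er ⟩
              p * Q + (rl + rt * Q)              ≡⟨ a₁ p Q rl rt ⟩
              rl + (p + rt) * Q                  ≡⟨ cong₂ (λ u v → u + v * Q) (sym (m∸n+n≡m il≤rl)) (sym zt+) ⟩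
              (rl ∸ il + il) + (zt + it) * Q     ≡⟨ a₂ (rl ∸ il) zt it Q il ⟩
              ((rl ∸ il) + zt * Q) + (il + it * Q) ≡⟨ cong ((rl ∸ il) + zt * Q +_) (sym ei) ⟩
              ((rl ∸ il) + zt * Q) + i₀          ∎
        -- The run of borrows continues below the top digit: i comes from the recursion, and the top
        -- digit of i₀ joins j.
        ... | no il≰rl with borrow a rl il (≰⇒> il≰rl) il<
        ...   | i , j , i≤ , eij , Sij , S< = i , j + it * Q , subst (i ≤_) (sym er) (≤-trans i≤ (m≤m+n rl _))
              , trans ei (trans (cong (_+ it * Q) eij) (+-assoc i j _))
              , trans (cong S ei) (trans (S-split a il it il<) (trans (cong (_+ S it) Sij)
                  (trans (+-assoc (S i) (S j) (S it)) (cong (S i +_) (sym (S-split a j it j<))))))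
              , subst₂ _<_ (sym e₁) (sym e₂) (+-mono-<-≤ S< rt≤)
          where
          rl<il = ≰⇒> il≰rl
          j< : j < Q
          j< = ≤-<-trans (subst (j ≤_) (sym eij) (m≤n+m j i)) il<
          rt≤it : rt ≤ it
          rt≤it = ≮⇒≥ λ it<rt → <⇒≱ r<i (subst₂ _≤_ (sym ei) (sym er)
            (≤-trans (+-monoˡ-≤ (it * Q) (<⇒≤ il<)) (≤-trans (*-monoˡ-≤ Q it<rt) (m≤n+m _ rl))))
          zl = Q + rl ∸ il
          zl+ : zl + il ≡ Q + rl
          zl+ = m∸n+n≡m (≤-trans (<⇒≤ il<) (m≤m+n Q rl))
          zl< : zl < Q
          zl< = +-cancelʳ-< il zl Q (subst (_< Q + il) (sym zl+) (+-monoʳ-< Q rl<il))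
          zt = p₁ + rt ∸ it
          zt+ : zt + it ≡ p₁ + rt
          zt+ = m∸n+n≡m (≤-trans (≤-pred it<p) (m≤m+n p₁ rt))
          zt<p : zt < p
          zt<p = +-cancelʳ-< it zt p (subst (_< p + it) (sym zt+) (s≤s (+-monoʳ-≤ p₁ rt≤it)))
          rt≤ : rt ≤ zt
          rt≤ = +-cancelʳ-≤ it rt zt (subst (rt + it ≤_) (trans (+-comm rt p₁) (sym zt+)) (+-monoʳ-≤ rt (≤-pred it<p)))
          e₁ : S (r ∸ i) ≡ S (rl ∸ i) + rt
          e₁ = trans (cong S (trans (cong (_∸ i) (trans er (+-comm rl _))) (trans (+-∸-assoc (rt * Q) i≤) (+-comm (rt * Q) _))))
                 (trans (S-split a (rl ∸ i) rt (≤-<-trans (m∸n≤m rl i) rl<)) (cong (S (rl ∸ i) +_) (S-small rt (≤-<-trans rt≤it it<p))))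
          e₂ : S (p ^ suc a + r ∸ i₀) ≡ S zl + zt
          e₂ = trans (cong S (∸-eq _ i₀ (zl + zt * Q) eqz))
                 (trans (S-split a zl zt zl<) (cong (S zl +_) (S-small zt zt<p)))
            where
            open ≡-Reasoning
            a₁ : ∀ P Q l t → Q + P * Q + (l + t * Q) ≡ (Q + l) + (P + t) * Q
            a₁ = solve-∀
            a₂ : ∀ x z i Q l → (x + l) + (z + i) * Q ≡ (x + z * Q) + (l + i * Q)
            a₂ = solve-∀
            eqz : p ^ suc a + r ≡ (zl + zt * Q) + i₀
            eqz = begin
              p * Q + r                        ≡⟨ cong (p * Q +_) er ⟩
              p * Q + (rl + rt * Q)            ≡⟨ a₁ p₁ Q rl rt ⟩
              (Q + rl) + (p₁ + rt) * Q         ≡⟨ cong₂ (λ u v → u + v * Q) (sym zl+) (sym zt+) ⟩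
              (zl + il) + (zt + it) * Q        ≡⟨ a₂ zl zt it Q il ⟩
              (zl + zt * Q) + (il + it * Q)    ≡⟨ cong (zl + zt * Q +_) (sym ei) ⟩
              (zl + zt * Q) + i₀               ∎

-- The p-adic valuation and Legendre's formula in terms of digit sums.

module Valuations where
  open DigitSums
  open import Data.Nat
  open import Data.Nat.Properties
  open import Data.Nat.DivMod
  open import Data.Nat.Divisibility
  open import Data.Nat.Primality
  open import Data.Nat.Combinatorics using (_C_; nCk≡n!/k![n-k]!; k![n∸k]!∣n!)

  open import Data.Nat.Induction using (<-rec)
  open import Data.Nat.Tactic.RingSolver using (solve-∀)
  open import Data.Product
  open import Data.Sum using (inj₁; inj₂)
  open import Data.Empty using (⊥-elim)
  open import Relation.Nullary
  open import Relation.Binary.PropositionalEquality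

  C-factorials : ∀ a b → ((a + b) C a) * (a ! * b !) ≡ (a + b) !
  C-factorials a b = begin
    ((a + b) C a) * (a ! * b !) ≡⟨ cong (λ z → ((a + b) C a) * (a ! * z !)) (m+n∸m≡n a b) ⟨
    ((a + b) C a) * (a ! * (a + b ∸ a) !) ≡⟨ cong (_* (a ! * (a + b ∸ a) !)) (nCk≡n!/k![n-k]! (m≤m+n a b)) ⟩
    ((a + b) ! / (a ! * (a + b ∸ a) !)) * (a ! * (a + b ∸ a) !) ≡⟨ m/n*n≡m (k![n∸k]!∣n! (m≤m+n a b)) ⟩
    (a + b) ! ∎
    where
    open ≡-Reasoning
    instance _ = a !* (a + b ∸ a) !≢0

  fact≢0 : ∀ n → n ! ≢ 0
  fact≢0 n = ≢-nonZero⁻¹ (n !) {{n !≢0}}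

  C≢0 : ∀ a b → (a + b) C a ≢ 0
  C≢0 a b e = fact≢0 (a + b) (trans (sym (C-factorials a b)) (cong (_* (a ! * b !)) e))

  *≢0 : ∀ {x y} → x ≢ 0 → y ≢ 0 → x * y ≢ 0
  *≢0 {x} {y} a b e with m*n≡0⇒m≡0∨n≡0 x e
  ... | inj₁ z = a z
  ... | inj₂ z = b z

  module Val (p₂ : ℕ) (pp : Prime (suc (suc p₂))) where
    open Digits p₂ public

    record Split (x : ℕ) : Set where
      constructor split
      field
        exp cof : ℕ
        eq      : x ≡ p ^ exp * cof
        ∤cof    : ¬ p ∣ cof

    splitting : ∀ x → x ≢ 0 → Split x
    splitting = <-rec _ go
      where
      go : ∀ x → (∀ {y} → y < x → y ≢ 0 → Split y) → x ≢ 0 → Split x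
      go x rec x≢0 with p ∣? x
      ... | no  p∤x = split 0 x (sym (+-identityʳ x)) p∤x
      ... | yes (divides q refl) with rec (m<m*n q p {{≢-nonZero q≢0}} 1<p) q≢0
        where
        q≢0 : q ≢ 0
        q≢0 e = x≢0 (cong (_* p) e)
      ...   | split e u eq nd = split (suc e) u (trans (cong (_* p) eq) (arr (p ^ e) u p)) nd
        where
        arr : ∀ a b c → a * b * c ≡ c * a * b
        arr = solve-∀

    -- junk value ν 0 = 0
    ν : ℕ → ℕ
    ν zero    = 0
    ν (suc x) = Split.exp (splitting (suc x) λ ())

    ν-split : ∀ x → x ≢ 0 → ∃ λ u → x ≡ p ^ ν x * u × ¬ p ∣ u
    ν-split zero    ne = ⊥-elim (ne refl)
    ν-split (suc x) ne = let split e u eq nd = splitting (suc x) (λ ()) in u , eq , nd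

    pow≢0 : ∀ e → p ^ e ≢ 0
    pow≢0 e = ≢-nonZero⁻¹ (p ^ e) {{m^n≢0 p e}}

    split-unique : ∀ e f u w → p ^ e * u ≡ p ^ f * w → ¬ p ∣ u → ¬ p ∣ w → e ≡ f
    split-unique zero zero u w eq _ _ = refl
    split-unique zero (suc f) u w eq nu _ = ⊥-elim (nu (divides (p ^ f * w)
      (trans (sym (+-identityʳ u)) (trans eq (trans (*-assoc p (p ^ f) w) (*-comm p (p ^ f * w)))))))
    split-unique (suc e) zero u w eq _ nw = ⊥-elim (nw (divides (p ^ e * u)
      (trans (sym (+-identityʳ w)) (trans (sym eq) (trans (*-assoc p (p ^ e) u) (*-comm p (p ^ e * u)))))))
    split-unique (suc e) (suc f) u w eq nu nw = cong suc (split-unique e f u w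
      (*-cancelˡ-≡ _ _ p (trans (sym (*-assoc p (p ^ e) u)) (trans eq (*-assoc p (p ^ f) w)))) nu nw)

    ν-unique : ∀ {x} e u → x ≡ p ^ e * u → ¬ p ∣ u → ν x ≡ e
    ν-unique {x} e u eq nu = let w , eqw , nw = ν-split x x≢0 in split-unique _ e w u (trans (sym eqw) eq) nw nu
      where
      x≢0 : x ≢ 0
      x≢0 x0 = *≢0 (pow≢0 e) (λ u0 → nu (subst (p ∣_) (sym u0) (p ∣0))) (trans (sym eq) x0)

    ν-* : ∀ {x y} → x ≢ 0 → y ≢ 0 → ν (x * y) ≡ ν x + ν y
    ν-* {x} {y} x≢0 y≢0 = let u , eu , nu = ν-split x x≢0 ; w , ew , nw = ν-split y y≢0 in
      ν-unique (ν x + ν y) (u * w)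
        (trans (cong₂ _*_ eu ew) (trans (arr (p ^ ν x) u (p ^ ν y) w) (cong (_* (u * w)) (sym (^-distribˡ-+-* p (ν x) (ν y))))))
        (λ d → [_,_]′ nu nw (euclidsLemma u w pp d))
      where
      open import Data.Sum using ([_,_]′)
      arr : ∀ a b c d → (a * b) * (c * d) ≡ (a * c) * (b * d)
      arr = solve-∀

    ν-∤ : ∀ {x} → ¬ p ∣ x → ν x ≡ 0
    ν-∤ {x} nd = ν-unique 0 x (sym (+-identityʳ x)) nd

    ν-p* : ∀ x → x ≢ 0 → ν (x * p) ≡ suc (ν x)
    ν-p* x x≢0 = let u , eu , nu = ν-split x x≢0 in
      ν-unique (suc (ν x)) u (trans (*-comm x p) (trans (cong (p *_) eu) (sym (*-assoc p (p ^ ν x) u)))) nu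

    pow-∣ : ∀ {e f} → e ≤ f → p ^ e ∣ p ^ f
    pow-∣ {e} {f} e≤f = divides (p ^ (f ∸ e)) (trans (cong (p ^_) (sym (m∸n+n≡m e≤f))) (^-distribˡ-+-* p (f ∸ e) e))

    ν-∣ : ∀ {e x} → x ≢ 0 → e ≤ ν x → p ^ e ∣ x
    ν-∣ {e} {x} x≢0 e≤ = let u , eu , _ = ν-split x x≢0 in
      ∣-trans (pow-∣ e≤) (divides u (trans eu (*-comm _ u)))

    ∣-ν : ∀ {e x} → x ≢ 0 → p ^ e ∣ x → e ≤ ν x
    ∣-ν {e} x≢0 (divides q refl) = subst (e ≤_) (sym (trans (ν-* q≢0 (pow≢0 e)) (cong (ν q +_) νpow))) (m≤n+m e (ν q))
      where
      q≢0 : q ≢ 0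
      q≢0 z = x≢0 (cong (_* p ^ e) z)
      p∤1 : ¬ p ∣ 1
      p∤1 d = <⇒≱ 1<p (∣⇒≤ d)
      νpow : ν (p ^ e) ≡ e
      νpow = ν-unique {p ^ e} e 1 (sym (*-identityʳ (p ^ e))) p∤1

    -- Adding 1 turns the final run of digits p - 1 into zeros and raises the next digit. The run
    -- has length ν(x + 1), and each of its digits costs p - 1. Summed over x this telescopes to
    -- `legendre`.
    ν-S : ∀ x → S (suc x) + p₁ * ν (suc x) ≡ suc (S x)
    ν-S = <-rec _ go
      where
      open ≡-Reasoning
      go : ∀ x → (∀ {y} → y < x → S (suc y) + p₁ * ν (suc y) ≡ suc (S y)) → S (suc x) + p₁ * ν (suc x) ≡ suc (S x)
      go x rec with divView p₁ x
      ... | dv d y d< with m≤n⇒m<n∨m≡n d<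
      ...   | inj₁ sd< = begin
          S (suc d + y * p) + p₁ * ν (suc d + y * p) ≡⟨ cong₂ (λ a b → a + p₁ * b) (S-digit (suc d) y sd<) (ν-∤ ndiv) ⟩
          suc d + S y + p₁ * 0                       ≡⟨ cong (suc d + S y +_) (*-zeroʳ p₁) ⟩
          suc d + S y + 0                            ≡⟨ +-identityʳ _ ⟩
          suc (d + S y)                              ≡⟨ cong suc (S-digit d y d<) ⟨
          suc (S (d + y * p))                        ∎
          where
          ndiv : ¬ p ∣ suc d + y * p
          ndiv dd = <⇒≱ sd< (∣⇒≤ (∣m+n∣m⇒∣n (subst (p ∣_) (+-comm (suc d) (y * p)) dd) (n∣m*n y)))
      ...   | inj₂ refl = begin
          S (p + y * p) + p₁ * ν (p + y * p)   ≡⟨ cong₂ (λ a b → a + p₁ * b) (S-digit 0 (suc y) (s≤s z≤n)) (ν-p* (suc y) λ ()) ⟩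
          S (suc y) + p₁ * suc (ν (suc y))     ≡⟨ arr (S (suc y)) p₁ (ν (suc y)) ⟩
          p₁ + (S (suc y) + p₁ * ν (suc y))    ≡⟨ cong (p₁ +_) (rec y<) ⟩
          p₁ + suc (S y)                       ≡⟨ +-suc p₁ (S y) ⟩
          suc (p₁ + S y)                       ≡⟨ cong suc (S-digit p₁ y d<) ⟨
          suc (S (p₁ + y * p))                 ∎
          where
          y< : y < p₁ + y * p
          y< = s≤s (≤-trans (m≤m*n y p) (m≤n+m _ p₂))
          arr : ∀ a q v → a + q * suc v ≡ q + (a + q * v)
          arr = solve-∀

    legendre : ∀ n → p₁ * ν (n !) + S n ≡ n
    legendre zero    = cong (_+ 0) (trans (cong (p₁ *_) (ν-∤ {1} λ d → <⇒≱ 1<p (∣⇒≤ d))) (*-zeroʳ p₁))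
    legendre (suc n) = begin
      p₁ * ν (suc n * n !) + S (suc n)            ≡⟨ cong (λ z → p₁ * z + S (suc n)) (ν-* {suc n} {n !} (λ ()) (fact≢0 n)) ⟩
      p₁ * (ν (suc n) + ν (n !)) + S (suc n)      ≡⟨ arr p₁ (ν (suc n)) (ν (n !)) (S (suc n)) ⟩
      p₁ * ν (n !) + (S (suc n) + p₁ * ν (suc n)) ≡⟨ cong (p₁ * ν (n !) +_) (ν-S n) ⟩
      p₁ * ν (n !) + suc (S n)                    ≡⟨ +-suc _ (S n) ⟩
      suc (p₁ * ν (n !) + S n)                    ≡⟨ cong suc (legendre n) ⟩
      suc n                                       ∎
      where
      open ≡-Reasoning
      arr : ∀ q a b c → q * (a + b) + c ≡ q * b + (c + q * a)
      arr = solve-∀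

    -- Legendre's formula for the three factorials: p - 1 times the valuation is the digit sum lost
    -- in forming a + b.
    ν-C : ∀ a b → p₁ * ν ((a + b) C a) + S (a + b) ≡ S a + S b
    ν-C a b = +-cancelˡ-≡ (p₁ * ν (a !) + p₁ * ν (b !)) _ _ (begin
      (p₁ * ν (a !) + p₁ * ν (b !)) + (p₁ * ν ((a + b) C a) + S (a + b))
        ≡⟨ arr p₁ (ν (a !)) (ν (b !)) (ν ((a + b) C a)) (S (a + b)) ⟩
      p₁ * (ν ((a + b) C a) + (ν (a !) + ν (b !))) + S (a + b)
        ≡⟨ cong (λ z → p₁ * z + S (a + b)) (sym (trans (ν-* (C≢0 a b) (*≢0 (fact≢0 a) (fact≢0 b))) (cong (ν ((a + b) C a) +_) (ν-* (fact≢0 a) (fact≢0 b))))) ⟩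
      p₁ * ν (((a + b) C a) * (a ! * b !)) + S (a + b)
        ≡⟨ cong (λ z → p₁ * ν z + S (a + b)) (C-factorials a b) ⟩
      p₁ * ν ((a + b) !) + S (a + b)   ≡⟨ legendre (a + b) ⟩
      a + b                            ≡⟨ cong₂ _+_ (sym (legendre a)) (sym (legendre b)) ⟩
      (p₁ * ν (a !) + S a) + (p₁ * ν (b !) + S b) ≡⟨ arr₂ (p₁ * ν (a !)) (S a) (p₁ * ν (b !)) (S b) ⟩
      (p₁ * ν (a !) + p₁ * ν (b !)) + (S a + S b) ∎)
      where
      open ≡-Reasoning
      arr : ∀ q a b c s → (q * a + q * b) + (q * c + s) ≡ q * (c + (a + b)) + s
      arr = solve-∀
      arr₂ : ∀ a b c d → (a + b) + (c + d) ≡ (a + c) + (b + d)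
      arr₂ = solve-∀

-- Dumas' theorem for products of integer polynomials given by coefficient functions.

module DumasLemma where
  open DigitSums
  open Valuations
  open import Data.Nat
  open import Data.Nat.Properties
  open import Data.Nat.Divisibility
  open import Data.Nat.Primality
  open import Data.Nat.Tactic.RingSolver using (solve-∀)
  open import Data.Integer as ℤ using (ℤ; ∣_∣; 0ℤ)
  import Data.Integer.Properties as ℤ
  import Data.Integer.Divisibility.Signed as ℤᵈ
  open import Data.Product
  open import Data.Sum using (_⊎_; inj₁; inj₂)
  open import Data.Empty using (⊥; ⊥-elim)
  open import Relation.Nullary
  open import Relation.Binary.PropositionalEquality
  open import Relation.Binary.Definitions using (tri<; tri≈; tri>)

  convTo : (ℕ → ℤ) → (ℕ → ℤ) → ℕ → ℕ → ℤ
  convTo F H m zero    = F 0 ℤ.* H m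
  convTo F H m (suc i) = convTo F H m i ℤ.+ F (suc i) ℤ.* H (m ∸ suc i)

  conv : (ℕ → ℤ) → (ℕ → ℤ) → ℕ → ℤ
  conv F H m = convTo F H m m

  ∣-+ : ∀ {d} a b → d ∣ ∣ a ∣ → d ∣ ∣ b ∣ → d ∣ ∣ a ℤ.+ b ∣
  ∣-+ {d} a b x y = ℤᵈ.∣⇒∣ᵤ {ℤ.+ d} {a ℤ.+ b} (ℤᵈ.∣m∣n⇒∣m+n (ℤᵈ.∣ᵤ⇒∣ {ℤ.+ d} {a} x) (ℤᵈ.∣ᵤ⇒∣ {ℤ.+ d} {b} y))

  ∣-cancel : ∀ {d} a b → d ∣ ∣ a ℤ.+ b ∣ → d ∣ ∣ a ∣ → d ∣ ∣ b ∣
  ∣-cancel {d} a b x y = ℤᵈ.∣⇒∣ᵤ {ℤ.+ d} {b} (ℤᵈ.∣m+n∣m⇒∣n {m = a} (ℤᵈ.∣ᵤ⇒∣ {ℤ.+ d} {a ℤ.+ b} x) (ℤᵈ.∣ᵤ⇒∣ {ℤ.+ d} {a} y))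

  convTo-∣ : ∀ {d} F H m l → (∀ i → i ≤ l → d ∣ ∣ F i ℤ.* H (m ∸ i) ∣) → d ∣ ∣ convTo F H m l ∣
  convTo-∣ F H m zero    all = all 0 z≤n
  convTo-∣ F H m (suc l) all = ∣-+ (convTo F H m l) _ (convTo-∣ F H m l λ i i≤ → all i (m≤n⇒m≤1+n i≤)) (all (suc l) ≤-refl)

  convTo-∣-term : ∀ {d} F H m l X → X ≤ l → d ∣ ∣ convTo F H m l ∣ →
    (∀ i → i ≤ l → i ≢ X → d ∣ ∣ F i ℤ.* H (m ∸ i) ∣) → d ∣ ∣ F X ℤ.* H (m ∸ X) ∣
  convTo-∣-term F H m zero    zero z≤n tot oth = tot
  convTo-∣-term {d} F H m (suc l) X X≤ tot oth with X ≟ suc l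
  ... | yes refl = ∣-cancel (convTo F H m l) _ tot (convTo-∣ F H m l λ i i≤ → oth i (m≤n⇒m≤1+n i≤) (<⇒≢ (s≤s i≤)))
  ... | no X≢ = convTo-∣-term F H m l X (≤-pred (≤∧≢⇒< X≤ X≢))
        (∣-cancel t (convTo F H m l) (subst (λ z → d ∣ ∣ z ∣) (ℤ.+-comm (convTo F H m l) t) tot) (oth (suc l) ≤-refl (≢-sym X≢)))
        λ i i≤ → oth i (m≤n⇒m≤1+n i≤)
    where t = F (suc l) ℤ.* H (m ∸ suc l)

  module Dumas (p₂ : ℕ) (pp : Prime (suc (suc p₂))) where
    open Val p₂ pp public

    νℤ : ℤ → ℕ
    νℤ z = ν ∣ z ∣

    abs≢0 : ∀ {z} → z ≢ 0ℤ → ∣ z ∣ ≢ 0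
    abs≢0 ne e = ne (ℤ.∣i∣≡0⇒i≡0 e)

    νℤ-* : ∀ {x y} → x ≢ 0ℤ → y ≢ 0ℤ → νℤ (x ℤ.* y) ≡ νℤ x + νℤ y
    νℤ-* {x} {y} a b = trans (cong ν (ℤ.abs-* x y)) (ν-* (abs≢0 a) (abs≢0 b))

    *ℤ≢0 : ∀ {x y} → x ≢ 0ℤ → y ≢ 0ℤ → x ℤ.* y ≢ 0ℤ
    *ℤ≢0 {x} a b e with ℤ.i*j≡0⇒i≡0∨j≡0 x e
    ... | inj₁ z = a z
    ... | inj₂ z = b z

    module Weight (α β : ℕ) .{{_ : NonZero α}} where

      w : (ℕ → ℤ) → ℕ → ℕ
      w F j = α * νℤ (F j) + β * j

      -- X is the right end of the face of the Newton polygon with slope -β/α. Zero coefficients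
      -- have infinite valuation but the junk value `ν 0`, so they are left out of the comparison.
      -- Breaking ties towards the larger index makes X unique, and it is uniqueness that reads off
      -- the sum of the two indices from the product.
      record Arg (F : ℕ → ℤ) (X : ℕ) : Set where
        field
          nz     : F X ≢ 0ℤ
          least  : ∀ j → F j ≢ 0ℤ → w F X ≤ w F j
          strict : ∀ j → X < j → F j ≢ 0ℤ → w F X < w F j
      open Arg public

      arg-unique : ∀ {F X Y} → Arg F X → Arg F Y → X ≡ Y
      arg-unique {F} {X} {Y} a b with <-cmp X Y
      ... | tri< X<Y _ _ = ⊥-elim (<⇒≱ (strict a Y X<Y (nz b)) (least b X (nz a)))
      ... | tri≈ _ e _ = e
      ... | tri> _ _ Y<X = ⊥-elim (<⇒≱ (strict b X Y<X (nz a)) (least a Y (nz b)))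

      arg-exists : ∀ F k → F k ≢ 0ℤ → (∀ j → k < j → F j ≡ 0ℤ) → ∃ λ X → X ≤ k × Arg F X
      arg-exists F k Fk above with search k
        where
        Best : ℕ → Set
        Best l = ∃ λ X → X ≤ l × F X ≢ 0ℤ × (∀ j → j ≤ l → F j ≢ 0ℤ → w F X ≤ w F j × (X < j → w F X < w F j))
        search : ∀ l → (∀ j → j ≤ l → F j ≡ 0ℤ) ⊎ Best l
        extend : ∀ l → F (suc l) ≢ 0ℤ → (∀ j → j ≤ l → F j ≡ 0ℤ) ⊎ Best l → Best (suc l)
        search zero with F 0 ℤ.≟ 0ℤ
        ... | yes z = inj₁ λ { zero _ → z ; (suc j) () }
        ... | no nz0 = inj₂ (0 , z≤n , nz0 , λ { zero _ _ → ≤-refl , λ () ; (suc j) () _ })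
        search (suc l) with F (suc l) ℤ.≟ 0ℤ | search l
        ... | no nz1 | r = inj₂ (extend l nz1 r)
        ... | yes z | inj₁ all = inj₁ go
          where
          go : ∀ j → j ≤ suc l → F j ≡ 0ℤ
          go j j≤ with j ≟ suc l
          ... | yes refl = z
          ... | no  j≢ = all j (≤-pred (≤∧≢⇒< j≤ j≢))
        ... | yes z | inj₂ (X , X≤ , nzX , best) = inj₂ (X , m≤n⇒m≤1+n X≤ , nzX , go)
          where
          go : ∀ j → j ≤ suc l → F j ≢ 0ℤ → w F X ≤ w F j × (X < j → w F X < w F j)
          go j j≤ nzj with j ≟ suc l
          ... | yes refl = ⊥-elim (nzj z)
          ... | no  j≢ = best j (≤-pred (≤∧≢⇒< j≤ j≢)) nzj
        extend l nz1 (inj₁ all) = suc l , ≤-refl , nz1 , go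
          where
          go : ∀ j → j ≤ suc l → F j ≢ 0ℤ → w F (suc l) ≤ w F j × (suc l < j → w F (suc l) < w F j)
          go j j≤ nzj with j ≟ suc l
          ... | yes refl = ≤-refl , λ l<l → ⊥-elim (<-irrefl refl l<l)
          ... | no  j≢ = ⊥-elim (nzj (all j (≤-pred (≤∧≢⇒< j≤ j≢))))
        extend l nz1 (inj₂ (X , X≤ , nzX , best)) with w F X <? w F (suc l)
        ... | yes lt = X , m≤n⇒m≤1+n X≤ , nzX , go
          where
          go : ∀ j → j ≤ suc l → F j ≢ 0ℤ → w F X ≤ w F j × (X < j → w F X < w F j)
          go j j≤ nzj with j ≟ suc l
          ... | yes refl = <⇒≤ lt , λ _ → lt
          ... | no  j≢ = best j (≤-pred (≤∧≢⇒< j≤ j≢)) nzj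
        ... | no ge = suc l , ≤-refl , nz1 , go
          where
          go : ∀ j → j ≤ suc l → F j ≢ 0ℤ → w F (suc l) ≤ w F j × (suc l < j → w F (suc l) < w F j)
          go j j≤ nzj with j ≟ suc l
          ... | yes refl = ≤-refl , λ l<l → ⊥-elim (<-irrefl refl l<l)
          ... | no  j≢ = ≤-trans (≮⇒≥ ge) (proj₁ (best j (≤-pred (≤∧≢⇒< j≤ j≢)) nzj)) , λ l<j → ⊥-elim (<⇒≱ l<j j≤)
      ... | inj₁ all = ⊥-elim (Fk (all k ≤-refl))
      ... | inj₂ (X , X≤ , nzX , best) = X , X≤ , record
        { nz = nzX
        ; least = λ j nzj → proj₁ (best j (inside j nzj) nzj)
        ; strict = λ j X<j nzj → proj₂ (best j (inside j nzj) nzj) X<j }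
        where
        inside : ∀ j → F j ≢ 0ℤ → j ≤ k
        inside j nzj = ≮⇒≥ λ k<j → nzj (above j k<j)

      -- Dumas' theorem, for a single slope of the Newton polygon.
      dumas : ∀ {F H X Y} → Arg F X → Arg H Y →
              Arg (conv F H) (X + Y) × νℤ (conv F H (X + Y)) ≡ νℤ (F X) + νℤ (H Y)
      dumas {F} {H} {X} {Y} aF aH = record { nz = nz₀ ; least = least₀ ; strict = strict₀ } , ν₀
        where
        M e : ℕ
        M = w F X + w H Y
        e = νℤ (F X) + νℤ (H Y)
        arr : ∀ a b u v i j → (a * u + b * i) + (a * v + b * j) ≡ a * (u + v) + b * (i + j)
        arr = solve-∀
        M≡ : M ≡ α * e + β * (X + Y)
        M≡ = arr α β (νℤ (F X)) (νℤ (H Y)) X Y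
        term-w : ∀ m i → i ≤ m → F i ≢ 0ℤ → H (m ∸ i) ≢ 0ℤ → w F i + w H (m ∸ i) ≡ α * νℤ (F i ℤ.* H (m ∸ i)) + β * m
        term-w m i i≤m a b = trans (arr α β (νℤ (F i)) (νℤ (H (m ∸ i))) i (m ∸ i))
          (cong₂ (λ u v → α * u + β * v) (sym (νℤ-* a b)) (m+[n∸m]≡n i≤m))
        big-∣ : ∀ m t i → (F i ≢ 0ℤ → H (m ∸ i) ≢ 0ℤ → α * t + β * m < α * νℤ (F i ℤ.* H (m ∸ i)) + β * m) →
                p ^ suc t ∣ ∣ F i ℤ.* H (m ∸ i) ∣
        big-∣ m t i lt with F i ℤ.≟ 0ℤ | H (m ∸ i) ℤ.≟ 0ℤ
        ... | yes z | _ = subst (λ u → p ^ suc t ∣ ∣ u ∣) (sym (trans (cong (ℤ._* H (m ∸ i)) z) (ℤ.*-zeroˡ (H (m ∸ i))))) ((p ^ suc t) ∣0)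
        ... | no _ | yes z = subst (λ u → p ^ suc t ∣ ∣ u ∣) (sym (trans (cong (F i ℤ.*_) z) (ℤ.*-zeroʳ (F i)))) ((p ^ suc t) ∣0)
        ... | no a | no b = ν-∣ (abs≢0 (*ℤ≢0 a b)) (*-cancelˡ-< α t _ (+-cancelʳ-< (β * m) _ _ (lt a b)))
        terms-strict : ∀ m i → i ≤ m → (X < i ⊎ Y < m ∸ i) → F i ≢ 0ℤ → H (m ∸ i) ≢ 0ℤ →
                       M < α * νℤ (F i ℤ.* H (m ∸ i)) + β * m
        terms-strict m i i≤m (inj₁ X<i) a b = subst (M <_) (term-w m i i≤m a b) (+-mono-<-≤ (strict aF i X<i a) (least aH (m ∸ i) b))
        terms-strict m i i≤m (inj₂ Y<j) a b = subst (M <_) (term-w m i i≤m a b) (+-mono-≤-< (least aF i a) (strict aH (m ∸ i) Y<j b))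
        m₀ = X + Y
        m₀∸X : m₀ ∸ X ≡ Y
        m₀∸X = m+n∸m≡n X Y
        main≢0 : F X ℤ.* H (m₀ ∸ X) ≢ 0ℤ
        main≢0 = *ℤ≢0 (nz aF) (subst (λ z → H z ≢ 0ℤ) (sym m₀∸X) (nz aH))
        ν-main : νℤ (F X ℤ.* H (m₀ ∸ X)) ≡ e
        ν-main = trans (cong (λ z → νℤ (F X ℤ.* H z)) m₀∸X) (νℤ-* (nz aF) (nz aH))
        -- Away from X one of the two indices lies beyond its last minimiser, where strictness
        -- supplies a further factor p. The term at X alone therefore fixes the valuation of the
        -- sum.
        others : ∀ i → i ≤ m₀ → i ≢ X → p ^ suc e ∣ ∣ F i ℤ.* H (m₀ ∸ i) ∣
        others i i≤ i≢ = big-∣ m₀ e i λ a b → subst (_< α * νℤ (F i ℤ.* H (m₀ ∸ i)) + β * m₀) M≡ (terms-strict m₀ i i≤ side a b)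
          where
          side : X < i ⊎ Y < m₀ ∸ i
          side with <-cmp X i
          ... | tri< X<i _ _ = inj₁ X<i
          ... | tri≈ _ X≡i _ = ⊥-elim (i≢ (sym X≡i))
          ... | tri> _ _ i<X = inj₂ (+-cancelˡ-< i _ _ (subst (i + Y <_) (sym (m+[n∸m]≡n i≤)) (+-monoˡ-< Y i<X)))
        ¬big : ¬ (p ^ suc e ∣ ∣ conv F H m₀ ∣)
        ¬big d = <⇒≱ (n<1+n e) (subst (suc e ≤_) ν-main (∣-ν (abs≢0 main≢0) (convTo-∣-term F H m₀ m₀ X (m≤m+n X Y) d others)))
        nz₀ : conv F H m₀ ≢ 0ℤ
        nz₀ z = ¬big (subst (λ u → p ^ suc e ∣ ∣ u ∣) (sym z) ((p ^ suc e) ∣0))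
        e≤ : e ≤ νℤ (conv F H m₀)
        e≤ = ∣-ν (abs≢0 nz₀) (convTo-∣ F H m₀ m₀ each)
          where
          each : ∀ i → i ≤ m₀ → p ^ e ∣ ∣ F i ℤ.* H (m₀ ∸ i) ∣
          each i i≤ with i ≟ X
          ... | yes refl = ν-∣ (abs≢0 main≢0) (≤-reflexive (sym ν-main))
          ... | no  i≢ = ∣-trans (pow-∣ (n≤1+n e)) (others i i≤ i≢)
        ν₀ : νℤ (conv F H m₀) ≡ e
        ν₀ = ≤-antisym (≮⇒≥ λ e< → ¬big (ν-∣ (abs≢0 nz₀) e<)) e≤
        w₀ : w (conv F H) m₀ ≡ M
        w₀ = trans (cong (λ z → α * z + β * m₀) ν₀) (sym M≡)
        -- If every nonzero term weighed more than the sum, each term, and hence the sum, would be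
        -- divisible by a higher power of p than the valuation of the sum allows.
        below : ∀ m → conv F H m ≢ 0ℤ →
          (∀ i → i ≤ m → F i ≢ 0ℤ → H (m ∸ i) ≢ 0ℤ → w (conv F H) m < α * νℤ (F i ℤ.* H (m ∸ i)) + β * m) → ⊥
        below m nzm all = <⇒≱ (n<1+n _) (∣-ν {suc (νℤ (conv F H m))} (abs≢0 nzm)
          (convTo-∣ F H m m λ i i≤ → big-∣ m _ i (all i i≤)))
        least₀ : ∀ m → conv F H m ≢ 0ℤ → w (conv F H) m₀ ≤ w (conv F H) m
        least₀ m nzm = ≮⇒≥ λ lt → below m nzm λ i i≤ a b →
          <-≤-trans (subst (w (conv F H) m <_) w₀ lt)
            (subst (M ≤_) (term-w m i i≤ a b) (+-mono-≤ (least aF i a) (least aH (m ∸ i) b)))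
        strict₀ : ∀ m → m₀ < m → conv F H m ≢ 0ℤ → w (conv F H) m₀ < w (conv F H) m
        strict₀ m m₀<m nzm = ≰⇒> λ le → below m nzm λ i i≤ a b →
          ≤-<-trans (subst (w (conv F H) m ≤_) w₀ le) (terms-strict m i i≤ (side i i≤) a b)
          where
          side : ∀ i → i ≤ m → X < i ⊎ Y < m ∸ i
          side i i≤ with X <? i
          ... | yes X<i = inj₁ X<i
          ... | no X≮i = inj₂ (+-cancelˡ-< i _ _ (subst (i + Y <_) (sym (m+[n∸m]≡n i≤)) (≤-<-trans (+-monoˡ-≤ Y (≮⇒≥ X≮i)) m₀<m)))

-- The weights of the coefficients and their minimisers, in digits of n.

module CoefficientProfile where
  open DigitSums
  open import Data.Nat
  open import Data.Nat.Properties
  open import Data.Nat.DivMod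
  open import Data.Nat.Tactic.RingSolver using (solve-∀)
  open import Data.Product
  open import Data.Empty using (⊥-elim)
  open import Relation.Nullary
  open import Relation.Binary.PropositionalEquality
  open import Relation.Binary.Definitions using (tri<; tri≈; tri>)

  first-min : ∀ (f : ℕ → ℕ) r → ∃ λ x → x ≤ r × (∀ i → i ≤ r → f x ≤ f i) × (∀ i → i < x → f x < f i)
  first-min f zero = 0 , z≤n , (λ { zero _ → ≤-refl ; (suc i) () }) , λ i ()
  first-min f (suc r) with first-min f r
  ... | x , x≤ , mn , st with f (suc r) <? f x
  ...   | yes lt = suc r , ≤-refl , all , λ i i< → <-≤-trans lt (mn i (≤-pred i<))
    where
    all : ∀ i → i ≤ suc r → f (suc r) ≤ f i
    all i i≤ with i ≟ suc r
    ... | yes refl = ≤-refl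
    ... | no  i≢ = ≤-trans (<⇒≤ lt) (mn i (≤-pred (≤∧≢⇒< i≤ i≢)))
  ...   | no ge = x , m≤n⇒m≤1+n x≤ , all , st
    where
    all : ∀ i → i ≤ suc r → f x ≤ f i
    all i i≤ with i ≟ suc r
    ... | yes refl = ≮⇒≥ ge
    ... | no  i≢ = mn i (≤-pred (≤∧≢⇒< i≤ i≢))

  module Profile (p₂ s : ℕ) where
    open Digits p₂

    -- This is p - 1 times the valuation of C(s + i, i), by Legendre's formula.
    κ : ℕ → ℕ
    κ i = S s + S i ∸ S (s + i)

    κ-eq : ∀ i → κ i + S (s + i) ≡ S s + S i
    κ-eq i = m∸n+n≡m (S-sub s i)

    -- p₁ · (valuation of the coefficient of x^(n − i)) = i + T n i − S n
    T : ℕ → ℕ → ℕ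
    T n i = S (n ∸ i) + κ i

    module Level (a r m : ℕ) (r+s<q : r + s < p ^ a) where
      q n : ℕ
      q = p ^ a
      n = r + m * q

      instance
        q≢0 : NonZero q
        q≢0 = m^n≢0 p a

      r<q : r < q
      r<q = ≤-<-trans (m≤m+n r s) r+s<q

      -- The edges of length divisible by q will run from x to x + m q. Of the r remaining
      -- positions, x precede them and r - x follow.
      minimum = first-min (T r) r
      x = proj₁ minimum
      x≤r = proj₁ (proj₂ minimum)
      T-least = proj₁ (proj₂ (proj₂ minimum))
      T-first = proj₂ (proj₂ (proj₂ minimum))
      x<q : x < q
      x<q = ≤-<-trans x≤r r<q

      -- As s + i₀ ≤ s + r < q, adding s carries nothing across q, and the digits of i₁ cancel.
      κ-low : ∀ i₀ i₁ → i₀ ≤ r → κ (i₀ + i₁ * q) ≡ κ i₀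
      κ-low i₀ i₁ i₀≤r = trans (cong₂ _∸_
          (trans (cong (S s +_) (S-split a i₀ i₁ (≤-<-trans i₀≤r r<q))) (sym (+-assoc (S s) (S i₀) (S i₁))))
          (trans (cong S (sym (+-assoc s i₀ (i₁ * q)))) (S-split a (s + i₀) i₁ s+i₀<q)))
        (trans (cong₂ _∸_ (+-comm (S s + S i₀) (S i₁)) (+-comm (S (s + i₀)) (S i₁))) ([m+n]∸[m+o]≡n∸o (S i₁) (S s + S i₀) (S (s + i₀))))
        where
        s+i₀<q : s + i₀ < q
        s+i₀<q = ≤-<-trans (≤-trans (+-monoʳ-≤ s i₀≤r) (≤-reflexive (+-comm s r))) r+s<q

      T-low : ∀ i₀ i₁ j₁ → i₀ ≤ r → i₁ + j₁ ≡ m → T n (i₀ + i₁ * q) ≡ S j₁ + T r i₀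
      T-low i₀ i₁ j₁ i₀≤r eq = trans (cong₂ _+_ (trans (cong S n∸) (S-split a (r ∸ i₀) j₁ (≤-<-trans (m∸n≤m r i₀) r<q))) (κ-low i₀ i₁ i₀≤r))
          (arr (S (r ∸ i₀)) (S j₁) (κ i₀))
        where
        arr : ∀ a b c → (a + b) + c ≡ b + (a + c)
        arr = solve-∀
        arr₂ : ∀ d i u v Q → (d + i) + (u + v) * Q ≡ (d + v * Q) + (i + u * Q)
        arr₂ = solve-∀
        n∸ : n ∸ (i₀ + i₁ * q) ≡ (r ∸ i₀) + j₁ * q
        n∸ = trans (cong (_∸ (i₀ + i₁ * q)) (trans (cong₂ (λ u v → u + v * q) (sym (m∸n+n≡m i₀≤r)) (sym eq)) (arr₂ (r ∸ i₀) i₀ i₁ j₁ q)))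
               (m+n∸n≡m ((r ∸ i₀) + j₁ * q) (i₀ + i₁ * q))

      -- Here n - i borrows at q. `borrow` replaces the low part i₀ by some i ≤ r with no larger κ
      -- and with a strictly smaller digit sum of the difference, so i₀ loses to the minimum over 0,
      -- ..., r by at least one.
      T-high : ∀ i₀ i₁ j₁ → r < i₀ → i₀ < q → i₁ + suc j₁ ≡ m → suc (S j₁ + T r x) ≤ T n (i₀ + i₁ * q)
      T-high i₀ i₁ j₁ r<i₀ i₀<q eq with borrow a r i₀ r<i₀ i₀<q
      ... | i , j , i≤r , i₀≡ , Si₀ , S< = begin
        suc (S j₁ + T r x)                              ≤⟨ s≤s (+-monoʳ-≤ (S j₁) (T-least i i≤r)) ⟩
        suc (S j₁ + (S (r ∸ i) + κ i))                  ≡⟨ arr (S j₁) (S (r ∸ i)) (κ i) ⟩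
        (suc (S (r ∸ i)) + S j₁) + κ i                  ≤⟨ +-mono-≤ (+-monoˡ-≤ (S j₁) S<) κ≤ ⟩
        (S (q + r ∸ i₀) + S j₁) + κ (i₀ + i₁ * q)       ≡⟨ cong (_+ κ (i₀ + i₁ * q)) (sym (S-split a (q + r ∸ i₀) j₁ z<q)) ⟩
        S ((q + r ∸ i₀) + j₁ * q) + κ (i₀ + i₁ * q)     ≡⟨ cong (λ z → S z + κ (i₀ + i₁ * q)) (sym n∸) ⟩
        S (n ∸ (i₀ + i₁ * q)) + κ (i₀ + i₁ * q)         ∎
        where
        open ≤-Reasoning
        arr : ∀ a b c → suc (a + (b + c)) ≡ (suc b + a) + c
        arr = solve-∀
        i₀≤ : i₀ ≤ q + r
        i₀≤ = ≤-trans (<⇒≤ i₀<q) (m≤m+n q r)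
        z+ : (q + r ∸ i₀) + i₀ ≡ q + r
        z+ = m∸n+n≡m i₀≤
        z<q : q + r ∸ i₀ < q
        z<q = +-cancelʳ-< i₀ _ q (subst (_< q + i₀) (sym z+) (+-monoʳ-< q r<i₀))
        arr₂ : ∀ r u v Q → r + (u + suc v) * Q ≡ (Q + r) + v * Q + u * Q
        arr₂ = solve-∀
        arr₃ : ∀ z i v u Q → (z + i) + v * Q + u * Q ≡ (z + v * Q) + (i + u * Q)
        arr₃ = solve-∀
        n∸ : n ∸ (i₀ + i₁ * q) ≡ (q + r ∸ i₀) + j₁ * q
        n∸ = trans (cong (_∸ (i₀ + i₁ * q)) (trans (cong (λ v → r + v * q) (sym eq)) (trans (arr₂ r i₁ j₁ q)
               (trans (cong (λ v → v + j₁ * q + i₁ * q) (sym z+)) (arr₃ (q + r ∸ i₀) i₀ j₁ i₁ q)))))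
               (m+n∸n≡m ((q + r ∸ i₀) + j₁ * q) (i₀ + i₁ * q))
        jj = j + i₁ * q
        big≡ : i₀ + i₁ * q ≡ i + jj
        big≡ = trans (cong (_+ i₁ * q) i₀≡) (+-assoc i j _)
        j<q : j < q
        j<q = ≤-<-trans (subst (j ≤_) (sym i₀≡) (m≤n+m j i)) i₀<q
        Sbig : S (i + jj) ≡ S i + S jj
        Sbig = trans (cong S (sym big≡)) (trans (S-split a i₀ i₁ i₀<q) (trans (cong (_+ S i₁) Si₀)
                 (trans (+-assoc (S i) (S j) (S i₁)) (cong (S i +_) (sym (S-split a j i₁ j<q))))))
        -- The digit sum is additive on i + jj, so adjoining jj to i can only create further carries
        -- with s.
        κ≤ : κ i ≤ κ (i₀ + i₁ * q)
        κ≤ = subst (λ z → κ i ≤ κ z) (sym big≡) (+-cancelʳ-≤ (S (s + (i + jj))) _ _ (begin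
          κ i + S (s + (i + jj))          ≡⟨ cong (λ z → κ i + S z) (sym (+-assoc s i jj)) ⟩
          κ i + S (s + i + jj)            ≤⟨ +-monoʳ-≤ (κ i) (S-sub (s + i) jj) ⟩
          κ i + (S (s + i) + S jj)        ≡⟨ +-assoc (κ i) _ _ ⟨
          (κ i + S (s + i)) + S jj        ≡⟨ cong (_+ S jj) (κ-eq i) ⟩
          (S s + S i) + S jj              ≡⟨ +-assoc (S s) _ _ ⟩
          S s + (S i + S jj)              ≡⟨ cong (S s +_) Sbig ⟨
          S s + S (i + jj)                ≡⟨ κ-eq (i + jj) ⟨
          κ (i + jj) + S (s + (i + jj))    ∎))

      module _ (c ρ m′ : ℕ) (ρ< : ρ < p ^ c) (m≡ : m ≡ ρ + m′ * p ^ c) where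
        Q = p ^ c
        instance
          Q≢0 : NonZero Q
          Q≢0 = m^n≢0 p c
        φ : ℕ
        φ = x + ρ * q

        T-φ : T n φ ≡ S m′ + T r x
        T-φ = trans (T-low x ρ (m′ * Q) x≤r (sym m≡)) (cong (_+ T r x) (S-split c 0 m′ (m^n>0 p c)))

        digits-≤ : ∀ y → y < Q → y ≤ Q * S y
        digits-≤ zero    _  = z≤n
        digits-≤ (suc y) y< = ≤-trans (<⇒≤ y<) (m≤m*n Q (S (suc y)) {{>-nonZero (S-pos (suc y) (s≤s z≤n))}})

        digits-< : ∀ y → y < Q → y ≢ 0 → y < Q * S y
        digits-< zero    _  ne = ⊥-elim (ne refl)
        digits-< (suc y) y< _  = <-≤-trans y< (m≤m*n Q (S (suc y)) {{>-nonZero (S-pos (suc y) (s≤s z≤n))}})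

        -- With q = 1 and s = 0 this locates a vertex of the polygon of the truncated exponential
        -- series: ρ is the first minimiser of Q S(m - i) + i. For the digits y₀ of j below Q one
        -- has y₀ ≤ Q S(y₀), strictly unless y₀ = 0; the digits above compare by subadditivity.
        high : ∀ i j → i + j ≡ m → (Q * S m′ + ρ ≤ Q * S j + i) × (i < ρ → Q * S m′ + ρ < Q * S j + i)
        high i j i+j = go (j / Q) (j % Q) (m%n<n j Q) (m≡m%n+[m/n]*n j Q)
          where
          go : ∀ y₁ y₀ → y₀ < Q → j ≡ y₀ + y₁ * Q → (Q * S m′ + ρ ≤ Q * S j + i) × (i < ρ → Q * S m′ + ρ < Q * S j + i)
          go y₁ y₀ y₀< ej = +-cancelʳ-≤ (y₀ + y₁ * Q) _ _ le , λ i<ρ → +-cancelʳ-< (y₀ + y₁ * Q) _ _ (lt i<ρ)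
            where
            open ≤-Reasoning
            y₁≤m′ : y₁ ≤ m′
            y₁≤m′ = ≤-pred (*-cancelʳ-< Q y₁ (suc m′) (≤-<-trans (≤-trans (m≤n+m (y₁ * Q) y₀)
              (subst (_≤ m) ej (subst (j ≤_) i+j (m≤n+m j i)))) (subst (_< Q + m′ * Q) (sym m≡) (+-monoˡ-< (m′ * Q) ρ<))))
            Q-part : Q * S m′ + y₁ * Q ≤ Q * S y₁ + m′ * Q
            Q-part = begin
              Q * S m′ + y₁ * Q                      ≡⟨ cong (λ z → Q * S z + y₁ * Q) (sym (m+[n∸m]≡n y₁≤m′)) ⟩
              Q * S (y₁ + (m′ ∸ y₁)) + y₁ * Q        ≤⟨ +-monoˡ-≤ (y₁ * Q) (*-monoʳ-≤ Q (≤-trans (S-sub y₁ (m′ ∸ y₁)) (+-monoʳ-≤ (S y₁) (S≤id (m′ ∸ y₁))))) ⟩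
              Q * (S y₁ + (m′ ∸ y₁)) + y₁ * Q        ≡⟨ arr Q (S y₁) (m′ ∸ y₁) y₁ ⟩
              Q * S y₁ + ((m′ ∸ y₁) + y₁) * Q        ≡⟨ cong (λ z → Q * S y₁ + z * Q) (m∸n+n≡m y₁≤m′) ⟩
              Q * S y₁ + m′ * Q                      ∎
              where
              arr : ∀ q a b y → q * (a + b) + y * q ≡ q * a + (b + y) * q
              arr = solve-∀
            lhs : ∀ a b c d → a + b + (c + d) ≡ c + ((a + d) + b)
            lhs = solve-∀
            rhs : Q * S y₀ + ((Q * S y₁ + m′ * Q) + ρ) ≡ Q * S j + i + (y₀ + y₁ * Q)
            rhs = begin-equality
              Q * S y₀ + ((Q * S y₁ + m′ * Q) + ρ)   ≡⟨ arr Q (S y₀) (S y₁) (m′ * Q) ρ ⟩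
              Q * (S y₀ + S y₁) + (ρ + m′ * Q)       ≡⟨ cong₂ (λ u v → Q * u + v) (sym (trans (cong S ej) (S-split c y₀ y₁ y₀<))) (trans (sym m≡) (sym i+j)) ⟩
              Q * S j + (i + j)                      ≡⟨ +-assoc (Q * S j) i j ⟨
              Q * S j + i + j                        ≡⟨ cong (Q * S j + i +_) ej ⟩
              Q * S j + i + (y₀ + y₁ * Q)            ∎
              where
              arr : ∀ q a b c d → q * a + ((q * b + c) + d) ≡ q * (a + b) + (d + c)
              arr = solve-∀
            le : Q * S m′ + ρ + (y₀ + y₁ * Q) ≤ Q * S j + i + (y₀ + y₁ * Q)
            le = begin
              Q * S m′ + ρ + (y₀ + y₁ * Q)           ≡⟨ lhs (Q * S m′) ρ y₀ (y₁ * Q) ⟩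
              y₀ + ((Q * S m′ + y₁ * Q) + ρ)         ≤⟨ +-mono-≤ (digits-≤ y₀ y₀<) (+-monoˡ-≤ ρ Q-part) ⟩
              Q * S y₀ + ((Q * S y₁ + m′ * Q) + ρ)   ≡⟨ rhs ⟩
              Q * S j + i + (y₀ + y₁ * Q)            ∎
            y₀≢0 : i < ρ → y₀ ≢ 0
            y₀≢0 i<ρ y0 = <⇒≱ i<ρ (+-cancelʳ-≤ (y₁ * Q) _ _ (begin
              ρ + y₁ * Q   ≤⟨ +-monoʳ-≤ ρ (*-monoˡ-≤ Q y₁≤m′) ⟩
              ρ + m′ * Q   ≡⟨ trans (sym m≡) (sym i+j) ⟩
              i + j        ≡⟨ cong (i +_) (trans ej (cong (_+ y₁ * Q) y0)) ⟩
              i + y₁ * Q   ∎))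
            lt : i < ρ → Q * S m′ + ρ + (y₀ + y₁ * Q) < Q * S j + i + (y₀ + y₁ * Q)
            lt i<ρ = begin-strict
              Q * S m′ + ρ + (y₀ + y₁ * Q)           ≡⟨ lhs (Q * S m′) ρ y₀ (y₁ * Q) ⟩
              y₀ + ((Q * S m′ + y₁ * Q) + ρ)         <⟨ +-mono-<-≤ (digits-< y₀ y₀< (y₀≢0 i<ρ)) (+-monoˡ-≤ ρ Q-part) ⟩
              Q * S y₀ + ((Q * S y₁ + m′ * Q) + ρ)   ≡⟨ rhs ⟩
              Q * S j + i + (y₀ + y₁ * Q)            ∎

        qQ = q * Q
        arr-low : ∀ q Q S t i i₁ → q * Q * (S + t) + (i + i₁ * q) ≡ q * (Q * S + i₁) + (q * Q * t + i)
        arr-low = solve-∀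
        x<qQ : x < qQ
        x<qQ = <-≤-trans x<q (m≤m*n q Q)

        value-φ : qQ * T n φ + φ ≡ q * (Q * S m′ + ρ) + (qQ * T r x + x)
        value-φ = trans (cong (λ t → qQ * t + φ) T-φ) (arr-low q Q (S m′) (T r x) x ρ)

        low-≢ : ∀ i → i ≤ r → i ≢ x → qQ * T r x + x < qQ * T r i + i
        low-≢ i i≤r i≢x with <-cmp i x
        ... | tri≈ _ e _ = ⊥-elim (i≢x e)
        ... | tri> _ _ x<i = +-mono-≤-< (*-monoʳ-≤ qQ (T-least i i≤r)) x<i
        ... | tri< i<x _ _ = <-≤-trans (+-monoʳ-< (qQ * T r x) x<qQ)
                (≤-trans (≤-trans (≤-reflexive (trans (+-comm _ qQ) (sym (*-suc qQ (T r x))))) (*-monoʳ-≤ qQ (T-first i i<x))) (m≤m+n _ i))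

        -- For low parts i₀ ≤ r the weight is q times that of `high` in the upper part plus a weight
        -- of i₀ alone, and the two minima combine independently. First in i means last in the
        -- exponent n - i, as `Arg` requires.
        φ-first : ∀ i → i ≤ n → (qQ * T n φ + φ ≤ qQ * T n i + i) × (i < φ → qQ * T n φ + φ < qQ * T n i + i)
        φ-first i i≤n = go (i / q) (i % q) (m%n<n i q) (m≡m%n+[m/n]*n i q)
          where
          open ≤-Reasoning
          Goal = (qQ * T n φ + φ ≤ qQ * T n i + i) × (i < φ → qQ * T n φ + φ < qQ * T n i + i)
          both : qQ * T n φ + φ < qQ * T n i + i → Goal
          both lt = <⇒≤ lt , λ _ → lt
          go : ∀ i₁ i₀ → i₀ < q → i ≡ i₀ + i₁ * q → Goal
          go i₁ i₀ i₀<q ei = cases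
            where
            i₁≤m : i₁ ≤ m
            i₁≤m = ≤-pred (*-cancelʳ-< q i₁ (suc m) (≤-<-trans (≤-trans (m≤n+m (i₁ * q) i₀) (subst (_≤ n) ei i≤n)) (+-monoˡ-< (m * q) r<q)))
            cases : Goal
            cases with i₀ ≤? r
            ... | yes i₀≤r = low
              where
              j₁ = m ∸ i₁
              val : qQ * T n i + i ≡ q * (Q * S j₁ + i₁) + (qQ * T r i₀ + i₀)
              val = trans (cong₂ (λ u v → qQ * T n u + v) ei ei)
                      (trans (cong (λ t → qQ * t + (i₀ + i₁ * q)) (T-low i₀ i₁ j₁ i₀≤r (m+[n∸m]≡n i₁≤m))) (arr-low q Q (S j₁) (T r i₀) i₀ i₁))
              hi = high i₁ j₁ (m+[n∸m]≡n i₁≤m)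
              low : Goal
              low with i₀ ≟ x
              ... | no ne = both (subst₂ _<_ (sym value-φ) (sym val) (+-mono-≤-< (*-monoʳ-≤ q (proj₁ hi)) (low-≢ i₀ i₀≤r ne)))
              ... | yes refl = subst₂ _≤_ (sym value-φ) (sym val) (+-monoˡ-≤ (qQ * T r x + x) (*-monoʳ-≤ q (proj₁ hi)))
                  , λ i<φ → subst₂ _<_ (sym value-φ) (sym val) (+-monoˡ-< (qQ * T r x + x) (*-monoʳ-< q (proj₂ hi
                      (*-cancelʳ-< q i₁ ρ (+-cancelˡ-< x _ _ (subst (_< φ) ei i<φ))))))
            -- The unit gained in `T-high` is worth qQ ≥ q, which pays for comparing with i₁ + 1 in
            -- place of i₁.
            ... | no i₀≰r = both (begin-strict
                qQ * T n φ + φ                               ≡⟨ value-φ ⟩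
                q * (Q * S m′ + ρ) + (qQ * T r x + x)        ≤⟨ +-monoˡ-≤ _ (*-monoʳ-≤ q (proj₁ (high (suc i₁) j₁ (trans (sym (+-suc i₁ j₁)) ej)))) ⟩
                q * (Q * S j₁ + suc i₁) + (qQ * T r x + x)   ≡⟨ arr q Q (S j₁) i₁ (qQ * T r x) x ⟩
                (q + x) + (q * Q * S j₁ + qQ * T r x + i₁ * q)   <⟨ +-monoˡ-< (q * Q * S j₁ + qQ * T r x + i₁ * q) (+-mono-≤-< (m≤m*n q Q) (≤-<-trans x≤r (≰⇒> i₀≰r))) ⟩
                (qQ + i₀) + (q * Q * S j₁ + qQ * T r x + i₁ * q) ≡⟨ arr₂ qQ (S j₁) (T r x) i₀ i₁ q ⟩
                qQ * suc (S j₁ + T r x) + (i₀ + i₁ * q)      ≤⟨ +-monoˡ-≤ _ (*-monoʳ-≤ qQ (T-high i₀ i₁ j₁ (≰⇒> i₀≰r) i₀<q ej)) ⟩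
                qQ * T n (i₀ + i₁ * q) + (i₀ + i₁ * q)       ≡⟨ cong (λ u → qQ * T n u + u) (sym ei) ⟩
                qQ * T n i + i                               ∎)
              where
              i₁<m : i₁ < m
              i₁<m = ≤∧≢⇒< i₁≤m λ e → i₀≰r (+-cancelʳ-≤ (m * q) _ _ (subst (_≤ n) (trans ei (cong (λ z → i₀ + z * q) e)) i≤n))
              j₁ = m ∸ suc i₁
              ej : i₁ + suc j₁ ≡ m
              ej = trans (+-suc i₁ j₁) (m+[n∸m]≡n i₁<m)
              arr : ∀ q Q S i t x → q * (Q * S + suc i) + (t + x) ≡ (q + x) + (q * Q * S + t + i * q)
              arr = solve-∀
              arr₂ : ∀ z S t i i₁ q → (z + i) + (z * S + z * t + i₁ * q) ≡ z * suc (S + t) + (i + i₁ * q)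
              arr₂ = solve-∀

-- Factorisations of multiples of g₁ and the residues allowed for the degree of a factor.

module Factorisations where
  open DigitSums
  open Valuations
  open DumasLemma
  open CoefficientProfile
  open import Data.Nat
  open import Data.Nat.Properties
  open import Data.Nat.DivMod
  open import Data.Nat.Divisibility
  open import Data.Nat.Primality
  open import Data.Nat.Combinatorics using (_C_)
  open import Data.Nat.Tactic.RingSolver using (solve-∀)
  open import Data.Integer as ℤ using (ℤ; 0ℤ)
  import Data.Integer.Properties as ℤ
  open import Data.Product
  open import Relation.Nullary
  open import Relation.Binary.PropositionalEquality

  -- A factorisation of D · g₁ over ℤ into factors of degrees k and n − k.  The coefficients of g₁ are
  -- given as in its definition, with the denominator j ! multiplied out.
  record Factors (n s k : ℕ) : Set where
    field
      F H   : ℕ → ℤ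
      D     : ℤ
      D≢0   : D ≢ 0ℤ
      k≤n   : k ≤ n
      F-top : F k ≢ 0ℤ
      F-deg : ∀ j → k < j → F j ≡ 0ℤ
      H-top : H (n ∸ k) ≢ 0ℤ
      H-deg : ∀ j → n ∸ k < j → H j ≡ 0ℤ
      coefs : ∀ i j → i + j ≡ n → conv F H j ℤ.* (ℤ.+ (j !)) ≡ D ℤ.* (ℤ.+ (n ! * ((i + s) C i)))
      above : ∀ j → n < j → conv F H j ≡ 0ℤ

  module Local (p₂ : ℕ) (pp : Prime (suc (suc p₂))) {n s k : ℕ} (fac : Factors n s k) where
    open Dumas p₂ pp public
    open Profile p₂ s public
    open Factors fac public

    P : ℕ → ℤ
    P = conv F H

    P≢0 : ∀ i j → i + j ≡ n → P j ≢ 0ℤ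
    P≢0 i j e z = *ℤ≢0 D≢0 (λ q → *≢0 (fact≢0 n) (C≢0 i s) (ℤ.+-injective q))
      (trans (sym (coefs i j e)) (trans (cong (ℤ._* (ℤ.+ (j !))) z) (ℤ.*-zeroˡ (ℤ.+ (j !)))))

    ν-P : ∀ i j → i + j ≡ n → p₁ * νℤ (P j) + S n ≡ p₁ * νℤ D + (i + T n i)
    ν-P i j e = +-cancelˡ-≡ (p₁ * b) _ _ (begin
      p₁ * b + (p₁ * νℤ (P j) + S n)          ≡⟨ a₁ p₁ b (νℤ (P j)) (S n) ⟩
      p₁ * (νℤ (P j) + b) + S n               ≡⟨ cong (λ z → p₁ * z + S n) ν-coefs ⟩
      p₁ * (νℤ D + (ν (n !) + c)) + S n       ≡⟨ a₂ p₁ (νℤ D) (ν (n !)) c (S n) ⟩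
      p₁ * νℤ D + ((p₁ * ν (n !) + S n) + p₁ * c) ≡⟨ cong₂ (λ u v → p₁ * νℤ D + (u + v)) (trans (legendre n) (sym e)) κ≡ ⟩
      p₁ * νℤ D + ((i + j) + κ i)             ≡⟨ cong (λ u → p₁ * νℤ D + ((i + u) + κ i)) (sym (legendre j)) ⟩
      p₁ * νℤ D + ((i + (p₁ * b + S j)) + κ i) ≡⟨ a₃ (p₁ * νℤ D) i (p₁ * b) (S j) (κ i) ⟩
      p₁ * b + (p₁ * νℤ D + (i + (S j + κ i))) ≡⟨ cong (λ u → p₁ * b + (p₁ * νℤ D + (i + (S u + κ i)))) (sym n∸i) ⟩
      p₁ * b + (p₁ * νℤ D + (i + T n i))      ∎)
      where
      open ≡-Reasoning
      b c : ℕ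
      b = ν (j !)
      c = ν ((i + s) C i)
      n∸i : n ∸ i ≡ j
      n∸i = trans (cong (_∸ i) (sym e)) (m+n∸m≡n i j)
      fact-ℤ≢0 : ∀ j → ℤ.+ (j !) ≢ 0ℤ
      fact-ℤ≢0 j q = fact≢0 j (ℤ.+-injective q)
      ν-coefs : νℤ (P j) + b ≡ νℤ D + (ν (n !) + c)
      ν-coefs = trans (sym (νℤ-* (P≢0 i j e) (fact-ℤ≢0 j))) (trans (cong νℤ (coefs i j e))
        (trans (νℤ-* D≢0 (λ q → *≢0 (fact≢0 n) (C≢0 i s) (ℤ.+-injective q))) (cong (νℤ D +_) (ν-* (fact≢0 n) (C≢0 i s)))))
      κ≡ : p₁ * c ≡ κ i
      κ≡ = +-cancelʳ-≡ (S (s + i)) _ _ (trans (cong (λ z → p₁ * c + S z) (+-comm s i)) (trans (ν-C i s) (trans (+-comm (S i) (S s)) (sym (κ-eq i)))))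
      a₁ : ∀ q b v t → q * b + (q * v + t) ≡ q * (v + b) + t
      a₁ = solve-∀
      a₂ : ∀ q d f c t → q * (d + (f + c)) + t ≡ q * d + ((q * f + t) + q * c)
      a₂ = solve-∀
      a₃ : ∀ d i b t c → d + ((i + (b + t)) + c) ≡ b + (d + (i + (t + c)))
      a₃ = solve-∀

    -- The weight of the coefficient of x^(n - i) for α = A (p - 1) and β, up to a summand
    -- independent of i. The factor p - 1 clears the denominator in Legendre's formula.
    U : ℕ → ℕ → ℕ → ℕ
    U A β i = A * (i + T n i) + β * (n ∸ i)

    module Slope (A β : ℕ) .{{_ : NonZero A}} where
      instance
        α≢0 : NonZero (A * p₁)
        α≢0 = m*n≢0 A p₁
      open Weight (A * p₁) β public

      w-P : ∀ i → i ≤ n → w P (n ∸ i) + A * S n ≡ A * (p₁ * νℤ D) + U A β i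
      w-P i i≤n = trans (a₁ A p₁ (νℤ (P (n ∸ i))) (β * (n ∸ i)) (S n))
        (trans (cong (λ z → A * z + β * (n ∸ i)) (ν-P i (n ∸ i) (m+[n∸m]≡n i≤n))) (a₂ A (p₁ * νℤ D) (i + T n i) (β * (n ∸ i))))
        where
        a₁ : ∀ A q v b t → (A * q * v + b) + A * t ≡ A * (q * v + t) + b
        a₁ = solve-∀
        a₂ : ∀ A d t b → A * (d + t) + b ≡ A * d + (A * t + b)
        a₂ = solve-∀

      arg-P : ∀ φ → φ ≤ n → (∀ i → i ≤ n → U A β φ ≤ U A β i × (i < φ → U A β φ < U A β i)) → Arg P (n ∸ φ)
      arg-P φ φ≤n mn = record { nz = P≢0 φ (n ∸ φ) (m+[n∸m]≡n φ≤n) ; least = lst ; strict = str }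
        where
        j≤ : ∀ j → P j ≢ 0ℤ → j ≤ n
        j≤ j nzj = ≮⇒≥ λ n<j → nzj (above j n<j)
        conv-le : ∀ i → i ≤ n → U A β φ ≤ U A β i → w P (n ∸ φ) ≤ w P (n ∸ i)
        conv-le i i≤n le = +-cancelʳ-≤ (A * S n) _ _ (subst₂ _≤_ (sym (w-P φ φ≤n)) (sym (w-P i i≤n)) (+-monoʳ-≤ (A * (p₁ * νℤ D)) le))
        conv-lt : ∀ i → i ≤ n → U A β φ < U A β i → w P (n ∸ φ) < w P (n ∸ i)
        conv-lt i i≤n le = +-cancelʳ-< (A * S n) _ _ (subst₂ _<_ (sym (w-P φ φ≤n)) (sym (w-P i i≤n)) (+-monoʳ-< (A * (p₁ * νℤ D)) le))
        lst : ∀ j → P j ≢ 0ℤ → w P (n ∸ φ) ≤ w P j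
        lst j nzj = subst (λ z → w P (n ∸ φ) ≤ w P z) (m∸[m∸n]≡n (j≤ j nzj))
          (conv-le (n ∸ j) (m∸n≤m n j) (proj₁ (mn (n ∸ j) (m∸n≤m n j))))
        str : ∀ j → n ∸ φ < j → P j ≢ 0ℤ → w P (n ∸ φ) < w P j
        str j lt nzj = subst (λ z → w P (n ∸ φ) < w P z) (m∸[m∸n]≡n (j≤ j nzj))
          (conv-lt (n ∸ j) (m∸n≤m n j) (proj₂ (mn (n ∸ j) (m∸n≤m n j))
            (+-cancelˡ-< j _ _ (subst₂ _<_ (trans (m∸n+n≡m φ≤n) (sym (m+[n∸m]≡n (j≤ j nzj)))) refl (+-monoˡ-< φ lt)))))

      -- By `dumas` a vertex of the product is the sum of one vertex from each factor. The bounds on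
      -- X and Y by the degrees then allow the roots of each factor on either side to be counted.
      record Break (φ : ℕ) : Set where
        field
          X Y   : ℕ
          X≤k   : X ≤ k
          Y≤    : Y ≤ n ∸ k
          argF  : Arg F X
          argH  : Arg H Y
          X+Y   : X + Y ≡ n ∸ φ
          ν-sum : νℤ (P (n ∸ φ)) ≡ νℤ (F X) + νℤ (H Y)

      break : ∀ φ → φ ≤ n → (∀ i → i ≤ n → U A β φ ≤ U A β i × (i < φ → U A β φ < U A β i)) → Break φ
      break φ φ≤n mn with arg-exists F k F-top F-deg | arg-exists H (n ∸ k) H-top H-deg
      ... | X , X≤k , aF | Y , Y≤ , aH = record { X = X ; Y = Y ; X≤k = X≤k ; Y≤ = Y≤ ; argF = aF ; argH = aH ; X+Y = eq
            ; ν-sum = trans (cong (λ z → νℤ (P z)) (sym eq)) (proj₂ d) }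
        where
        d = dumas aF aH
        eq : X + Y ≡ n ∸ φ
        eq = arg-unique (proj₁ d) (arg-P φ φ≤n mn)

  module Residue (p₂ : ℕ) (pp : Prime (suc (suc p₂))) (s k a r m : ℕ) (r+s<q : r + s < (suc (suc p₂)) ^ a)
    (fac : Factors (r + m * (suc (suc p₂)) ^ a) s k) where
    open Local p₂ pp fac
    open Level a r m r+s<q

    module At (c : ℕ) where
      Qᶜ = p ^ c
      instance
        Qᶜ≢0 : NonZero Qᶜ
        Qᶜ≢0 = m^n≢0 p c
        qQ≢0 : NonZero (q * Qᶜ)
        qQ≢0 = m*n≢0 q Qᶜ
      ρ m′ : ℕ
      ρ = m % Qᶜ
      m′ = m / Qᶜ
      ρ< : ρ < Qᶜ
      ρ< = m%n<n m Qᶜ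
      m≡ : m ≡ ρ + m′ * Qᶜ
      m≡ = m≡m%n+[m/n]*n m Qᶜ
      φᶜ = x + ρ * q
      -- For β = A - 1 the weight U becomes β n + (A T + i), the quantity minimised in `φ-first`;
      -- moreover β ≡ -1 modulo q, which `mod-eq` exploits.
      A β : ℕ
      A = q * Qᶜ
      β = q * Qᶜ ∸ 1
      A≡ : A ≡ suc β
      A≡ = sym (suc-pred A)
      open Slope A β public
      ρ≤m : ρ ≤ m
      ρ≤m = m%n≤m m Qᶜ
      φ≤n : φᶜ ≤ n
      φ≤n = +-mono-≤ x≤r (*-monoˡ-≤ q ρ≤m)
      U≡ : ∀ i → i ≤ n → U A β i ≡ β * n + (A * T n i + i)
      U≡ i i≤n = trans (cong₂ (λ u v → u * (i + T n i) + β * v) A≡ refl)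
         (trans (arr β i (T n i) (n ∸ i)) (cong₂ (λ u v → β * u + (v * T n i + i)) (m+[n∸m]≡n i≤n) (sym A≡)))
        where
        arr : ∀ b i t d → suc b * (i + t) + b * d ≡ b * (i + d) + (suc b * t + i)
        arr = solve-∀
      brk : Break φᶜ
      brk = break φᶜ φ≤n λ i i≤n → let lst , str = φ-first c ρ m′ ρ< m≡ i i≤n in
        subst₂ _≤_ (sym (U≡ φᶜ φ≤n)) (sym (U≡ i i≤n)) (+-monoʳ-≤ (β * n) lst) ,
        λ i<φ → subst₂ _<_ (sym (U≡ φᶜ φ≤n)) (sym (U≡ i i≤n)) (+-monoʳ-< (β * n) (str i<φ))
      T-φᶜ : T n φᶜ ≡ S m′ + T r x
      T-φᶜ = T-φ c ρ m′ ρ< m≡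
      open Break brk public

    next : ∀ c → At.X c % q ≡ At.X (suc c) % q
    next c = mod-eq
      where
      open ≤-Reasoning
      module A₀ = At c
      module A₁ = At (suc c)
      d = A₀.m′ % p
      m″ = A₀.m′ / p
      m₀≡ : A₀.m′ ≡ d + m″ * p
      m₀≡ = m≡m%n+[m/n]*n A₀.m′ p
      instance
        _ = A₀.Qᶜ≢0
        _ = A₁.Qᶜ≢0
      next-digits : A₁.ρ ≡ A₀.ρ + d * A₀.Qᶜ × A₁.m′ ≡ m″
      next-digits = unique (A₀.ρ + d * A₀.Qᶜ) m″ lt (trans A₀.m≡ (trans (cong (λ z → A₀.ρ + z * A₀.Qᶜ) m₀≡) (arr A₀.ρ d m″ p A₀.Qᶜ)))
        where
        arr : ∀ r d m p Q → r + (d + m * p) * Q ≡ (r + d * Q) + m * (p * Q)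
        arr = solve-∀
        lt : A₀.ρ + d * A₀.Qᶜ < A₁.Qᶜ
        lt = <-≤-trans (+-monoˡ-< (d * A₀.Qᶜ) A₀.ρ<) (*-monoˡ-≤ A₀.Qᶜ (m%n<n A₀.m′ p))
        unique : ∀ ρ′ μ → ρ′ < A₁.Qᶜ → m ≡ ρ′ + μ * A₁.Qᶜ → A₁.ρ ≡ ρ′ × A₁.m′ ≡ μ
        unique ρ′ μ ρ′< e = trans (cong (_% A₁.Qᶜ) e) (trans ([m+kn]%n≡m%n ρ′ μ A₁.Qᶜ) (m<n⇒m%n≡m ρ′<))
          , trans (cong (_/ A₁.Qᶜ) e) (trans (+-distrib-/-∣ʳ ρ′ (n∣m*n μ)) (cong₂ _+_ (m<n⇒m/n≡0 ρ′<) (m*n/n≡m μ A₁.Qᶜ)))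
      T-step : T n A₀.φᶜ ≡ d + T n A₁.φᶜ
      T-step = trans A₀.T-φᶜ (trans (cong (_+ T r x) (trans (cong S m₀≡) (S-digit d m″ (m%n<n A₀.m′ p))))
        (trans (+-assoc d (S m″) (T r x)) (cong (d +_) (sym (trans A₁.T-φᶜ (cong (λ z → S z + T r x) (proj₂ next-digits)))))))
      φ-step : A₁.φᶜ ≡ A₀.φᶜ + d * A₀.A
      φ-step = trans (cong (λ z → x + z * q) (proj₁ next-digits)) (arr x A₀.ρ d A₀.Qᶜ q)
        where
        arr : ∀ x r d Q q → x + (r + d * Q) * q ≡ (x + r * q) + d * (q * Q)
        arr = solve-∀
      -- φ and the next φ lie on one edge of the Newton polygon, so both are minimisers for its slope.
      U-step : U A₀.A A₀.β A₀.φᶜ ≡ U A₀.A A₀.β A₁.φᶜ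
      U-step = trans (A₀.U≡ A₀.φᶜ A₀.φ≤n) (trans (cong (A₀.β * n +_) (trans (cong (λ t → A₀.A * t + A₀.φᶜ) T-step)
         (trans (arr A₀.A d (T n A₁.φᶜ) A₀.φᶜ) (cong (A₀.A * T n A₁.φᶜ +_) (sym φ-step))))) (sym (A₀.U≡ A₁.φᶜ A₁.φ≤n)))
        where
        arr : ∀ A d t f → A * (d + t) + f ≡ A * t + (f + d * A)
        arr = solve-∀
      w-step : A₀.w P (n ∸ A₀.φᶜ) ≡ A₀.w P (n ∸ A₁.φᶜ)
      w-step = +-cancelʳ-≡ (A₀.A * S n) _ _ (trans (A₀.w-P A₀.φᶜ A₀.φ≤n) (trans (cong (A₀.A * (p₁ * νℤ D) +_) U-step) (sym (A₀.w-P A₁.φᶜ A₁.φ≤n))))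
      split-w : ∀ φ X Y → X + Y ≡ n ∸ φ → νℤ (P (n ∸ φ)) ≡ νℤ (F X) + νℤ (H Y) → A₀.w P (n ∸ φ) ≡ A₀.w F X + A₀.w H Y
      split-w φ X Y e v = trans (cong₂ (λ a b → A₀.A * p₁ * a + A₀.β * b) v (sym e)) (arr (A₀.A * p₁) A₀.β (νℤ (F X)) (νℤ (H Y)) X Y)
        where
        arr : ∀ a b u v i j → a * (u + v) + b * (i + j) ≡ (a * u + b * i) + (a * v + b * j)
        arr = solve-∀
      sum-eq : A₀.w F A₀.X + A₀.w H A₀.Y ≡ A₀.w F A₁.X + A₀.w H A₁.Y
      sum-eq = trans (sym (split-w A₀.φᶜ A₀.X A₀.Y A₀.X+Y A₀.ν-sum)) (trans w-step (split-w A₁.φᶜ A₁.X A₁.Y A₁.X+Y A₁.ν-sum))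
      le-F : A₀.w F A₀.X ≤ A₀.w F A₁.X
      le-F = A₀.Arg.least A₀.argF A₁.X (A₁.Arg.nz A₁.argF)
      le-H : A₀.w H A₀.Y ≤ A₀.w H A₁.Y
      le-H = A₀.Arg.least A₀.argH A₁.Y (A₁.Arg.nz A₁.argH)
      -- The two sums agree and each summand on the left is minimal, so the summands agree one by
      -- one.
      eq-F : A₀.w F A₀.X ≡ A₀.w F A₁.X
      eq-F = ≤-antisym le-F (≮⇒≥ λ lt → <⇒≢ (+-mono-<-≤ lt le-H) sum-eq)
      -- Equal weights say A (p - 1)(v₀ - v₁) = β (X₁ - X₀) with q ∣ A and β ≡ -1, hence X₀ ≡ X₁
      -- modulo q. Adding X + Y turns β X into A X and avoids negative numbers.
      A-form : ∀ v X Y → (A₀.A * p₁ * v + A₀.β * X) + (X + Y) ≡ Y + (A₀.Qᶜ * X + A₀.Qᶜ * p₁ * v) * q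
      A-form v X Y = trans (arr₁ (A₀.A * p₁ * v) A₀.β X Y) (trans (cong (λ z → A₀.A * p₁ * v + z * X + Y) (sym A₀.A≡)) (arr₂ q A₀.Qᶜ p₁ v X Y))
        where
        arr₁ : ∀ a b X Y → (a + b * X) + (X + Y) ≡ a + suc b * X + Y
        arr₁ = solve-∀
        arr₂ : ∀ q Q p v X Y → q * Q * p * v + q * Q * X + Y ≡ Y + (Q * X + Q * p * v) * q
        arr₂ = solve-∀
      mod-eq : A₀.X % q ≡ A₁.X % q
      mod-eq = sym (trans (sym ([m+kn]%n≡m%n A₁.X (A₀.Qᶜ * A₀.X + A₀.Qᶜ * p₁ * νℤ (F A₀.X)) q)) (trans (cong (_% q) (trans (sym (A-form (νℤ (F A₀.X)) A₀.X A₁.X))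
         (trans (cong₂ _+_ eq-F (+-comm A₀.X A₁.X)) (A-form (νℤ (F A₁.X)) A₁.X A₀.X)))) ([m+kn]%n≡m%n A₀.X (A₀.Qᶜ * A₁.X + A₀.Qᶜ * p₁ * νℤ (F A₁.X)) q)))

    chain : ∀ c → At.X 0 % q ≡ At.X c % q
    chain zero    = refl
    chain (suc c) = trans (chain c) (next c)

    -- Between its first and last break f has a multiple of q roots; at most x before and r − x after.
    residue : k % q ≤ r
    residue = begin
      k % q                 ≡⟨ cong (_% q) (sym (m∸n+n≡m A₀.X≤k)) ⟩
      (u + A₀.X) % q        ≡⟨ cong (_% q) (trans (cong (u +_) (m≡m%n+[m/n]*n A₀.X q)) (sym (+-assoc u _ _))) ⟩
      (u + A₀.X % q + A₀.X / q * q) % q ≡⟨ [m+kn]%n≡m%n _ (A₀.X / q) q ⟩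
      (u + A₀.X % q) % q    ≤⟨ m%n≤m _ q ⟩
      u + A₀.X % q          ≡⟨ cong (u +_) (chain m) ⟩
      u + Aₘ.X % q          ≤⟨ +-mono-≤ u≤x (≤-trans (m%n≤m Aₘ.X q) Xₘ≤) ⟩
      x + (r ∸ x)           ≡⟨ m+[n∸m]≡n x≤r ⟩
      r                     ∎
      where
      open ≤-Reasoning
      -- The two ends of the long edges: level 0 has Q = 1 and φ = x, and level m has ρ = m because
      -- m < p^m, so φ = x + m q.
      module A₀ = At 0
      module Aₘ = At m
      u = k ∸ A₀.X
      instance
        _ = A₀.Qᶜ≢0
        _ = Aₘ.Qᶜ≢0
      φ₀≡ : A₀.φᶜ ≡ x
      φ₀≡ = trans (cong (λ z → x + z * q) (n%1≡0 m)) (+-identityʳ x)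
      φₘ≡ : Aₘ.φᶜ ≡ x + m * q
      φₘ≡ = cong (λ z → x + z * q) (m<n⇒m%n≡m (n<p^n m))
      Xₘ≤ : Aₘ.X ≤ r ∸ x
      Xₘ≤ = ≤-trans (m≤m+n _ Aₘ.Y) (≤-reflexive (trans Aₘ.X+Y (trans (cong (n ∸_) φₘ≡) ([m+o]∸[n+o] ))))
        where
        [m+o]∸[n+o] : r + m * q ∸ (x + m * q) ≡ r ∸ x
        [m+o]∸[n+o] = trans (cong₂ _∸_ (+-comm r (m * q)) (+-comm x (m * q))) ([m+n]∸[m+o]≡n∸o (m * q) r x)
      u≤x : u ≤ x
      u≤x = +-cancelʳ-≤ (A₀.X + (n ∸ k)) u x (begin
        u + (A₀.X + (n ∸ k))   ≡⟨ +-assoc u A₀.X _ ⟨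
        u + A₀.X + (n ∸ k)     ≡⟨ cong (_+ (n ∸ k)) (m∸n+n≡m A₀.X≤k) ⟩
        k + (n ∸ k)            ≡⟨ m+[n∸m]≡n k≤n ⟩
        n                      ≡⟨ m+[n∸m]≡n (≤-trans x≤r (m≤m+n r (m * q))) ⟨
        x + (n ∸ x)            ≡⟨ cong (λ z → x + (n ∸ z)) φ₀≡ ⟨
        x + (n ∸ A₀.φᶜ)        ≡⟨ cong (x +_) A₀.X+Y ⟨
        x + (A₀.X + A₀.Y)      ≤⟨ +-monoʳ-≤ x (+-monoʳ-≤ A₀.X A₀.Y≤) ⟩
        x + (A₀.X + (n ∸ k))   ∎)

-- Two criteria that exclude a degree by the slopes of the polygon.

module SlopeCriteria where
  open DigitSums
  open Valuations
  open DumasLemma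
  open CoefficientProfile
  open Factorisations
  open import Data.Nat
  open import Data.Nat.Properties
  open import Data.Nat.DivMod
  open import Data.Nat.Divisibility
  open import Data.Nat.Primality
  open import Data.Nat.Tactic.RingSolver using (solve-∀)
  open import Data.Product
  open import Data.Sum using (_⊎_; inj₁; inj₂)
  open import Data.Empty using (⊥; ⊥-elim)
  open import Relation.Nullary
  open import Relation.Binary.PropositionalEquality
  open import Relation.Binary.Definitions using (tri<; tri≈; tri>)

  module DigitCarries (p₂ : ℕ) where
    open Digits p₂

    S<id : ∀ x → p ≤ x → S x < x
    S<id x p≤x with divView p₁ x
    ... | dv d zero    d< = ⊥-elim (<⇒≱ d< (subst (p ≤_) (+-identityʳ d) p≤x))
    ... | dv d (suc y) d< = subst (_< d + suc y * p) (sym (S-digit d (suc y) d<))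
          (+-monoʳ-< d (≤-<-trans (S≤id (suc y)) (m<m*n (suc y) p 1<p)))

    S-carry : ∀ a b → p ≤ a % p + b % p → S (a + b) < S a + S b
    S-carry a b = go (a % p) (b % p) (a / p) (b / p) (m%n<n a p) (m%n<n b p) (m≡m%n+[m/n]*n a p) (m≡m%n+[m/n]*n b p)
      where
      open ≤-Reasoning
      go : ∀ d e x y → d < p → e < p → a ≡ d + x * p → b ≡ e + y * p → p ≤ d + e → S (a + b) < S a + S b
      go d e x y d< e< refl refl p≤ = begin-strict
        S (d + x * p + (e + y * p))     ≡⟨ cong S (trans (arr d x e y p) (trans (cong (_+ (x + y) * p) (sym c+)) (arr₂ c p (x + y)))) ⟩
        S (c + suc (x + y) * p)         ≡⟨ S-digit c (suc (x + y)) c< ⟩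
        c + S (suc (x + y))             ≤⟨ +-monoʳ-≤ c (≤-trans (S-suc (x + y)) (s≤s (S-sub x y))) ⟩
        c + suc (S x + S y)             <⟨ +-monoʳ-< c (+-monoˡ-< (S x + S y) 1<p) ⟩
        c + (p + (S x + S y))           ≡⟨ +-assoc c p _ ⟨
        c + p + (S x + S y)             ≡⟨ cong (_+ (S x + S y)) c+ ⟩
        d + e + (S x + S y)             ≡⟨ arr₃ d e (S x) (S y) ⟩
        (d + S x) + (e + S y)           ≡⟨ cong₂ _+_ (S-digit d x d<) (S-digit e y e<) ⟨
        S (d + x * p) + S (e + y * p)   ∎
        where
        c = d + e ∸ p
        c+ : c + p ≡ d + e
        c+ = m∸n+n≡m p≤
        c< : c < p
        c< = +-cancelʳ-< p c p (subst (_< p + p) (sym c+) (+-mono-< d< e<))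
        arr : ∀ d x e y q → d + x * q + (e + y * q) ≡ (d + e) + (x + y) * q
        arr = solve-∀
        arr₂ : ∀ c q z → (c + q) + z * q ≡ c + suc z * q
        arr₂ = solve-∀
        arr₃ : ∀ d e a b → d + e + (a + b) ≡ (d + a) + (e + b)
        arr₃ = solve-∀

    S-∸ : ∀ x j → j ≤ x % p → S x ≡ S (x ∸ j) + j
    S-∸ x j j≤ = go (x % p) (x / p) (m%n<n x p) j≤ (m≡m%n+[m/n]*n x p)
      where
      arr : ∀ a b c → a + b + c ≡ (a + c) + b
      arr = solve-∀
      go : ∀ d y → d < p → j ≤ d → x ≡ d + y * p → S x ≡ S (x ∸ j) + j
      go d y d< j≤d refl = begin
        S (d + y * p)              ≡⟨ S-digit d y d< ⟩
        d + S y                    ≡⟨ cong (_+ S y) (m∸n+n≡m j≤d) ⟨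
        (d ∸ j) + j + S y          ≡⟨ arr (d ∸ j) j (S y) ⟩
        (d ∸ j) + S y + j          ≡⟨ cong (_+ j) (S-digit (d ∸ j) y (≤-<-trans (m∸n≤m d j) d<)) ⟨
        S ((d ∸ j) + y * p) + j    ≡⟨ cong (λ z → S z + j) (+-∸-comm (y * p) j≤d) ⟨
        S (d + y * p ∸ j) + j      ∎
        where open ≡-Reasoning

  module Criteria (p₂ : ℕ) (pp : Prime (suc (suc p₂))) {n s k : ℕ} (fac : Factors n s k) where
    open Local p₂ pp fac
    open DigitCarries p₂

    -- If the part of the Newton polygon between the breaks φ and φ′ has slopes that no segment of
    -- length d ≤ k with integral rise can have, then f has no roots there.
    two-slopes : ∀ A β A′ β′ .{{_ : NonZero A}} .{{_ : NonZero A′}} φ φ′ → φ ≤ n → φ′ ≤ n →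
      Slope.Break A β φ → Slope.Break A′ β′ φ′ → β * A′ ≤ β′ * A →
      (∀ d ρ → 1 ≤ d → d ≤ k → β * d ≤ A * p₁ * ρ → A′ * p₁ * ρ < β′ * d → ⊥) →
      φ′ ≤ φ + (n ∸ k)
    two-slopes A β A′ β′ φ φ′ φ≤n φ′≤n B B′ slopes noint = +-cancelʳ-≤ (n ∸ φ′) _ _ (begin
        φ′ + (n ∸ φ′)               ≡⟨ m+[n∸m]≡n φ′≤n ⟩
        n                           ≡⟨ m+[n∸m]≡n φ≤n ⟨
        φ + (n ∸ φ)                 ≡⟨ cong (φ +_) (sym B.X+Y) ⟩
        φ + (B.X + B.Y)             ≤⟨ +-monoʳ-≤ φ (+-mono-≤ (≤-reflexive X≡) B.Y≤) ⟩
        φ + (B′.X + (n ∸ k))        ≤⟨ +-monoʳ-≤ φ (+-monoˡ-≤ (n ∸ k) (≤-trans (m≤m+n B′.X B′.Y) (≤-reflexive B′.X+Y))) ⟩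
        φ + ((n ∸ φ′) + (n ∸ k))    ≡⟨ arr φ (n ∸ φ′) (n ∸ k) ⟩
        φ + (n ∸ k) + (n ∸ φ′)      ∎)
      where
      open ≤-Reasoning
      arr : ∀ a b c → a + (b + c) ≡ a + c + b
      arr = solve-∀
      module W = Slope A β
      module W′ = Slope A′ β′
      module B = W.Break B
      module B′ = W′.Break B′
      α = A * p₁
      α′ = A′ * p₁
      instance
        α≢0 : NonZero α
        α≢0 = m*n≢0 A p₁
        α′≢0 : NonZero α′
        α′≢0 = m*n≢0 A′ p₁
      v = νℤ (F B.X)
      v′ = νℤ (F B′.X)
      nzX = W.Arg.nz B.argF
      nzX′ = W′.Arg.nz B′.argF
      shift : ∀ a b d X → a + b * (X + d) ≡ a + b * d + b * X
      shift = solve-∀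
      lin : ∀ a v ρ → a * (v + ρ) ≡ a * v + a * ρ
      lin = solve-∀
      X≡ : B.X ≡ B′.X
      X≡ with <-cmp B.X B′.X
      ... | tri≈ _ e _ = e
      -- A steeper weight moves the minimiser to smaller indices, so this order contradicts
      -- `slopes`.
      ... | tri< X<X′ _ _ = ⊥-elim contra
        where
        d = B′.X ∸ B.X
        X′≡ : B′.X ≡ B.X + d
        X′≡ = sym (m+[n∸m]≡n (<⇒≤ X<X′))
        lt : α * v < α * v′ + β * d
        lt = +-cancelʳ-< (β * B.X) _ _ (subst (α * v + β * B.X <_) (trans (cong (λ z → α * v′ + β * z) X′≡) (shift (α * v′) β d B.X))
               (W.Arg.strict B.argF B′.X X<X′ nzX′))
        le : α′ * v′ + β′ * d ≤ α′ * v
        le = +-cancelʳ-≤ (β′ * B.X) _ _ (subst (_≤ α′ * v + β′ * B.X) (trans (cong (λ z → α′ * v′ + β′ * z) X′≡) (shift (α′ * v′) β′ d B.X))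
               (W′.Arg.least B′.argF B.X nzX))
        v′≤v : v′ ≤ v
        v′≤v = *-cancelˡ-≤ α′ (≤-trans (m≤m+n _ _) le)
        ρ = v ∸ v′
        v≡ : v ≡ v′ + ρ
        v≡ = sym (m+[n∸m]≡n v′≤v)
        lt′ : α * ρ < β * d
        lt′ = +-cancelˡ-< (α * v′) _ _ (subst (_< α * v′ + β * d) (trans (cong (α *_) v≡) (lin α v′ ρ)) lt)
        le′ : β′ * d ≤ α′ * ρ
        le′ = +-cancelˡ-≤ (α′ * v′) _ _ (subst (α′ * v′ + β′ * d ≤_) (trans (cong (α′ *_) v≡) (lin α′ v′ ρ)) le)
        contra : ⊥
        contra = <-irrefl refl (begin-strict
          α′ * (α * ρ)         <⟨ *-monoʳ-< α′ lt′ ⟩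
          α′ * (β * d)         ≡⟨ a₁ A′ p₁ β d ⟩
          (β * A′) * (p₁ * d)  ≤⟨ *-monoˡ-≤ (p₁ * d) slopes ⟩
          (β′ * A) * (p₁ * d)  ≡⟨ a₁ A p₁ β′ d ⟨
          α * (β′ * d)         ≤⟨ *-monoʳ-≤ α le′ ⟩
          α * (α′ * ρ)         ≡⟨ a₂ α α′ ρ ⟩
          α′ * (α * ρ)         ∎)
          where
          a₁ : ∀ A q b d → A * q * (b * d) ≡ (b * A) * (q * d)
          a₁ = solve-∀
          a₂ : ∀ a b c → a * (b * c) ≡ b * (a * c)
          a₂ = solve-∀
      -- Here f would have a segment of length d ≤ k and integral rise ρ with slope between β/α and
      -- β′/α′, which `noint` forbids.
      ... | tri> _ _ X′<X = ⊥-elim (noint d ρ 1≤d d≤k le′ lt′)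
        where
        d = B.X ∸ B′.X
        X≡′ : B.X ≡ B′.X + d
        X≡′ = sym (m+[n∸m]≡n (<⇒≤ X′<X))
        1≤d : 1 ≤ d
        1≤d = m<n⇒0<n∸m X′<X
        d≤k : d ≤ k
        d≤k = ≤-trans (m∸n≤m B.X B′.X) B.X≤k
        le : α * v + β * d ≤ α * v′
        le = +-cancelʳ-≤ (β * B′.X) _ _ (subst (_≤ α * v′ + β * B′.X) (trans (cong (λ z → α * v + β * z) X≡′) (shift (α * v) β d B′.X))
               (W.Arg.least B.argF B′.X nzX′))
        lt : α′ * v′ < α′ * v + β′ * d
        lt = +-cancelʳ-< (β′ * B′.X) _ _ (subst (α′ * v′ + β′ * B′.X <_) (trans (cong (λ z → α′ * v + β′ * z) X≡′) (shift (α′ * v) β′ d B′.X))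
               (W′.Arg.strict B′.argF B.X X′<X nzX))
        ρ = v′ ∸ v
        v′≡ : v′ ≡ v + ρ
        v′≡ = sym (m+[n∸m]≡n (*-cancelˡ-≤ α (≤-trans (m≤m+n _ _) le)))
        le′ : β * d ≤ α * ρ
        le′ = +-cancelˡ-≤ (α * v) _ _ (subst (α * v + β * d ≤_) (trans (cong (α *_) v′≡) (lin α v ρ)) le)
        lt′ : α′ * ρ < β′ * d
        lt′ = +-cancelˡ-< (α′ * v) _ _ (subst (_< α′ * v + β′ * d) (trans (cong (α′ *_) v′≡) (lin α′ v ρ)) lt)

    -- p divides the coefficients of index ≥ k from the top, while all slopes are < 1/k.
    small-slopes : ∀ c → 1 ≤ k → k < p → (n % p < k ⊎ p ≤ s % p + k) →
      κ n ≤ p₁ * c → k * c ≤ (n + s) % p → k * suc c < p → ⊥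
    small-slopes c 1≤k k<p early κ≤ kc≤u kc<p = <⇒≱ φ<k k≤φ
      where
      open ≤-Reasoning
      -- As A exceeds n, the weight compares valuations before positions: φ is the last i for which
      -- p does not divide the coefficient of x^(n - i) in g₁.
      A = suc n
      U₁ = U A 1
      minimum = first-min U₁ n
      φ = proj₁ minimum
      φ≤n = proj₁ (proj₂ minimum)
      B : Slope.Break A 1 φ
      B = Slope.break A 1 φ φ≤n λ i i≤n → proj₁ (proj₂ (proj₂ minimum)) i i≤n , proj₂ (proj₂ (proj₂ minimum)) i
      instance
        k≢0 : NonZero k
        k≢0 = >-nonZero 1≤k
      κ-0 : T n 0 ≡ S n
      κ-0 = trans (cong (S n +_) (trans (cong (λ z → S s + 0 ∸ S z) (+-identityʳ s)) (trans (cong (_∸ S s) (+-identityʳ (S s))) (n∸n≡0 (S s))))) (+-identityʳ (S n))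
      positive : ∀ i → k ≤ i → i ≤ n → S n < i + T n i
      positive i k≤i i≤n = +-cancelʳ-< (S (s + i)) _ _ (subst (S n + S (s + i) <_) (sym total) (strictly early))
        where
        arr : ∀ i a b c → i + (a + b) + c ≡ i + a + (b + c)
        arr = solve-∀
        total : i + T n i + S (s + i) ≡ i + S (n ∸ i) + (S s + S i)
        total = trans (arr i (S (n ∸ i)) (κ i) (S (s + i))) (cong (i + S (n ∸ i) +_) (κ-eq i))
        n≡ : i + (n ∸ i) ≡ n
        n≡ = m+[n∸m]≡n i≤n
        sub₁ : S n ≤ S i + S (n ∸ i)
        sub₁ = subst (λ z → S z ≤ S i + S (n ∸ i)) n≡ (S-sub i (n ∸ i))
        -- That coefficient is i! C(n,i) C(s+i,i). For i ≥ p the prime divides i!; for k ≤ i < p the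
        -- hypothesis yields a carry in i + (n - i) or in s + i, that is, p divides one of the
        -- binomials.
        strictly : (n % p < k ⊎ p ≤ s % p + k) → S n + S (s + i) < i + S (n ∸ i) + (S s + S i)
        strictly hyp with p ≤? i | hyp
        ... | yes p≤i | _ = +-mono-<-≤ (≤-<-trans sub₁ (+-monoˡ-< (S (n ∸ i)) (S<id i p≤i))) (S-sub s i)
        ... | no p≰i | inj₁ n%<k = +-mono-<-≤ (<-≤-trans (subst (λ z → S z < S i + S (n ∸ i)) n≡ (S-carry i (n ∸ i) carry)) (+-monoˡ-≤ (S (n ∸ i)) (S≤id i))) (S-sub s i)
          where
          i%p : i % p ≡ i
          i%p = m<n⇒m%n≡m (≰⇒> p≰i)
          carry : p ≤ i % p + (n ∸ i) % p
          carry = ≮⇒≥ λ lt → <⇒≱ n%<k (begin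
            k                         ≤⟨ k≤i ⟩
            i                         ≤⟨ m≤m+n i _ ⟩
            i + (n ∸ i) % p           ≡⟨ cong (_+ (n ∸ i) % p) i%p ⟨
            i % p + (n ∸ i) % p       ≡⟨ m<n⇒m%n≡m lt ⟨
            (i % p + (n ∸ i) % p) % p ≡⟨ %-distribˡ-+ i (n ∸ i) p ⟨
            (i + (n ∸ i)) % p         ≡⟨ cong (_% p) n≡ ⟩
            n % p                     ∎)
        ... | no p≰i | inj₂ carry = +-mono-≤-< (≤-trans sub₁ (+-monoˡ-≤ (S (n ∸ i)) (S≤id i)))
              (S-carry s i (≤-trans carry (+-monoʳ-≤ (s % p) (≤-trans k≤i (≤-reflexive (sym (m<n⇒m%n≡m (≰⇒> p≰i))))))))
      φ<k : φ < k
      φ<k = ≰⇒> λ k≤φ → <⇒≱ (begin-strict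
        A * (0 + T n 0) + 1 * n         ≡⟨ cong₂ (λ z t → A * z + t) κ-0 (*-identityˡ n) ⟩
        A * S n + n                     <⟨ +-monoʳ-< (A * S n) (n<1+n n) ⟩
        A * S n + A                     ≡⟨ trans (+-comm _ A) (sym (*-suc A (S n))) ⟩
        A * suc (S n)                   ≤⟨ *-monoʳ-≤ A (positive φ k≤φ φ≤n) ⟩
        A * (φ + T n φ)                 ≤⟨ m≤m+n _ _ ⟩
        U₁ φ                            ∎) (proj₁ (proj₂ (proj₂ minimum)) 0 z≤n)
      u<p : (n + s) % p < p
      u<p = m%n<n (n + s) p
      κ-near : ∀ j → j ≤ (n + s) % p → j ≤ n → κ n ≤ κ (n ∸ j)
      κ-near j j≤u j≤n = +-cancelʳ-≤ (S (s + (n ∸ j)) + j) _ _ (begin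
        κ n + (S (s + (n ∸ j)) + j)           ≡⟨ cong (λ z → κ n + (S z + j)) (sym (+-∸-assoc s j≤n)) ⟩
        κ n + (S (s + n ∸ j) + j)             ≡⟨ cong (κ n +_) (sym (S-∸ (s + n) j (subst (λ z → j ≤ z % p) (+-comm n s) j≤u))) ⟩
        κ n + S (s + n)                       ≡⟨ κ-eq n ⟩
        S s + S n                             ≤⟨ +-monoʳ-≤ (S s) (subst (λ z → S z ≤ S (n ∸ j) + S j) (m∸n+n≡m j≤n) (S-sub (n ∸ j) j)) ⟩
        S s + (S (n ∸ j) + S j)               ≤⟨ +-monoʳ-≤ (S s) (+-monoʳ-≤ (S (n ∸ j)) (S≤id j)) ⟩
        S s + (S (n ∸ j) + j)                 ≡⟨ +-assoc (S s) _ j ⟨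
        S s + S (n ∸ j) + j                   ≡⟨ cong (_+ j) (κ-eq (n ∸ j)) ⟨
        κ (n ∸ j) + S (s + (n ∸ j)) + j       ≡⟨ +-assoc (κ (n ∸ j)) _ j ⟩
        κ (n ∸ j) + (S (s + (n ∸ j)) + j)     ∎)
      -- The last vertex lies strictly below every line of slope 1/k from the others. Removing j up
      -- to the last digit of n + s does not lower κ; for larger j < p the bound on k c suffices,
      -- and from p on the bound on k (c + 1).
      key : ∀ j → 1 ≤ j → j ≤ n → k * (j + κ n) < k * (S j + κ (n ∸ j)) + p₁ * j
      key j 1≤j j≤n with j ≤? (n + s) % p
      ... | yes j≤u = begin-strict
        k * (j + κ n)                         ≤⟨ *-monoʳ-≤ k (+-mono-≤ (≤-reflexive (sym (S-small j (≤-<-trans j≤u u<p)))) (κ-near j j≤u j≤n)) ⟩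
        k * (S j + κ (n ∸ j))                 <⟨ m<m+n _ (*-mono-≤ {1} {p₁} (s≤s z≤n) 1≤j) ⟩
        k * (S j + κ (n ∸ j)) + p₁ * j        ∎
      ... | no j≰u with j <? p
      ...   | yes j<p = begin-strict
        k * (j + κ n)                         ≤⟨ *-monoʳ-≤ k (+-monoʳ-≤ j κ≤) ⟩
        k * (j + p₁ * c)                      ≡⟨ arr k j p₁ c ⟩
        k * j + p₁ * (k * c)                  <⟨ +-mono-≤-< (*-monoʳ-≤ k (≤-trans (≤-reflexive (sym (S-small j j<p))) (m≤m+n (S j) _))) (*-monoʳ-< p₁ (≤-<-trans kc≤u (≰⇒> j≰u))) ⟩
        k * (S j + κ (n ∸ j)) + p₁ * j        ∎
        where
        arr : ∀ k j q c → k * (j + q * c) ≡ k * j + q * (k * c)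
        arr = solve-∀
      ...   | no j≮p = begin-strict
        k * (j + κ n)                         ≤⟨ *-monoʳ-≤ k (+-monoʳ-≤ j κ≤) ⟩
        k * (j + p₁ * c)                      ≡⟨ arr k j p₁ c ⟩
        k * j + p₁ * (k * c)                  <⟨ +-monoʳ-< (k * j) (m<m+n _ 1≤k) ⟩
        k * j + (p₁ * (k * c) + k)            ≤⟨ +-monoʳ-≤ (k * j) (+-monoˡ-≤ k (*-monoˡ-≤ (k * c) (≤-trans (n≤1+n p₁) (≮⇒≥ j≮p)))) ⟩
        k * j + (j * (k * c) + k)             ≡⟨ arr₂ k j c ⟩
        k * 1 + (k * suc c) * j               ≤⟨ +-mono-≤ (*-monoʳ-≤ k (≤-trans (S-pos j 1≤j) (m≤m+n (S j) _))) (*-monoˡ-≤ j (≤-pred kc<p)) ⟩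
        k * (S j + κ (n ∸ j)) + p₁ * j        ∎
        where
        arr : ∀ k j q c → k * (j + q * c) ≡ k * j + q * (k * c)
        arr = solve-∀
        arr₂ : ∀ k j c → k * j + (j * (k * c) + k) ≡ k * 1 + (k * suc c) * j
        arr₂ = solve-∀
      last-lt : ∀ i → i < n → U k p₁ n < U k p₁ i
      last-lt i i<n = begin-strict
        k * (n + (S (n ∸ n) + κ n)) + p₁ * (n ∸ n)      ≡⟨ cong (λ z → k * (n + (S z + κ n)) + p₁ * z) (n∸n≡0 n) ⟩
        k * (n + κ n) + p₁ * 0                          ≡⟨ trans (cong (k * (n + κ n) +_) (*-zeroʳ p₁)) (+-identityʳ _) ⟩
        k * (n + κ n)                                   ≡⟨ cong (λ z → k * (z + κ n)) (sym (m+[n∸m]≡n i≤n)) ⟩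
        k * (i + j + κ n)                               ≡⟨ arr k i j (κ n) ⟩
        k * i + k * (j + κ n)                           <⟨ +-monoʳ-< (k * i) (key j (m<n⇒0<n∸m i<n) (m∸n≤m n i)) ⟩
        k * i + (k * (S j + κ (n ∸ j)) + p₁ * j)        ≡⟨ arr₂ k i (S j) (κ (n ∸ j)) (p₁ * j) ⟩
        k * (i + (S j + κ (n ∸ j))) + p₁ * j            ≡⟨ cong (λ z → k * (i + (S j + κ z)) + p₁ * j) (m∸[m∸n]≡n i≤n) ⟩
        k * (i + (S j + κ i)) + p₁ * j                  ∎
        where
        i≤n = <⇒≤ i<n
        j = n ∸ i
        arr : ∀ k i j t → k * (i + j + t) ≡ k * i + k * (j + t)
        arr = solve-∀
        arr₂ : ∀ k i a b c → k * i + (k * (a + b) + c) ≡ k * (i + (a + b)) + c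
        arr₂ = solve-∀
      B′ : Slope.Break k p₁ n
      B′ = Slope.break k p₁ n ≤-refl at-n
        where
        at-n : ∀ i → i ≤ n → U k p₁ n ≤ U k p₁ i × (i < n → U k p₁ n < U k p₁ i)
        at-n i i≤n with i ≟ n
        ... | yes refl = ≤-refl , λ n<n → ⊥-elim (<-irrefl refl n<n)
        ... | no ne = <⇒≤ (last-lt i (≤∧≢⇒< i≤n ne)) , last-lt i
      -- A slope strictly between 0 and 1/k over a length d ≤ k would need a rise strictly between 0
      -- and 1.
      no-rise : ∀ d ρ → 1 ≤ d → d ≤ k → 1 * d ≤ A * p₁ * ρ → k * p₁ * ρ < p₁ * d → ⊥
      no-rise d zero    1≤d d≤k le lt = <⇒≱ 1≤d (≤-trans (≤-reflexive (sym (*-identityˡ d))) (≤-trans le (≤-reflexive (*-zeroʳ (A * p₁)))))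
      no-rise d (suc ρ) 1≤d d≤k le lt = <⇒≱ lt (begin
        p₁ * d           ≤⟨ *-monoʳ-≤ p₁ d≤k ⟩
        p₁ * k           ≡⟨ *-comm p₁ k ⟩
        k * p₁           ≤⟨ m≤m*n (k * p₁) (suc ρ) ⟩
        k * p₁ * suc ρ   ∎)
      k≤φ : k ≤ φ
      k≤φ = +-cancelʳ-≤ (n ∸ k) _ _ (subst (_≤ φ + (n ∸ k)) (sym (m+[n∸m]≡n k≤n))
        (two-slopes A 1 k p₁ φ n φ≤n ≤-refl B B′ (begin
          1 * k      ≡⟨ *-identityˡ k ⟩
          k          ≤⟨ ≤-pred k<p ⟩
          p₁         ≤⟨ m≤m*n p₁ A ⟩
          p₁ * A     ∎) no-rise))

-- Gamma moments and the positivity of g₁ in even degree.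

module LaguerreExpansion where
  open Valuations
  open DumasLemma
  open Factorisations
  open import Data.Nat as ℕ using (ℕ; zero; suc; z≤n; s≤s; _∸_; _!)
  import Data.Nat.Properties as ℕ
  open import Data.Nat.Combinatorics using (_C_; nCk+nC[k+1]≡[n+1]C[k+1]; k>n⇒nCk≡0; nCn≡1)
  import Data.Nat.Tactic.RingSolver as ℕR
  open import Data.Integer using (ℤ; +_; _+_; _*_; 0ℤ; 1ℤ; ∣_∣; -[1+_])
  open import Data.Integer.Properties
  open import Data.Integer.Tactic.RingSolver using (solve-∀)
  open import Data.Product
  open import Data.Sum using (inj₁; inj₂)
  open import Data.Empty using (⊥)
  open import Relation.Nullary
  open import Relation.Binary.PropositionalEquality
  open import Relation.Binary.Definitions using (tri<; tri≈; tri>)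

  Σ[_] : ℕ → (ℕ → ℤ) → ℤ
  Σ[ zero  ] f = 0ℤ
  Σ[ suc N ] f = Σ[ N ] f + f N

  Σ-cong : ∀ N {f g} → (∀ i → i ℕ.< N → f i ≡ g i) → Σ[ N ] f ≡ Σ[ N ] g
  Σ-cong zero    e = refl
  Σ-cong (suc N) e = cong₂ _+_ (Σ-cong N λ i i< → e i (ℕ.m≤n⇒m≤1+n i<)) (e N ℕ.≤-refl)

  Σ-+ : ∀ N f g → Σ[ N ] (λ i → f i + g i) ≡ Σ[ N ] f + Σ[ N ] g
  Σ-+ zero    f g = refl
  Σ-+ (suc N) f g = trans (cong (_+ (f N + g N)) (Σ-+ N f g)) (arr (Σ[ N ] f) (Σ[ N ] g) (f N) (g N))
    where
    arr : ∀ a b c d → (a + b) + (c + d) ≡ (a + c) + (b + d)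
    arr = solve-∀

  Σ-* : ∀ N c f → Σ[ N ] (λ i → c * f i) ≡ c * Σ[ N ] f
  Σ-* zero    c f = sym (*-zeroʳ c)
  Σ-* (suc N) c f = trans (cong (_+ c * f N) (Σ-* N c f)) (sym (*-distribˡ-+ c (Σ[ N ] f) (f N)))

  Σ-head : ∀ N f → Σ[ suc N ] f ≡ f 0 + Σ[ N ] (λ i → f (suc i))
  Σ-head zero    f = +-comm 0ℤ (f 0)
  Σ-head (suc N) f = trans (cong (_+ f (suc N)) (Σ-head N f)) (+-assoc (f 0) (Σ[ N ] (λ i → f (suc i))) (f (suc N)))

  rising : ℕ → ℕ → ℕ
  rising s zero    = 1
  rising s (suc i) = suc s ℕ.* rising (suc s) i

  -- C(n,i) (s+1)⋯(s+i), the coefficient of x^(n − i) in g₁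
  coef : ℕ → ℕ → ℕ → ℕ
  coef n s i = (n C i) ℕ.* rising s i

  pascal : ∀ n k → + (suc n C suc k) ≡ + (n C k) + + (n C suc k)
  pascal n k = trans (cong +_ (sym (nCk+nC[k+1]≡[n+1]C[k+1] n k))) (pos-+ (n C k) (n C suc k))

  C-out : ∀ n k → n ℕ.< k → + (n C k) ≡ 0ℤ
  C-out n k n<k = cong +_ (k>n⇒nCk≡0 n<k)

  C-absorb : ∀ a b → suc a ℕ.* ((suc a ℕ.+ b) C suc a) ≡ suc b ℕ.* ((a ℕ.+ suc b) C a)
  C-absorb a b = ℕ.*-cancelʳ-≡ _ _ (a ! ℕ.* b !) {{a ℕ.!* b !≢0}} (begin
    suc a ℕ.* ((suc a ℕ.+ b) C suc a) ℕ.* (a ! ℕ.* b !)   ≡⟨ arr₁ (suc a) ((suc a ℕ.+ b) C suc a) (a !) (b !) ⟩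
    ((suc a ℕ.+ b) C suc a) ℕ.* (suc a ! ℕ.* b !)         ≡⟨ C-factorials (suc a) b ⟩
    (suc a ℕ.+ b) !                                       ≡⟨ cong _! (sym (ℕ.+-suc a b)) ⟩
    (a ℕ.+ suc b) !                                       ≡⟨ sym (C-factorials a (suc b)) ⟩
    ((a ℕ.+ suc b) C a) ℕ.* (a ! ℕ.* suc b !)             ≡⟨ arr₂ (suc b) ((a ℕ.+ suc b) C a) (a !) (b !) ⟩
    suc b ℕ.* ((a ℕ.+ suc b) C a) ℕ.* (a ! ℕ.* b !)       ∎)
    where
    open ≡-Reasoning
    arr₁ : ∀ t c a b → t ℕ.* c ℕ.* (a ℕ.* b) ≡ c ℕ.* ((t ℕ.* a) ℕ.* b)
    arr₁ = ℕR.solve-∀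
    arr₂ : ∀ t c a b → c ℕ.* (a ℕ.* (t ℕ.* b)) ≡ t ℕ.* c ℕ.* (a ℕ.* b)
    arr₂ = ℕR.solve-∀

  -- g n s x y = E (x + y U)ⁿ, where U has moments E Uⁱ = (s+1)⋯(s+i); the recursion peels off one factor.
  module Moments (x y : ℤ) where

    g : ℕ → ℕ → ℤ
    g zero    s = 1ℤ
    g (suc n) s = x * g n s + + (suc s) * (y * g n (suc s))

    Y : ℕ → ℤ
    Y zero    = 1ℤ
    Y (suc k) = y * Y k

    X : ℕ → ℤ
    X zero    = 1ℤ
    X (suc k) = x * X k

    -- Integration by parts against the gamma density: the mean of f(U) for s + 1 is its mean for s
    -- plus the mean of f′(U) for s + 1. Here f(U) = (x + y U)^(m+1).
    g-step : ∀ m s → g (suc m) (suc s) ≡ g (suc m) s + + (suc m) * (y * g m (suc s))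
    g-step zero    s = trans (cong (λ z → x * 1ℤ + z * (y * 1ℤ)) (pos-+ 1 (suc s))) (arr x y (+ suc s))
      where
      arr : ∀ x y t → x * 1ℤ + (1ℤ + t) * (y * 1ℤ) ≡ (x * 1ℤ + t * (y * 1ℤ)) + 1ℤ * (y * 1ℤ)
      arr = solve-∀
    g-step (suc m) s = begin
      x * g (suc m) (suc s) + + suc (suc s) * (y * g (suc m) (suc (suc s)))
        ≡⟨ cong₂ (λ u v → x * u + + suc (suc s) * (y * v)) (g-step m s) (g-step m (suc s)) ⟩
      x * (g (suc m) s + + (suc m) * (y * g m (suc s))) + + suc (suc s) * (y * (g (suc m) (suc s) + + (suc m) * (y * g m (suc (suc s)))))
        ≡⟨ cong (λ t → x * (g (suc m) s + + (suc m) * (y * g m (suc s))) + t * (y * (g (suc m) (suc s) + + (suc m) * (y * g m (suc (suc s)))))) (pos-+ 1 (suc s)) ⟩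
      x * (g (suc m) s + + (suc m) * (y * g m (suc s))) + (1ℤ + + suc s) * (y * (g (suc m) (suc s) + + (suc m) * (y * g m (suc (suc s)))))
        ≡⟨ arr x y (+ suc s) (+ suc m) (g (suc m) s) (g m (suc s)) (g (suc m) (suc s)) (g m (suc (suc s))) ⟩
      (x * g (suc m) s + + suc s * (y * g (suc m) (suc s))) + (y * g (suc m) (suc s) + + suc m * (y * (x * g m (suc s) + (1ℤ + + suc s) * (y * g m (suc (suc s))))))
        ≡⟨ cong (λ t → (x * g (suc m) s + + suc s * (y * g (suc m) (suc s))) + (y * g (suc m) (suc s) + + suc m * (y * (x * g m (suc s) + t * (y * g m (suc (suc s)))))))  (sym (pos-+ 1 (suc s))) ⟩
      g (suc (suc m)) s + (y * g (suc m) (suc s) + + suc m * (y * g (suc m) (suc s)))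
        ≡⟨ cong (λ ∙ → g (suc (suc m)) s + ∙) (trans (arr₂ (y * g (suc m) (suc s)) (+ suc m)) (cong (_* (y * g (suc m) (suc s))) (sym (pos-+ 1 (suc m))))) ⟩
      g (suc (suc m)) s + + suc (suc m) * (y * g (suc m) (suc s)) ∎
      where
      open ≡-Reasoning
      arr : ∀ x y t m a b c d → x * (a + m * (y * b)) + (1ℤ + t) * (y * (c + m * (y * d)))
            ≡ (x * a + t * (y * c)) + (y * c + m * (y * (x * b + (1ℤ + t) * (y * d))))
      arr = solve-∀
      arr₂ : ∀ c m → c + m * c ≡ (1ℤ + m) * c
      arr₂ = solve-∀

    N : ℕ → ℕ → ℕ
    N zero    s = 1
    N (suc k) s = suc k ℕ.* (suc (s ℕ.+ k) ℕ.* N k s)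

    N-shift : ∀ k s → suc s ℕ.* N k (suc s) ≡ suc (s ℕ.+ k) ℕ.* N k s
    N-shift zero    s = cong (λ z → suc z ℕ.* 1) (sym (ℕ.+-identityʳ s))
    N-shift (suc k) s = begin
      suc s ℕ.* (suc k ℕ.* (suc (suc s ℕ.+ k) ℕ.* N k (suc s)))  ≡⟨ arr (suc s) (suc k) (suc (suc s ℕ.+ k)) (N k (suc s)) ⟩
      suc k ℕ.* (suc (suc s ℕ.+ k) ℕ.* (suc s ℕ.* N k (suc s)))  ≡⟨ cong (λ z → suc k ℕ.* (suc (suc s ℕ.+ k) ℕ.* z)) (N-shift k s) ⟩
      suc k ℕ.* (suc (suc s ℕ.+ k) ℕ.* (suc (s ℕ.+ k) ℕ.* N k s)) ≡⟨ arr₂ (suc k) (suc (suc s ℕ.+ k)) (suc (s ℕ.+ k)) (N k s) ⟩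
      suc (suc s ℕ.+ k) ℕ.* N (suc k) s                          ≡⟨ cong (λ z → suc z ℕ.* N (suc k) s) (sym (ℕ.+-suc s k)) ⟩
      suc (s ℕ.+ suc k) ℕ.* N (suc k) s                          ∎
      where
      open ≡-Reasoning
      arr : ∀ a b c d → a ℕ.* (b ℕ.* (c ℕ.* d)) ≡ b ℕ.* (c ℕ.* (a ℕ.* d))
      arr = ℕR.solve-∀
      arr₂ : ∀ a b c d → a ℕ.* (b ℕ.* (c ℕ.* d)) ≡ b ℕ.* (a ℕ.* (c ℕ.* d))
      arr₂ = ℕR.solve-∀

    -- E (x+yU)ᵃ(x+yU)ᵇ expanded in the orthogonal (Laguerre) polynomials of U, which have squared norms N k s.
    term : ℕ → ℕ → ℕ → ℕ → ℤ
    term a b s k = (+ (a C k) * (+ (b C k) * (+ N k s * (Y k * Y k)))) * (g (a ∸ k) (s ℕ.+ k) * g (b ∸ k) (s ℕ.+ k))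

    -- `g-step` for the second factor. The binomial weights vanish out of range, so the identity
    -- holds for all k whatever truncated subtraction yields.
    lower : ∀ b k σ → + (b C k) * (g (b ∸ k) (suc σ)) ≡ + (b C k) * g (b ∸ k) σ + (+ (b C suc k) * + suc k) * (y * g (b ∸ suc k) (suc σ))
    lower b k σ with ℕ.<-cmp k b
    ... | tri> _ _ b<k = trans (cong (_* g (b ∸ k) (suc σ)) (C-out b k b<k)) (trans (*-zeroˡ (g (b ∸ k) (suc σ)))
          (sym (trans (cong₂ (λ u v → u * g (b ∸ k) σ + (v * + suc k) * (y * g (b ∸ suc k) (suc σ))) (C-out b k b<k) (C-out b (suc k) (ℕ.m<n⇒m<1+n b<k)))
            (arr (g (b ∸ k) σ) (+ suc k) (y * g (b ∸ suc k) (suc σ))))))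
      where
      arr : ∀ a k c → 0ℤ * a + (0ℤ * k) * c ≡ 0ℤ
      arr = solve-∀
    ... | tri≈ _ refl _ = trans (cong (λ z → + (b C b) * g z (suc σ)) (ℕ.n∸n≡0 b)) (sym (trans (cong₂ (λ z v → + (b C b) * g z σ + (v * + suc b) * (y * g (b ∸ suc b) (suc σ))) (ℕ.n∸n≡0 b) (C-out b (suc b) ℕ.≤-refl))
          (arr (+ (b C b)) (+ suc b) (y * g (b ∸ suc b) (suc σ)))))
      where
      arr : ∀ a k c → a * 1ℤ + (0ℤ * k) * c ≡ a * 1ℤ
      arr = solve-∀
    ... | tri< k<b _ _ = begin
      + (b C k) * g (b ∸ k) (suc σ)                          ≡⟨ cong (λ z → + (b C k) * g z (suc σ)) b∸k ⟩
      + (b C k) * g (suc m) (suc σ)                          ≡⟨ cong (+ (b C k) *_) (g-step m σ) ⟩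
      + (b C k) * (g (suc m) σ + + suc m * (y * g m (suc σ))) ≡⟨ arr (+ (b C k)) (g (suc m) σ) (+ suc m) (y * g m (suc σ)) ⟩
      + (b C k) * g (suc m) σ + (+ suc m * + (b C k)) * (y * g m (suc σ)) ≡⟨ cong₂ (λ z v → + (b C k) * g z σ + v * (y * g m (suc σ))) (sym b∸k) absorb ⟩
      + (b C k) * g (b ∸ k) σ + (+ (b C suc k) * + suc k) * (y * g m (suc σ)) ∎
      where
      open ≡-Reasoning
      m = b ∸ suc k
      b≡ : b ≡ k ℕ.+ suc m
      b≡ = sym (trans (ℕ.+-suc k m) (ℕ.m+[n∸m]≡n k<b))
      b∸k : b ∸ k ≡ suc m
      b∸k = trans (cong (_∸ k) b≡) (ℕ.m+n∸m≡n k (suc m))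
      arr : ∀ c a m d → c * (a + m * d) ≡ c * a + (m * c) * d
      arr = solve-∀
      absorb : + suc m * + (b C k) ≡ + (b C suc k) * + suc k
      absorb = trans (sym (pos-* (suc m) (b C k))) (trans (cong +_ (trans (cong (λ z → suc m ℕ.* (z C k)) b≡)
        (trans (sym (C-absorb k m)) (trans (ℕ.*-comm (suc k) _) (cong (λ z → (z C suc k) ℕ.* suc k) (sym (trans b≡ (ℕ.+-suc k m)))))))) (pos-* (b C suc k) (suc k)))

    upper : ∀ a k s → + (a C k) * g (suc a ∸ k) (s ℕ.+ k) ≡ + (a C k) * (x * g (a ∸ k) (s ℕ.+ k) + + suc (s ℕ.+ k) * (y * g (a ∸ k) (suc (s ℕ.+ k))))
    upper a k s with k ℕ.≤? a
    ... | yes k≤a = cong (λ z → + (a C k) * g z (s ℕ.+ k)) (ℕ.+-∸-assoc 1 k≤a)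
    ... | no  k≰a = trans (cong (_* g (suc a ∸ k) (s ℕ.+ k)) (C-out a k (ℕ.≰⇒> k≰a))) (trans (*-zeroˡ (g (suc a ∸ k) (s ℕ.+ k)))
         (sym (trans (cong (_* rest) (C-out a k (ℕ.≰⇒> k≰a))) (*-zeroˡ rest))))
      where
      rest = x * g (a ∸ k) (s ℕ.+ k) + + suc (s ℕ.+ k) * (y * g (a ∸ k) (suc (s ℕ.+ k)))

    -- Pascal's rule splits `term (suc a)` at k + 1 into a part with C(a, k+1), `stay` at k + 1, and
    -- a part with C(a, k), `next` at k. `exchange` obtains the same parts from the recursion of `g`
    -- applied to `term a`.
    stay next : ℕ → ℕ → ℕ → ℕ → ℤ
    stay a b s k = (+ (a C k) * (+ (b C k) * (+ N k s * (Y k * Y k)))) * (g (suc a ∸ k) (s ℕ.+ k) * g (b ∸ k) (s ℕ.+ k))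
    next a b s k = (+ (a C k) * (+ (b C suc k) * (+ N (suc k) s * (Y (suc k) * Y (suc k))))) * (g (a ∸ k) (s ℕ.+ suc k) * g (b ∸ suc k) (s ℕ.+ suc k))

    term-suc : ∀ a b s k → term (suc a) b s (suc k) ≡ next a b s k + stay a b s (suc k)
    term-suc a b s k = trans (cong (λ z → (z * c) * d) (pascal a k)) (arr (+ (a C k)) (+ (a C suc k)) c d)
      where
      c = + (b C suc k) * (+ N (suc k) s * (Y (suc k) * Y (suc k)))
      d = g (a ∸ k) (s ℕ.+ suc k) * g (b ∸ suc k) (s ℕ.+ suc k)
      arr : ∀ u v c d → ((u + v) * c) * d ≡ (u * c) * d + (v * c) * d
      arr = solve-∀

    exchange : ∀ a b s k → x * term a b s k + + suc s * (y * term a b (suc s) k) ≡ stay a b s k + next a b s k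
    exchange a b s k = begin
      x * term a b s k + + suc s * (y * term a b (suc s) k)
        ≡⟨ arr₁ x y (+ suc s) Ca Cb Nk Nk′ YY G₀ B₀ G₁ B₁ ⟩
      Ca * (YY * (x * G₀ * (Nk * (Cb * B₀)) + y * G₁ * ((+ suc s * Nk′) * (Cb * B₁))))
        ≡⟨ cong₂ (λ u v → Ca * (YY * (x * G₀ * (Nk * (Cb * B₀)) + y * G₁ * (u * v)))) N-eq (lower b k (s ℕ.+ k)) ⟩
      Ca * (YY * (x * G₀ * (Nk * (Cb * B₀)) + y * G₁ * ((σ * Nk) * (Cb * B₀ + (Cb′ * + suc k) * (y * B₂)))))
        ≡⟨ arr₂ x y σ Ca Cb Cb′ Nk (+ suc k) YY G₀ B₀ G₁ B₂ ⟩
      (Ca * (x * G₀ + σ * (y * G₁))) * (Cb * (Nk * YY) * B₀) + (Ca * (Cb′ * ((+ suc k * (σ * Nk)) * (y * y * YY)))) * (G₁ * B₂)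
        ≡⟨ cong₂ _+_ fst snd ⟩
      stay a b s k + next a b s k ∎
      where
      open ≡-Reasoning
      Ca = + (a C k)
      Cb = + (b C k)
      Cb′ = + (b C suc k)
      Nk = + N k s
      Nk′ = + N k (suc s)
      YY = Y k * Y k
      σ = + suc (s ℕ.+ k)
      G₀ = g (a ∸ k) (s ℕ.+ k)
      B₀ = g (b ∸ k) (s ℕ.+ k)
      G₁ = g (a ∸ k) (suc (s ℕ.+ k))
      B₁ = g (b ∸ k) (suc (s ℕ.+ k))
      B₂ = g (b ∸ suc k) (suc (s ℕ.+ k))
      N-eq : + suc s * Nk′ ≡ σ * Nk
      N-eq = trans (sym (pos-* (suc s) (N k (suc s)))) (trans (cong +_ (N-shift k s)) (pos-* (suc (s ℕ.+ k)) (N k s)))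
      arr₁ : ∀ x y t ca cb n n′ w g₀ b₀ g₁ b₁ → x * ((ca * (cb * (n * w))) * (g₀ * b₀)) + t * (y * ((ca * (cb * (n′ * w))) * (g₁ * b₁)))
             ≡ ca * (w * (x * g₀ * (n * (cb * b₀)) + y * g₁ * ((t * n′) * (cb * b₁))))
      arr₁ = solve-∀
      arr₂ : ∀ x y σ ca cb cb′ n k w g₀ b₀ g₁ b₂ → ca * (w * (x * g₀ * (n * (cb * b₀)) + y * g₁ * ((σ * n) * (cb * b₀ + (cb′ * k) * (y * b₂)))))
             ≡ (ca * (x * g₀ + σ * (y * g₁))) * (cb * (n * w) * b₀) + (ca * (cb′ * ((k * (σ * n)) * (y * y * w)))) * (g₁ * b₂)
      arr₂ = solve-∀
      arr₃ : ∀ c a b w n g → (c * g) * (a * (n * w) * b) ≡ (c * (a * (n * w))) * (g * b)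
      arr₃ = solve-∀
      fst : (Ca * (x * G₀ + σ * (y * G₁))) * (Cb * (Nk * YY) * B₀) ≡ stay a b s k
      fst = trans (cong (_* (Cb * (Nk * YY) * B₀)) (sym (upper a k s))) (arr₃ Ca Cb B₀ YY Nk (g (suc a ∸ k) (s ℕ.+ k)))
      arr₄ : ∀ y w → y * y * (w * w) ≡ (y * w) * (y * w)
      arr₄ = solve-∀
      snd : (Ca * (Cb′ * ((+ suc k * (σ * Nk)) * (y * y * YY)))) * (G₁ * B₂) ≡ next a b s k
      snd = trans (cong₂ (λ u v → (Ca * (Cb′ * (u * v))) * (G₁ * B₂))
               (sym (trans (pos-* (suc k) _) (cong (+ suc k *_) (pos-* (suc (s ℕ.+ k)) (N k s))))) (arr₄ y (Y k)))
             (cong (λ z → (Ca * (Cb′ * (+ N (suc k) s * (Y (suc k) * Y (suc k))))) * (g (a ∸ k) z * g (b ∸ suc k) z)) (sym (ℕ.+-suc s k)))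

    -- Parseval's identity, proved as a polynomial identity by induction on a, without any integral.
    -- Summands beyond a vanish, so K may be any bound.
    orthogonal : ∀ a b s K → a ℕ.≤ K → g (a ℕ.+ b) s ≡ Σ[ suc K ] (term a b s)
    orthogonal zero    b s K _ = sym (trans (Σ-head K (term 0 b s)) (trans (cong₂ _+_ head (vanish K)) (+-identityʳ (g b s))))
      where
      arr : ∀ g → (1ℤ * (1ℤ * (1ℤ * (1ℤ * 1ℤ)))) * (1ℤ * g) ≡ g
      arr = solve-∀
      head : term 0 b s 0 ≡ g b s
      head = trans (arr (g b (s ℕ.+ 0))) (cong (g b) (ℕ.+-identityʳ s))
      zero-term : ∀ k → term 0 b s (suc k) ≡ 0ℤ
      zero-term k = trans (cong (λ z → (z * c) * d) (C-out 0 (suc k) (s≤s z≤n))) (trans (cong (_* d) (*-zeroˡ c)) (*-zeroˡ d))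
        where
        c = + (b C suc k) * (+ N (suc k) s * (Y (suc k) * Y (suc k)))
        d = g (0 ∸ suc k) (s ℕ.+ suc k) * g (b ∸ suc k) (s ℕ.+ suc k)
      vanish : ∀ K → Σ[ K ] (λ k → term 0 b s (suc k)) ≡ 0ℤ
      vanish zero    = refl
      vanish (suc K) = cong₂ _+_ (vanish K) (zero-term K)
    orthogonal (suc a) b s (suc K) (s≤s a≤K) = begin
      x * g (a ℕ.+ b) s + + suc s * (y * g (a ℕ.+ b) (suc s))
        ≡⟨ cong₂ (λ u v → x * u + + suc s * (y * v)) (orthogonal a b s K a≤K) (orthogonal a b (suc s) K a≤K) ⟩
      x * Σ[ suc K ] (term a b s) + + suc s * (y * Σ[ suc K ] (term a b (suc s)))
        ≡⟨ cong₂ (λ u v → u + + suc s * v) (Σ-* (suc K) x (term a b s)) (Σ-* (suc K) y (term a b (suc s))) ⟨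
      Σ[ suc K ] (λ k → x * term a b s k) + + suc s * Σ[ suc K ] (λ k → y * term a b (suc s) k)
        ≡⟨ cong (λ ∙ → Σ[ suc K ] (λ k → x * term a b s k) + ∙) (Σ-* (suc K) (+ suc s) (λ k → y * term a b (suc s) k)) ⟨
      Σ[ suc K ] (λ k → x * term a b s k) + Σ[ suc K ] (λ k → + suc s * (y * term a b (suc s) k))
        ≡⟨ Σ-+ (suc K) _ _ ⟨
      Σ[ suc K ] (λ k → x * term a b s k + + suc s * (y * term a b (suc s) k))
        ≡⟨ Σ-cong (suc K) (λ k _ → exchange a b s k) ⟩
      Σ[ suc K ] (λ k → stay a b s k + next a b s k)
        ≡⟨ Σ-+ (suc K) (stay a b s) (next a b s) ⟩
      Σ[ suc K ] (stay a b s) + Σ[ suc K ] (next a b s)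
        ≡⟨ cong (_+ Σ[ suc K ] (next a b s)) (sym (trans (cong (λ ∙ → Σ[ suc K ] (stay a b s) + ∙) out) (+-identityʳ (Σ[ suc K ] (stay a b s))))) ⟩
      Σ[ suc (suc K) ] (stay a b s) + Σ[ suc K ] (next a b s)
        ≡⟨ cong (_+ Σ[ suc K ] (next a b s)) (Σ-head (suc K) (stay a b s)) ⟩
      (stay a b s 0 + Σ[ suc K ] (λ k → stay a b s (suc k))) + Σ[ suc K ] (next a b s)
        ≡⟨ arr (stay a b s 0) (Σ[ suc K ] (λ k → stay a b s (suc k))) (Σ[ suc K ] (next a b s)) ⟩
      stay a b s 0 + (Σ[ suc K ] (next a b s) + Σ[ suc K ] (λ k → stay a b s (suc k)))
        ≡⟨ cong (λ ∙ → stay a b s 0 + ∙) (Σ-+ (suc K) (next a b s) (λ k → stay a b s (suc k))) ⟨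
      stay a b s 0 + Σ[ suc K ] (λ k → next a b s k + stay a b s (suc k))
        ≡⟨ cong (λ ∙ → stay a b s 0 + ∙) (Σ-cong (suc K) (λ k _ → sym (term-suc a b s k))) ⟩
      term (suc a) b s 0 + Σ[ suc K ] (λ k → term (suc a) b s (suc k))
        ≡⟨ Σ-head (suc K) (term (suc a) b s) ⟨
      Σ[ suc (suc K) ] (term (suc a) b s) ∎
      where
      open ≡-Reasoning
      arr : ∀ a b c → (a + b) + c ≡ a + (c + b)
      arr = solve-∀
      out : stay a b s (suc K) ≡ 0ℤ
      out = trans (cong (λ z → (z * c) * d) (C-out a (suc K) (s≤s a≤K))) (trans (cong (_* d) (*-zeroˡ c)) (*-zeroˡ d))
        where
        c = + (b C suc K) * (+ N (suc K) s * (Y (suc K) * Y (suc K)))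
        d = g (suc a ∸ suc K) (s ℕ.+ suc K) * g (b ∸ suc K) (s ℕ.+ suc K)

    square : ∀ i → i * i ≡ + (∣ i ∣ ℕ.* ∣ i ∣)
    square (+ n)    = sym (pos-* n n)
    square -[1+ n ] = refl

    N≢0 : ∀ k s → N k s ≢ 0
    N≢0 zero    s ()
    N≢0 (suc k) s e = *≢0 {suc k} (λ ()) (*≢0 {suc (s ℕ.+ k)} (λ ()) (N≢0 k s)) e

    Y≢0 : y ≢ 0ℤ → ∀ k → Y k ≢ 0ℤ
    Y≢0 y≢0 zero    ()
    Y≢0 y≢0 (suc k) e with i*j≡0⇒i≡0∨j≡0 y e
    ... | inj₁ z = y≢0 z
    ... | inj₂ z = Y≢0 y≢0 k z

    -- For a = b = m every term is a squared norm times an integer square, and the last one is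
    -- `N m s` y^(2m) > 0.
    g-even≢0 : y ≢ 0ℤ → ∀ m s → g (m ℕ.+ m) s ≢ 0ℤ
    g-even≢0 y≢0 m s e = contra (total (suc m))
      where
      z : ℕ → ℤ
      z k = + (m C k) * (Y k * g (m ∸ k) (s ℕ.+ k))
      t : ℕ → ℕ
      t k = N k s ℕ.* (∣ z k ∣ ℕ.* ∣ z k ∣)
      arr : ∀ c n w h → (c * (c * (n * (w * w)))) * (h * h) ≡ n * ((c * (w * h)) * (c * (w * h)))
      arr = solve-∀
      term≡ : ∀ k → term m m s k ≡ + t k
      term≡ k = trans (arr (+ (m C k)) (+ N k s) (Y k) (g (m ∸ k) (s ℕ.+ k))) (trans (cong (+ N k s *_) (square (z k))) (sym (pos-* (N k s) (∣ z k ∣ ℕ.* ∣ z k ∣))))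
      natSum : ℕ → ℕ
      natSum zero    = 0
      natSum (suc M) = natSum M ℕ.+ t M
      total : ∀ M → Σ[ M ] (term m m s) ≡ + natSum M
      total zero    = refl
      total (suc M) = trans (cong₂ _+_ (total M) (term≡ M)) (sym (pos-+ (natSum M) (t M)))
      z-top : z m ≡ Y m
      z-top = trans (cong₂ (λ u v → + u * (Y m * g v (s ℕ.+ m))) (nCn≡1 m) (ℕ.n∸n≡0 m)) (arr′ (Y m))
        where
        arr′ : ∀ w → 1ℤ * (w * 1ℤ) ≡ w
        arr′ = solve-∀
      z≢0 : ∣ z m ∣ ≢ 0
      z≢0 q = Y≢0 y≢0 m (trans (sym z-top) (∣i∣≡0⇒i≡0 q))
      contra : Σ[ suc m ] (term m m s) ≡ + natSum (suc m) → ⊥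
      contra q = *≢0 (N≢0 m s) (*≢0 z≢0 z≢0) (ℕ.m+n≡0⇒n≡0 (natSum m) (+-injective (trans (sym q) (trans (sym (orthogonal m m s m ℕ.≤-refl)) e))))

-- Linear factors in even degree.

module LinearFactors where
  open Valuations
  open DumasLemma
  open Factorisations
  open LaguerreExpansion
  open import Data.Nat as ℕ using (ℕ; zero; suc; z≤n; s≤s; _∸_; _!)
  import Data.Nat.Properties as ℕ
  open import Data.Nat.Combinatorics using (_C_)
  import Data.Nat.Tactic.RingSolver as ℕR
  open import Data.Integer using (ℤ; +_; -_; _+_; _*_; 0ℤ; 1ℤ; -[1+_])
  open import Data.Integer.Properties
  open import Data.Integer.Tactic.RingSolver using (solve-∀)
  open import Data.Product
  open import Data.Sum using (inj₁; inj₂)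
  open import Data.Empty using (⊥; ⊥-elim)
  open import Relation.Nullary
  open import Relation.Binary.PropositionalEquality

  rising-! : ∀ s i → rising s i ℕ.* s ! ≡ (i ℕ.+ s) !
  rising-! s zero    = ℕ.+-identityʳ (s !)
  rising-! s (suc i) = trans (arr (suc s) (rising (suc s) i) (s !)) (trans (rising-! (suc s) i) (cong _! (ℕ.+-suc i s)))
    where
    arr : ∀ a r f → (a ℕ.* r) ℕ.* f ≡ r ℕ.* (a ℕ.* f)
    arr = ℕR.solve-∀

  -- Multiplied by i! s!, both sides become (i + j)! (i + s)!. This links the binomial form of the
  -- coefficients with the form C(n,i)(s+1)⋯(s+i).
  coef-! : ∀ i j s → coef (i ℕ.+ j) s i ℕ.* j ! ≡ (i ℕ.+ j) ! ℕ.* ((i ℕ.+ s) C i)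
  coef-! i j s = ℕ.*-cancelʳ-≡ _ _ (i ! ℕ.* s !) {{i ℕ.!* s !≢0}} (begin
    (c ℕ.* rising s i) ℕ.* j ! ℕ.* (i ! ℕ.* s !)     ≡⟨ arr₁ c (rising s i) (j !) (i !) (s !) ⟩
    (c ℕ.* (i ! ℕ.* j !)) ℕ.* (rising s i ℕ.* s !)   ≡⟨ cong₂ ℕ._*_ (C-factorials i j) (rising-! s i) ⟩
    (i ℕ.+ j) ! ℕ.* (i ℕ.+ s) !                      ≡⟨ cong ((i ℕ.+ j) ! ℕ.*_) (sym (C-factorials i s)) ⟩
    (i ℕ.+ j) ! ℕ.* (((i ℕ.+ s) C i) ℕ.* (i ! ℕ.* s !)) ≡⟨ ℕ.*-assoc ((i ℕ.+ j) !) _ _ ⟨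
    (i ℕ.+ j) ! ℕ.* ((i ℕ.+ s) C i) ℕ.* (i ! ℕ.* s !) ∎)
    where
    open ≡-Reasoning
    c = (i ℕ.+ j) C i
    arr₁ : ∀ c r j i s → (c ℕ.* r) ℕ.* j ℕ.* (i ℕ.* s) ≡ (c ℕ.* (i ℕ.* j)) ℕ.* (r ℕ.* s)
    arr₁ = ℕR.solve-∀

  module Expand (x y : ℤ) where
    open Moments x y hiding (stay)

    mono : ℕ → ℕ → ℕ → ℤ
    mono n s i = + coef n s i * (X (n ∸ i) * Y i)

    g-expand : ∀ n s → g n s ≡ Σ[ suc n ] (mono n s)
    g-expand zero    s = refl
    g-expand (suc n) s = begin
      x * g n s + + suc s * (y * g n (suc s))
        ≡⟨ cong₂ (λ u v → x * u + + suc s * (y * v)) (g-expand n s) (g-expand n (suc s)) ⟩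
      x * Σ[ suc n ] (mono n s) + + suc s * (y * Σ[ suc n ] (mono n (suc s)))
        ≡⟨ cong₂ _+_ first second ⟩
      (mono (suc n) s 0 + Σ[ suc n ] (λ i → stay i)) + Σ[ suc n ] moved
        ≡⟨ +-assoc (mono (suc n) s 0) _ _ ⟩
      mono (suc n) s 0 + (Σ[ suc n ] stay + Σ[ suc n ] moved)
        ≡⟨ cong (λ z → mono (suc n) s 0 + z) (sym (Σ-+ (suc n) stay moved)) ⟩
      mono (suc n) s 0 + Σ[ suc n ] (λ i → stay i + moved i)
        ≡⟨ cong (λ z → mono (suc n) s 0 + z) (Σ-cong (suc n) λ i _ → sym (mono-suc i)) ⟩
      mono (suc n) s 0 + Σ[ suc n ] (λ i → mono (suc n) s (suc i))
        ≡⟨ Σ-head (suc n) (mono (suc n) s) ⟨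
      Σ[ suc (suc n) ] (mono (suc n) s) ∎
      where
      open ≡-Reasoning
      stay moved kept : ℕ → ℤ
      stay i = + (n C suc i) * (+ rising s (suc i) * (X (n ∸ i) * Y (suc i)))
      moved i = + (n C i) * (+ rising s (suc i) * (X (n ∸ i) * Y (suc i)))
      kept i = + (n C i) * (+ rising s i * (X (suc n ∸ i) * Y i))
      mono-suc : ∀ i → mono (suc n) s (suc i) ≡ stay i + moved i
      mono-suc i = trans (cong (_* (X (n ∸ i) * Y (suc i))) (trans (pos-* (suc n C suc i) (rising s (suc i))) (cong (_* + rising s (suc i)) (pascal n i))))
          (arr (+ (n C i)) (+ (n C suc i)) (+ rising s (suc i)) (X (n ∸ i) * Y (suc i)))
        where
        arr : ∀ a b r w → ((a + b) * r) * w ≡ b * (r * w) + a * (r * w)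
        arr = solve-∀
      second : + suc s * (y * Σ[ suc n ] (mono n (suc s))) ≡ Σ[ suc n ] moved
      second = trans (cong (+ suc s *_) (sym (Σ-* (suc n) y (mono n (suc s))))) (trans (sym (Σ-* (suc n) (+ suc s) (λ i → y * mono n (suc s) i)))
         (Σ-cong (suc n) λ i _ → each i))
        where
        arr : ∀ t y c r u w → t * (y * ((c * r) * (u * w))) ≡ c * ((t * r) * (u * (y * w)))
        arr = solve-∀
        each : ∀ i → + suc s * (y * mono n (suc s) i) ≡ moved i
        each i = trans (cong (λ z → + suc s * (y * (z * (X (n ∸ i) * Y i)))) (pos-* (n C i) (rising (suc s) i)))
          (trans (arr (+ suc s) y (+ (n C i)) (+ rising (suc s) i) (X (n ∸ i)) (Y i))
            (cong (λ z → + (n C i) * (z * (X (n ∸ i) * Y (suc i)))) (sym (pos-* (suc s) (rising (suc s) i)))))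
      kept≡ : ∀ i → i ℕ.≤ n → x * mono n s i ≡ kept i
      kept≡ i i≤n = trans (cong (λ z → x * (z * (X (n ∸ i) * Y i))) (pos-* (n C i) (rising s i)))
        (trans (arr x (+ (n C i)) (+ rising s i) (X (n ∸ i)) (Y i)) (cong (λ z → + (n C i) * (+ rising s i * (X z * Y i))) (sym (ℕ.+-∸-assoc 1 i≤n))))
        where
        arr : ∀ x c r u w → x * ((c * r) * (u * w)) ≡ c * (r * ((x * u) * w))
        arr = solve-∀
      kept-out : kept (suc n) ≡ 0ℤ
      kept-out = trans (cong (_* w) (C-out n (suc n) ℕ.≤-refl)) (*-zeroˡ w)
        where
        w = + rising s (suc n) * (X (suc n ∸ suc n) * Y (suc n))
      kept-0 : kept 0 ≡ mono (suc n) s 0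
      kept-0 = arr (X (suc n))
        where
        arr : ∀ u → 1ℤ * (1ℤ * (u * 1ℤ)) ≡ 1ℤ * (u * 1ℤ)
        arr = solve-∀
      first : x * Σ[ suc n ] (mono n s) ≡ mono (suc n) s 0 + Σ[ suc n ] stay
      first = begin
        x * Σ[ suc n ] (mono n s)                 ≡⟨ Σ-* (suc n) x (mono n s) ⟨
        Σ[ suc n ] (λ i → x * mono n s i)         ≡⟨ Σ-cong (suc n) (λ i i< → kept≡ i (ℕ.≤-pred i<)) ⟩
        Σ[ suc n ] kept                           ≡⟨ trans (cong (λ z → Σ[ suc n ] kept + z) kept-out) (+-identityʳ (Σ[ suc n ] kept)) ⟨
        Σ[ suc (suc n) ] kept                     ≡⟨ Σ-head (suc n) kept ⟩
        kept 0 + Σ[ suc n ] stay                  ≡⟨ cong (_+ Σ[ suc n ] stay) kept-0 ⟩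
        mono (suc n) s 0 + Σ[ suc n ] stay        ∎

  conv-coef : ∀ {n s k} (fac : Factors n s k) → let open Factors fac in ∀ i j → i ℕ.+ j ≡ n → conv F H j ≡ D * + coef n s i
  conv-coef {n} {s} fac i j refl = *-cancelʳ-≡ _ _ (+ (j !)) {{j!≢0}} (trans (coefs i j refl) (trans (cong (λ z → D * + z) (sym (coef-! i j s)))
      (trans (cong (D *_) (pos-* (coef n s i) (j !))) (sym (*-assoc D (+ coef n s i) (+ (j !)))))))
    where
    open Factors fac
    j!≢0 : ℕ.NonZero (j !)
    j!≢0 = j ℕ.!≢0

  -- An integer linear factor F₀ + F₁ x would make g n s (−F₀) F₁ vanish.
  no-linear-factor : ∀ {s} m → 1 ℕ.≤ m → Factors (m ℕ.+ m) s 1 → ⊥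
  no-linear-factor {s} m 1≤m fac = g-even≢0 F-top m s g≡0
    where
    open Factors fac
    open Moments (- F 0) (F 1)
    open Expand (- F 0) (F 1)
    n = m ℕ.+ m
    1≤n : 1 ℕ.≤ n
    1≤n = ℕ.≤-trans 1≤m (ℕ.m≤m+n m m)
    two : ∀ l j → convTo F H j (suc l) ≡ F 0 * H j + F 1 * H (j ∸ 1)
    two zero    j = refl
    two (suc l) j = trans (cong₂ _+_ (two l j) (trans (cong (_* H (j ∸ suc (suc l))) (F-deg (suc (suc l)) (s≤s (s≤s z≤n)))) (*-zeroˡ (H (j ∸ suc (suc l)))))) (+-identityʳ _)
    -- Evaluated at x = -F₀, y = F₁, the homogenised product telescopes: its summand at j + 1 is e
    -- (j + 1) - e j.
    t e : ℕ → ℤ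
    t j = conv F H j * (X j * Y (n ∸ j))
    e j = F 0 * H j * (X j * Y (n ∸ j))
    t-suc : ∀ j → suc j ℕ.≤ n → t (suc j) ≡ e (suc j) + - e j
    t-suc j j< = trans (cong (_* (X (suc j) * Y (n ∸ suc j))) (two j (suc j)))
        (trans (arr (F 0) (F 1) (H (suc j)) (H j) (X j) (Y (n ∸ suc j))) (cong (λ w → e (suc j) + - (F 0 * H j * (X j * Y w))) (sym (ℕ.+-∸-assoc 1 j<))))
      where
      arr : ∀ a b h h′ u w → (a * h + b * h′) * ((- a * u) * w) ≡ a * h * ((- a * u) * w) + - (a * h′ * (u * (b * w)))
      arr = solve-∀
    e-top : e n ≡ 0ℤ
    e-top = trans (cong (λ z → F 0 * z * (X n * Y (n ∸ n))) (H-deg n (ℕ.∸-monoʳ-< {n} {1} {0} (s≤s z≤n) 1≤n))) (arr (F 0) (X n * Y (n ∸ n)))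
      where
      arr : ∀ a w → a * 0ℤ * w ≡ 0ℤ
      arr = solve-∀
    partial : ∀ M → M ℕ.≤ n → Σ[ M ] (λ i → t (n ∸ i)) ≡ - e (n ∸ M)
    partial zero    _  = sym (cong -_ e-top)
    partial (suc M) M< = trans (cong₂ _+_ (partial M (ℕ.<⇒≤ M<)) (trans (cong t n∸M) (t-suc (n ∸ suc M) (subst (ℕ._≤ n) n∸M (ℕ.m∸n≤m n M)))))
         (trans (cong (λ z → - e z + (e (suc (n ∸ suc M)) + - e (n ∸ suc M))) n∸M) (arr (e (suc (n ∸ suc M))) (e (n ∸ suc M))))
      where
      n∸M : n ∸ M ≡ suc (n ∸ suc M)
      n∸M = ℕ.+-∸-assoc 1 M<
      arr : ∀ a b → - a + (a + - b) ≡ - b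
      arr = solve-∀
    total : Σ[ suc n ] (λ i → t (n ∸ i)) ≡ 0ℤ
    total = trans (cong₂ _+_ (partial n ℕ.≤-refl) (cong t (ℕ.n∸n≡0 n))) (trans (cong (λ z → - e z + t 0) (ℕ.n∸n≡0 n)) (+-inverseˡ (t 0)))
    Dg≡0 : D * g n s ≡ 0ℤ
    Dg≡0 = trans (cong (D *_) (g-expand n s)) (trans (sym (Σ-* (suc n) D (mono n s)))
       (trans (Σ-cong (suc n) λ i i< → each i (ℕ.≤-pred i<)) total))
      where
      each : ∀ i → i ℕ.≤ n → D * mono n s i ≡ t (n ∸ i)
      each i i≤n = trans (sym (*-assoc D (+ coef n s i) (X (n ∸ i) * Y i)))
        (cong₂ (λ u v → u * (X (n ∸ i) * Y v)) (sym (conv-coef fac i (n ∸ i) (ℕ.m+[n∸m]≡n i≤n))) (sym (ℕ.m∸[m∸n]≡n i≤n)))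
    g≡0 : g n s ≡ 0ℤ
    g≡0 with i*j≡0⇒i≡0∨j≡0 D Dg≡0
    ... | inj₁ z = ⊥-elim (D≢0 z)
    ... | inj₂ z = z

-- From rational factors to integral ones with complementary degrees.

module ClearingDenominators where
  open import Defs
  open Valuations
  open DumasLemma
  open Factorisations
  open LaguerreExpansion using (Σ[_]; Σ-head; Σ-cong)
  open import Data.Nat as ℕ using (ℕ; zero; suc; z≤n; s≤s; _∸_; _!)
  import Data.Nat.Properties as ℕ
  open import Data.Nat.Combinatorics using (_C_)
  open import Data.Integer as ℤ using (ℤ; 0ℤ; 1ℤ)
  import Data.Integer.Properties as ℤ
  import Data.Integer.Tactic.RingSolver as ℤR
  open import Data.Rational as ℚ using (ℚ; 0ℚ; ↥_; ↧_; ↧ₙ_; toℚᵘ; fromℚᵘ)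
  import Data.Rational.Properties as ℚ
  open import Data.Rational.Unnormalised as ℚᵘ using (ℚᵘ; mkℚᵘ; *≡*)
  import Data.Rational.Unnormalised.Properties as ℚᵘ
  open import Data.List using ([]; _∷_; map; applyUpTo; length)
  open import Data.Product hiding (map)
  open import Data.Sum using (inj₁; inj₂)
  open import Data.Empty using (⊥-elim)
  open import Function using (_∘_; id)
  open import Relation.Nullary
  open import Relation.Binary.PropositionalEquality

  abstract
    ι : ℤ → ℚ
    ι z = fromℚᵘ (mkℚᵘ z 0)

    toℚᵘ-ι : ∀ z → toℚᵘ (ι z) ℚᵘ.≃ mkℚᵘ z 0
    toℚᵘ-ι z = ℚ.toℚᵘ-fromℚᵘ (mkℚᵘ z 0)

    ι-injective : ∀ {a b} → ι a ≡ ι b → a ≡ b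
    ι-injective {a} {b} e with ℚ.fromℚᵘ-injective {mkℚᵘ a 0} {mkℚᵘ b 0} e
    ... | *≡* eq = trans (sym (ℤ.*-identityʳ a)) (trans eq (ℤ.*-identityʳ b))

    ι-+ : ∀ a b → ι (a ℤ.+ b) ≡ ι a ℚ.+ ι b
    ι-+ a b = ℚ.toℚᵘ-injective (ℚᵘ.≃-trans (toℚᵘ-ι (a ℤ.+ b)) (ℚᵘ.≃-trans (*≡* (arr a b))
      (ℚᵘ.≃-trans (ℚᵘ.+-cong (ℚᵘ.≃-sym (toℚᵘ-ι a)) (ℚᵘ.≃-sym (toℚᵘ-ι b))) (ℚᵘ.≃-sym (ℚ.toℚᵘ-homo-+ (ι a) (ι b))))))
      where
      arr : ∀ a b → (a ℤ.+ b) ℤ.* (1ℤ ℤ.* 1ℤ) ≡ (a ℤ.* 1ℤ ℤ.+ b ℤ.* 1ℤ) ℤ.* 1ℤ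
      arr = ℤR.solve-∀

    ι-* : ∀ a b → ι (a ℤ.* b) ≡ ι a ℚ.* ι b
    ι-* a b = ℚ.toℚᵘ-injective (ℚᵘ.≃-trans (toℚᵘ-ι (a ℤ.* b)) (ℚᵘ.≃-trans (*≡* (arr a b))
      (ℚᵘ.≃-trans (ℚᵘ.*-cong (ℚᵘ.≃-sym (toℚᵘ-ι a)) (ℚᵘ.≃-sym (toℚᵘ-ι b))) (ℚᵘ.≃-sym (ℚ.toℚᵘ-homo-* (ι a) (ι b))))))
      where
      arr : ∀ a b → (a ℤ.* b) ℤ.* (1ℤ ℤ.* 1ℤ) ≡ (a ℤ.* b) ℤ.* 1ℤ
      arr = ℤR.solve-∀

    frac : ∀ i d .{{_ : ℕ.NonZero d}} → (i ℚ./ d) ℚ.* ι (ℤ.+ d) ≡ ι i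
    frac i (suc d) = ℚ.toℚᵘ-injective (ℚᵘ.≃-trans (ℚ.toℚᵘ-homo-* (i ℚ./ suc d) (ι (ℤ.+ suc d)))
      (ℚᵘ.≃-trans (ℚᵘ.*-cong (ℚ.toℚᵘ-fromℚᵘ (mkℚᵘ i d)) (toℚᵘ-ι (ℤ.+ suc d)))
      (ℚᵘ.≃-trans (*≡* (arr i (ℤ.+ suc d))) (ℚᵘ.≃-sym (toℚᵘ-ι i)))))
      where
      arr : ∀ i d → (i ℤ.* d) ℤ.* 1ℤ ≡ i ℤ.* (d ℤ.* 1ℤ)
      arr = ℤR.solve-∀

    ι-0 : ι 0ℤ ≡ 0ℚ
    ι-0 = refl

  numerator : ∀ q → q ℚ.* ι (↧ q) ≡ ι (↥ q)
  numerator q@record{} = trans (cong (ℚ._* ι (↧ q)) (sym (ℚ.↥p/↧p≡p q))) (frac (↥ q) (↧ₙ q))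

  record Cleared (f : Poly) : Set where
    field
      num : ℕ → ℤ
      den : ℤ
      den≢0 : den ≢ 0ℤ
      scale : ∀ j → ι (num j) ≡ ι den ℚ.* coeff f j

  clear : ∀ f → Cleared f
  clear [] = record { num = λ _ → 0ℤ ; den = 1ℤ ; den≢0 = λ () ; scale = λ _ → trans ι-0 (sym (ℚ.*-zeroʳ (ι 1ℤ))) }
  clear (a ∷ f) = record { num = F ; den = ↧ a ℤ.* c.den ; den≢0 = nz ; scale = sc }
    where
    module c = Cleared (clear f)
    F : ℕ → ℤ
    F zero    = ↥ a ℤ.* c.den
    F (suc j) = ↧ a ℤ.* c.num j
    nz : ↧ a ℤ.* c.den ≢ 0ℤ
    nz e with ℤ.i*j≡0⇒i≡0∨j≡0 (↧ a) e
    ... | inj₁ ()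
    ... | inj₂ z = c.den≢0 z
    sc : ∀ j → ι (F j) ≡ ι (↧ a ℤ.* c.den) ℚ.* coeff (a ∷ f) j
    sc zero    = trans (ι-* (↥ a) c.den) (trans (cong (ℚ._* ι c.den) (sym (numerator a)))
      (trans (ℚ.*-assoc a (ι (↧ a)) (ι c.den)) (trans (ℚ.*-comm a (ι (↧ a) ℚ.* ι c.den)) (cong (ℚ._* a) (sym (ι-* (↧ a) c.den))))))
    sc (suc j) = trans (ι-* (↧ a) (c.num j)) (trans (cong (ι (↧ a) ℚ.*_) (c.scale j))
      (trans (sym (ℚ.*-assoc (ι (↧ a)) (ι c.den) (coeff f j))) (cong (ℚ._* coeff f j) (sym (ι-* (↧ a) c.den)))))

  convℚ : (ℕ → ℚ) → (ℕ → ℚ) → ℕ → ℕ → ℚ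
  convℚ f g k zero    = f 0 ℚ.* g k
  convℚ f g k (suc i) = convℚ f g k i ℚ.+ f (suc i) ℚ.* g (k ∸ suc i)

  -- The local function of convSum has no name here; the type of convSum-go is inferred from its use.
  mutual
    convSum≡ : ∀ f g k → convSum f g k ≡ convℚ f g k k
    convSum≡ f g zero    = refl
    convSum≡ f g (suc m) with suc m | ℚ._+_
    ... | w | _⊕_ = cong (_⊕ (f w ℚ.* g (m ∸ m))) (convSum-go f g w m)

    convSum-go : ∀ f g w m → _ ≡ convℚ f g w m
    convSum-go f g w zero    = refl
    convSum-go f g w (suc m) = cong (ℚ._+ f (suc m) ℚ.* g (w ∸ suc m)) (convSum-go f g w m)

  conv-scale : ∀ {f h} (F H : ℕ → ℤ) (a b : ℤ) → (∀ j → ι (F j) ≡ ι a ℚ.* f j) → (∀ j → ι (H j) ≡ ι b ℚ.* h j) →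
    ∀ m l → ι (convTo F H m l) ≡ ι (a ℤ.* b) ℚ.* convℚ f h m l
  conv-scale {f} {h} F H a b eF eH m = go
    where
    term : ∀ i j → ι (F i ℤ.* H j) ≡ ι (a ℤ.* b) ℚ.* (f i ℚ.* h j)
    term i j = begin
      ι (F i ℤ.* H j)                          ≡⟨ ι-* (F i) (H j) ⟩
      ι (F i) ℚ.* ι (H j)                      ≡⟨ cong₂ ℚ._*_ (eF i) (eH j) ⟩
      (ι a ℚ.* f i) ℚ.* (ι b ℚ.* h j)          ≡⟨ ℚ.*-assoc (ι a) (f i) (ι b ℚ.* h j) ⟩
      ι a ℚ.* (f i ℚ.* (ι b ℚ.* h j))          ≡⟨ cong (ι a ℚ.*_) (trans (sym (ℚ.*-assoc (f i) (ι b) (h j))) (trans (cong (ℚ._* h j) (ℚ.*-comm (f i) (ι b))) (ℚ.*-assoc (ι b) (f i) (h j)))) ⟩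
      ι a ℚ.* (ι b ℚ.* (f i ℚ.* h j))          ≡⟨ ℚ.*-assoc (ι a) (ι b) (f i ℚ.* h j) ⟨
      (ι a ℚ.* ι b) ℚ.* (f i ℚ.* h j)          ≡⟨ cong (ℚ._* (f i ℚ.* h j)) (ι-* a b) ⟨
      ι (a ℤ.* b) ℚ.* (f i ℚ.* h j)            ∎
      where open ≡-Reasoning
    go : ∀ l → ι (convTo F H m l) ≡ ι (a ℤ.* b) ℚ.* convℚ f h m l
    go zero    = term 0 m
    go (suc l) = trans (ι-+ (convTo F H m l) (F (suc l) ℤ.* H (m ∸ suc l))) (trans (cong₂ ℚ._+_ (go l) (term (suc l) (m ∸ suc l)))
      (sym (ℚ.*-distribˡ-+ (ι (a ℤ.* b)) (convℚ f h m l) (f (suc l) ℚ.* h (m ∸ suc l)))))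

  coeff-map : ∀ (c : ℕ → ℚ) (φ : ℕ → ℕ) N → (∀ j → j ℕ.< N → coeff (map c (applyUpTo φ N)) j ≡ c (φ j))
                                             × (∀ j → N ℕ.≤ j → coeff (map c (applyUpTo φ N)) j ≡ 0ℚ)
  coeff-map c φ zero    = (λ j ()) , (λ j _ → refl)
  coeff-map c φ (suc N) with coeff-map c (φ ∘ suc) N
  ... | inside , outside = (λ { zero _ → refl ; (suc j) (s≤s j<) → inside j j< }) , (λ { zero () ; (suc j) (s≤s N≤) → outside j N≤ })

  length-bound : ∀ f j → length f ℕ.≤ j → coeff f j ≡ 0ℚ
  length-bound []      j       _        = refl
  length-bound (a ∷ f) (suc j) (s≤s le) = length-bound f j le

  Degree : Poly → ℕ → Set
  Degree f k = 1 ℕ.≤ k × coeff f k ≢ 0ℚ × (∀ j → k ℕ.< j → coeff f j ≡ 0ℚ)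

  degree : ∀ f → NonConstant f → ∃ (Degree f)
  degree f (j₀ , 1≤j₀ , nz) = search (length f) (λ j l< → length-bound f j (ℕ.<⇒≤ l<))
    where
    search : ∀ l → (∀ j → l ℕ.< j → coeff f j ≡ 0ℚ) → ∃ (Degree f)
    search zero    above = ⊥-elim (nz (above j₀ 1≤j₀))
    search (suc l) above with coeff f (suc l) ℚ.≟ 0ℚ
    ... | no  ne = suc l , s≤s z≤n , ne , above
    ... | yes z = search l above′
      where
      above′ : ∀ j → l ℕ.< j → coeff f j ≡ 0ℚ
      above′ j l<j with j ℕ.≟ suc l
      ... | yes refl = z
      ... | no  ne = above j (ℕ.≤∧≢⇒< l<j (≢-sym ne))

  ℤ-domain : ∀ {a b} → a ≢ 0ℤ → b ≢ 0ℤ → a ℤ.* b ≢ 0ℤ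
  ℤ-domain {a} a≢0 b≢0 e with ℤ.i*j≡0⇒i≡0∨j≡0 a e
  ... | inj₁ z = a≢0 z
  ... | inj₂ z = b≢0 z

  conv-zero : ∀ F H m l → (∀ i → i ℕ.≤ l → F i ℤ.* H (m ∸ i) ≡ 0ℤ) → convTo F H m l ≡ 0ℤ
  conv-zero F H m zero    z = z 0 z≤n
  conv-zero F H m (suc l) z = cong₂ ℤ._+_ (conv-zero F H m l λ i i≤ → z i (ℕ.m≤n⇒m≤1+n i≤)) (z (suc l) ℕ.≤-refl)

  conv-single : ∀ F H m l X → X ℕ.≤ l → (∀ i → i ℕ.≤ l → i ≢ X → F i ℤ.* H (m ∸ i) ≡ 0ℤ) → convTo F H m l ≡ F X ℤ.* H (m ∸ X)
  conv-single F H m zero    zero z≤n z = refl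
  conv-single F H m (suc l) X X≤ z with X ℕ.≟ suc l
  ... | yes refl = trans (cong (ℤ._+ F (suc l) ℤ.* H (m ∸ suc l)) (conv-zero F H m l λ i i≤ → z i (ℕ.m≤n⇒m≤1+n i≤) (ℕ.<⇒≢ (s≤s i≤)))) (ℤ.+-identityˡ _)
  ... | no  ne = trans (cong₂ ℤ._+_ (conv-single F H m l X (ℕ.≤-pred (ℕ.≤∧≢⇒< X≤ ne)) λ i i≤ → z i (ℕ.m≤n⇒m≤1+n i≤)) (z (suc l) ℕ.≤-refl (≢-sym ne))) (ℤ.+-identityʳ _)

  conv-Σ : ∀ F H m l → convTo F H m l ≡ Σ[ suc l ] (λ i → F i ℤ.* H (m ∸ i))
  conv-Σ F H m zero    = sym (ℤ.+-identityˡ _)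
  conv-Σ F H m (suc l) = cong (ℤ._+ F (suc l) ℤ.* H (m ∸ suc l)) (conv-Σ F H m l)

  Σ-reverse : ∀ m f → Σ[ suc m ] f ≡ Σ[ suc m ] (λ i → f (m ∸ i))
  Σ-reverse zero    f = refl
  Σ-reverse (suc m) f = trans (Σ-head (suc m) f) (trans (ℤ.+-comm (f 0) _)
     (cong₂ ℤ._+_ (trans (Σ-reverse m (f ∘ suc)) (Σ-cong (suc m) λ i i< → cong f (sym (ℕ.+-∸-assoc 1 (ℕ.≤-pred i<))))) (cong f (sym (ℕ.n∸n≡0 m)))))

  conv-comm : ∀ F H m → conv F H m ≡ conv H F m
  conv-comm F H m = trans (conv-Σ F H m m) (trans (Σ-reverse m _) (trans (Σ-cong (suc m) λ i i< →
    trans (ℤ.*-comm (F (m ∸ i)) _) (cong (λ z → H z ℤ.* F (m ∸ i)) (ℕ.m∸[m∸n]≡n (ℕ.≤-pred i<)))) (sym (conv-Σ H F m m))))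

  swap-factors : ∀ {n s k} → Factors n s k → Factors n s (n ∸ k)
  swap-factors {n} {s} {k} fac = record
    { F = H ; H = F ; D = D ; D≢0 = D≢0 ; k≤n = ℕ.m∸n≤m n k ; F-top = H-top ; F-deg = H-deg
    ; H-top = subst (λ z → F z ≢ 0ℤ) (sym n∸n∸k) F-top
    ; H-deg = λ j lt → F-deg j (subst (ℕ._< j) n∸n∸k lt)
    ; coefs = λ i j e → trans (cong (ℤ._* (ℤ.+ (j !))) (conv-comm H F j)) (coefs i j e)
    ; above = λ j lt → trans (conv-comm H F j) (above j lt) }
    where
    open Factors fac
    n∸n∸k : n ∸ (n ∸ k) ≡ k
    n∸n∸k = ℕ.m∸[m∸n]≡n k≤n

  g₁-coeff : ∀ n s i j → i ℕ.+ j ≡ n → coeff (g₁ n s) j ℚ.* ι (ℤ.+ (j !)) ≡ ι (ℤ.+ (n ! ℕ.* ((i ℕ.+ s) C i)))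
  g₁-coeff n s i j e = trans (cong (ℚ._* ι (ℤ.+ (j !))) (proj₁ (coeff-map (g₁coeff n s) id (suc n)) j (s≤s (subst (j ℕ.≤_) e (ℕ.m≤n+m j i)))))
    (trans (frac (ℤ.+ (n ! ℕ.* ((n ℕ.+ s ∸ j) C (n ∸ j)))) (j !) {{j ℕ.!≢0}}) (cong₂ (λ u v → ι (ℤ.+ (n ! ℕ.* (u C v)))) n+s∸j n∸j))
    where
    n∸j : n ∸ j ≡ i
    n∸j = trans (cong (_∸ j) (sym e)) (ℕ.m+n∸n≡m i j)
    n+s∸j : n ℕ.+ s ∸ j ≡ i ℕ.+ s
    n+s∸j = trans (ℕ.+-∸-comm s (subst (j ℕ.≤_) e (ℕ.m≤n+m j i))) (cong (ℕ._+ s) n∸j)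

  g₁-above : ∀ n s j → n ℕ.< j → coeff (g₁ n s) j ≡ 0ℚ
  g₁-above n s j n<j = proj₂ (coeff-map (g₁coeff n s) id (suc n)) j n<j

  -- The degrees add up to n because the product is nonzero both at kf + kh and at n, and vanishes
  -- above either.
  factors-of-degrees : ∀ n s f h → IsProduct f h (g₁ n s) → ∀ kf kh → Degree f kf → Degree h kh →
    1 ℕ.≤ n ∸ kf × Factors n s kf
  factors-of-degrees n s f h prod kf kh (1≤kf , f-top , f-deg) (1≤kh , h-top , h-deg) = subst (1 ℕ.≤_) (sym n∸kf) 1≤kh , record
      { F = cf.num ; H = ch.num ; D = D ; D≢0 = D≢0 ; k≤n = subst (kf ℕ.≤_) n≡ (ℕ.m≤m+n kf kh) ; F-top = F-top ; F-deg = F-deg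
      ; H-top = subst (λ z → ch.num z ≢ 0ℤ) (sym n∸kf) H-top
      ; H-deg = λ j lt → H-deg j (subst (ℕ._< j) n∸kf lt)
      ; coefs = coefs ; above = above }
    where
    module cf = Cleared (clear f)
    module ch = Cleared (clear h)
    D = cf.den ℤ.* ch.den
    D≢0 : D ≢ 0ℤ
    D≢0 = ℤ-domain cf.den≢0 ch.den≢0
    P = conv cf.num ch.num
    ι-P : ∀ j → ι (P j) ≡ ι D ℚ.* coeff (g₁ n s) j
    ι-P j = trans (conv-scale cf.num ch.num cf.den ch.den cf.scale ch.scale j j)
      (cong (ι D ℚ.*_) (trans (sym (convSum≡ (coeff f) (coeff h) j)) (prod j)))
    zero-num : ∀ {f} (c : Cleared f) j → coeff f j ≡ 0ℚ → Cleared.num c j ≡ 0ℤ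
    zero-num c j z = ι-injective (trans (Cleared.scale c j) (trans (cong (ι (Cleared.den c) ℚ.*_) z) (trans (ℚ.*-zeroʳ (ι (Cleared.den c))) (sym ι-0))))
    nonzero-num : ∀ {f} (c : Cleared f) j → coeff f j ≢ 0ℚ → Cleared.num c j ≢ 0ℤ
    nonzero-num {f} c j nz e = Cleared.den≢0 c (ι-injective (trans (cancel (ι (Cleared.den c)) (coeff f j) nz
        (trans (sym (Cleared.scale c j)) (trans (cong ι e) ι-0))) (sym ι-0)))
      where
      cancel : ∀ a b → b ≢ 0ℚ → a ℚ.* b ≡ 0ℚ → a ≡ 0ℚ
      cancel a b b≢0 ab = trans (sym (ℚ.*-identityʳ a)) (trans (cong (a ℚ.*_) (sym (ℚ.*-inverseʳ b)))
         (trans (sym (ℚ.*-assoc a b (ℚ.1/ b))) (trans (cong (ℚ._* ℚ.1/ b) ab) (ℚ.*-zeroˡ (ℚ.1/ b)))))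
        where instance
          _ : ℚ.NonZero b
          _ = ℚ.≢-nonZero b≢0
    F-top = nonzero-num (clear f) kf f-top
    H-top = nonzero-num (clear h) kh h-top
    F-deg : ∀ j → kf ℕ.< j → cf.num j ≡ 0ℤ
    F-deg j lt = zero-num (clear f) j (f-deg j lt)
    H-deg : ∀ j → kh ℕ.< j → ch.num j ≡ 0ℤ
    H-deg j lt = zero-num (clear h) j (h-deg j lt)
    above : ∀ j → n ℕ.< j → P j ≡ 0ℤ
    above j lt = ι-injective (trans (ι-P j) (trans (cong (ι D ℚ.*_) (g₁-above n s j lt)) (trans (ℚ.*-zeroʳ (ι D)) (sym ι-0))))
    coefs : ∀ i j → i ℕ.+ j ≡ n → P j ℤ.* (ℤ.+ (j !)) ≡ D ℤ.* (ℤ.+ (n ! ℕ.* ((i ℕ.+ s) C i)))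
    coefs i j e = ι-injective (trans (ι-* (P j) (ℤ.+ (j !))) (trans (cong (ℚ._* ι (ℤ.+ (j !))) (ι-P j))
      (trans (ℚ.*-assoc (ι D) (coeff (g₁ n s) j) (ι (ℤ.+ (j !)))) (trans (cong (ι D ℚ.*_) (g₁-coeff n s i j e)) (sym (ι-* D (ℤ.+ (n ! ℕ.* ((i ℕ.+ s) C i)))))))))
    -- The last hypothesis serves two cases: m = kf + kh with i ≠ kf, and m > kf + kh with arbitrary
    -- i. Each time one of the indices exceeds the degree of its factor.
    left-or-right : ∀ m i → kf ℕ.+ kh ℕ.≤ m → i ℕ.≤ m → (i ≡ kf → kf ℕ.+ kh ≢ m) → cf.num i ℤ.* ch.num (m ∸ i) ≡ 0ℤ
    left-or-right m i le i≤m ne = decide (kf ℕ.<? i)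
      where
      decide : Dec (kf ℕ.< i) → cf.num i ℤ.* ch.num (m ∸ i) ≡ 0ℤ
      decide (yes kf<i) = trans (cong (ℤ._* ch.num (m ∸ i)) (F-deg i kf<i)) (ℤ.*-zeroˡ (ch.num (m ∸ i)))
      decide (no  kf≮i) = trans (cong (cf.num i ℤ.*_) (H-deg (m ∸ i) (ℕ.≤∧≢⇒< kh≤ kh≢))) (ℤ.*-zeroʳ (cf.num i))
        where
        i≤kf = ℕ.≮⇒≥ kf≮i
        i+ : i ℕ.+ (m ∸ i) ≡ m
        i+ = ℕ.m+[n∸m]≡n i≤m
        kh≤ : kh ℕ.≤ m ∸ i
        kh≤ = ℕ.+-cancelˡ-≤ i _ _ (subst (i ℕ.+ kh ℕ.≤_) (sym i+) (ℕ.≤-trans (ℕ.+-monoˡ-≤ kh i≤kf) le))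
        kh≢ : kh ≢ m ∸ i
        kh≢ e = ne i≡kf (ℕ.≤-antisym le (subst (ℕ._≤ kf ℕ.+ kh) (trans (cong (i ℕ.+_) e) i+) (ℕ.+-monoˡ-≤ kh i≤kf)))
          where
          i≡kf : i ≡ kf
          i≡kf = ℕ.≤-antisym i≤kf (ℕ.+-cancelʳ-≤ kh _ _ (subst (kf ℕ.+ kh ℕ.≤_) (trans (sym i+) (cong (i ℕ.+_) (sym e))) le))
    P-top : P (kf ℕ.+ kh) ≢ 0ℤ
    P-top e = ℤ-domain F-top H-top (trans (sym (trans (conv-single cf.num ch.num m m kf (ℕ.m≤m+n kf kh)
          λ i i≤ i≢ → left-or-right m i ℕ.≤-refl i≤ λ e _ → i≢ e) (cong (λ z → cf.num kf ℤ.* ch.num z) (ℕ.m+n∸m≡n kf kh)))) e)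
      where m = kf ℕ.+ kh
    P-n : P n ≢ 0ℤ
    P-n e = ℤ-domain D≢0 (λ z → *≢0 (fact≢0 n) (C≢0 0 s) (ℤ.+-injective z))
      (trans (sym (coefs 0 n refl)) (trans (cong (ℤ._* (ℤ.+ (n !))) e) (ℤ.*-zeroˡ (ℤ.+ (n !)))))
    n≡ : kf ℕ.+ kh ≡ n
    n≡ = ℕ.≤-antisym (ℕ.≮⇒≥ λ lt → P-top (above _ lt))
      (ℕ.≮⇒≥ λ lt → P-n (conv-zero cf.num ch.num n n λ i i≤ → left-or-right′ i i≤ lt))
      where
      left-or-right′ : ∀ i → i ℕ.≤ n → kf ℕ.+ kh ℕ.< n → cf.num i ℤ.* ch.num (n ∸ i) ≡ 0ℤ
      left-or-right′ i i≤ lt = left-or-right n i (ℕ.<⇒≤ lt) i≤ (λ _ → ℕ.<⇒≢ lt)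
    n∸kf : n ∸ kf ≡ kh
    n∸kf = trans (cong (_∸ kf) (sym n≡)) (ℕ.m+n∸m≡n kf kh)

  factors : ∀ n s f h → IsProduct f h (g₁ n s) → NonConstant f → NonConstant h →
    ∃ λ k → 1 ℕ.≤ k × 1 ℕ.≤ n ∸ k × Factors n s k
  factors n s f h prod nf nh = let kf , df = degree f nf ; kh , dh = degree h nh in
    kf , proj₁ df , factors-of-degrees n s f h prod kf kh df dh

-- Kummer's theorem level by level, logarithms and local divisibility.

module KummerBounds where
  open DigitSums
  open Valuations
  open DumasLemma
  open CoefficientProfile
  open Factorisations
  open SlopeCriteria
  open import Data.Nat
  open import Data.Nat.Properties
  open import Data.Nat.DivMod
  open import Data.Nat.Divisibility
  open import Data.Nat.Primality
  open import Data.Nat.Coprimality using (Coprime; coprime-divisor)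
  open import Data.Nat.Combinatorics using (_C_)
  open import Data.Nat.Induction using (<-rec)
  open import Data.Nat.Primality.Factorisation using (factorise)
  import Data.List.Relation.Unary.All
  open import Data.Nat.Tactic.RingSolver using (solve-∀)
  open import Data.Product
  open import Data.Sum using (inj₁; inj₂)
  open import Data.Empty using (⊥; ⊥-elim)
  open import Data.List using (_∷_; [])
  open import Data.Nat.ListAction using (product)
  open import Relation.Nullary
  open import Relation.Binary.PropositionalEquality

  carryAt : (q : ℕ) .{{_ : NonZero q}} → ℕ → ℕ → ℕ
  carryAt q a b with q ≤? a % q + b % q
  ... | yes _ = 1
  ... | no  _ = 0

  carryAt-≤1 : ∀ q .{{_ : NonZero q}} a b → carryAt q a b ≤ 1
  carryAt-≤1 q a b with q ≤? a % q + b % q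
  ... | yes _ = ≤-refl
  ... | no  _ = z≤n

  carryAt-0 : ∀ q .{{_ : NonZero q}} a b → a % q + b % q < q → carryAt q a b ≡ 0
  carryAt-0 q a b lt with q ≤? a % q + b % q
  ... | yes q≤ = ⊥-elim (<⇒≱ lt q≤)
  ... | no  _ = refl

  carryAt-/ : ∀ q .{{_ : NonZero q}} a b → (a + b) / q ≡ a / q + b / q + carryAt q a b
  carryAt-/ q@(suc q₁) a b with q ≤? a % q + b % q
  ... | no  q≰ = trans (+-distrib-/ a b (≰⇒> q≰)) (sym (+-identityʳ _))
  ... | yes q≤ = trans (cong (_/ q) eq) (trans (proj₂ (divmod-unique q₁ c (suc (a / q + b / q)) c<)) (+-comm 1 _))
    where
    c = a % q + b % q ∸ q
    c+ : c + q ≡ a % q + b % q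
    c+ = m∸n+n≡m q≤
    c< : c < q
    c< = +-cancelʳ-< q c q (subst (_< q + q) (sym c+) (+-mono-< (m%n<n a q) (m%n<n b q)))
    arr : ∀ x u y v q → (x + u * q) + (y + v * q) ≡ (x + y) + (u + v) * q
    arr = solve-∀
    arr₂ : ∀ c q z → (c + q) + z * q ≡ c + suc z * q
    arr₂ = solve-∀
    eq : a + b ≡ c + suc (a / q + b / q) * q
    eq = trans (cong₂ _+_ (m≡m%n+[m/n]*n a q) (m≡m%n+[m/n]*n b q))
      (trans (arr (a % q) (a / q) (b % q) (b / q) q) (trans (cong (_+ (a / q + b / q) * q) (sym c+)) (arr₂ c q (a / q + b / q))))

  Σ₁ : ℕ → (ℕ → ℕ) → ℕ
  Σ₁ zero    f = 0
  Σ₁ (suc L) f = Σ₁ L f + f (suc L)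

  -- Each carry counts at most 1, so the first e levels cost at most e and only the higher ones have
  -- to be compared.
  Σ₁-bound : ∀ L e f g → (∀ l → f l ≤ 1) → (∀ l → e < l → f l ≤ g l) → Σ₁ L f ≤ e + Σ₁ L g
  Σ₁-bound zero    e f g _ _ = z≤n
  Σ₁-bound (suc L) e f g f≤1 f≤g with e ≤? L
  ... | yes e≤L = ≤-trans (+-mono-≤ (Σ₁-bound L e f g f≤1 f≤g) (f≤g (suc L) (s≤s e≤L))) (≤-reflexive (+-assoc e _ _))
  ... | no  e≰L = ≤-trans (≤-trans (count (suc L)) (≰⇒> e≰L)) (m≤m+n e _)
    where
    count : ∀ L → Σ₁ L f ≤ L
    count zero    = z≤n
    count (suc L) = ≤-trans (+-mono-≤ (count L) (f≤1 (suc L))) (≤-reflexive (+-comm L 1))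

  Σ₁-0 : ∀ L → Σ₁ L (λ _ → 0) ≡ 0
  Σ₁-0 zero    = refl
  Σ₁-0 (suc L) = trans (+-identityʳ _) (Σ₁-0 L)

  module Kummer (p₂ : ℕ) (pp : Prime (suc (suc p₂))) where
    open Val p₂ pp public

    at : ℕ → ℕ → ℕ → ℕ
    at l = carryAt (p ^ l) {{m^n≢0 p l}}

    quot : ℕ → ℕ → ℕ
    quot l x = _/_ x (p ^ l) {{m^n≢0 p l}}

    quot-suc : ∀ l x → quot (suc l) x ≡ quot l (x / p)
    quot-suc l x = sym (m/n/o≡m/[n*o] x p (p ^ l) {{_}} {{m^n≢0 p l}} {{m^n≢0 p (suc l)}})

    quot-1 : ∀ x → quot 1 x ≡ x / p
    quot-1 x = /-congʳ {m = x} {{m^n≢0 p 1}} (*-identityʳ p)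

    lev : ℕ → ℕ → ℕ
    lev L x = Σ₁ L (λ l → quot l x)

    lev-suc : ∀ L x → lev (suc L) x ≡ x / p + lev L (x / p)
    lev-suc zero    x = trans (quot-1 x) (sym (+-identityʳ _))
    lev-suc (suc L) x = trans (cong₂ _+_ (lev-suc L x) (quot-suc (suc L) x)) (+-assoc (x / p) (lev L (x / p)) _)

    lev-S : ∀ L x → x < p ^ L → p₁ * lev L x + S x ≡ x
    lev-S zero    zero    _ = trans (+-identityʳ _) (*-zeroʳ p₁)
    lev-S zero    (suc x) (s≤s ())
    lev-S (suc L) x x< = begin
      p₁ * lev (suc L) x + S x                        ≡⟨ cong₂ (λ a b → p₁ * a + b) (lev-suc L x) (S-unfold x) ⟩
      p₁ * (x / p + lev L (x / p)) + (x % p + S (x / p)) ≡⟨ arr p₁ (x / p) (lev L (x / p)) (x % p) (S (x / p)) ⟩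
      p₁ * (x / p) + (x % p + (p₁ * lev L (x / p) + S (x / p))) ≡⟨ cong (λ z → p₁ * (x / p) + (x % p + z)) (lev-S L (x / p) (m<n*o⇒m/o<n (subst (x <_) (*-comm p (p ^ L)) x<))) ⟩
      p₁ * (x / p) + (x % p + x / p)                  ≡⟨ arr₂ p₁ (x / p) (x % p) ⟩
      x % p + x / p * p                               ≡⟨ m≡m%n+[m/n]*n x p ⟨
      x                                               ∎
      where
      open ≡-Reasoning
      arr : ∀ q a b c d → q * (a + b) + (c + d) ≡ q * a + (c + (q * b + d))
      arr = solve-∀
      arr₂ : ∀ q a c → q * a + (c + a) ≡ c + a * suc q
      arr₂ = solve-∀

    ν-! : ∀ L x → x < p ^ L → ν (x !) ≡ lev L x
    ν-! L x x< = *-cancelˡ-≡ _ _ p₁ (+-cancelʳ-≡ (S x) _ _ (trans (legendre x) (sym (lev-S L x x<))))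

    -- The carry at p^l is the excess of ⌊(a+b)/p^l⌋ over the sum of the two floors. Unlike `ν-C`
    -- this form shows at which level a carry happens, and the residue condition speaks of single
    -- levels.
    kummer : ∀ L a b → a + b < p ^ L → ν ((a + b) C a) ≡ Σ₁ L (λ l → at l a b)
    kummer L a b ab< = +-cancelʳ-≡ (lev L a + lev L b) _ _ (begin
      ν ((a + b) C a) + (lev L a + lev L b)      ≡⟨ cong₂ (λ u v → ν ((a + b) C a) + (u + v)) (ν-! L a (≤-<-trans (m≤m+n a b) ab<)) (ν-! L b (≤-<-trans (m≤n+m b a) ab<)) ⟨
      ν ((a + b) C a) + (ν (a !) + ν (b !))      ≡⟨ cong (ν ((a + b) C a) +_) (ν-* (fact≢0 a) (fact≢0 b)) ⟨
      ν ((a + b) C a) + ν (a ! * b !)            ≡⟨ ν-* (C≢0 a b) (*≢0 (fact≢0 a) (fact≢0 b)) ⟨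
      ν (((a + b) C a) * (a ! * b !))            ≡⟨ cong ν (C-factorials a b) ⟩
      ν ((a + b) !)                              ≡⟨ ν-! L (a + b) ab< ⟩
      lev L (a + b)                              ≡⟨ split-lev L ⟩
      Σ₁ L (λ l → at l a b) + (lev L a + lev L b) ∎)
      where
      open ≡-Reasoning
      arr : ∀ t u v a b c → (t + (u + v)) + (a + b + c) ≡ (t + c) + ((u + a) + (v + b))
      arr = solve-∀
      split-lev : ∀ L → lev L (a + b) ≡ Σ₁ L (λ l → at l a b) + (lev L a + lev L b)
      split-lev zero    = refl
      split-lev (suc L) = trans (cong₂ _+_ (split-lev L) (carryAt-/ (p ^ suc L) {{m^n≢0 p (suc L)}} a b))
        (arr (Σ₁ L (λ l → at l a b)) (lev L a) (lev L b) (quot (suc L) a) (quot (suc L) b) (at (suc L) a b))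

    ν-C-≤ : ∀ a b e → (∀ l → e < l → at l a b ≡ 0) → ν ((a + b) C a) ≤ e
    ν-C-≤ a b e none = begin
      ν ((a + b) C a)                        ≡⟨ kummer (a + b) a b (n<p^n (a + b)) ⟩
      Σ₁ (a + b) (λ l → at l a b)            ≤⟨ Σ₁-bound (a + b) e _ (λ _ → 0) (λ l → carryAt-≤1 (p ^ l) {{m^n≢0 p l}} a b) (λ l e<l → ≤-reflexive (none l e<l)) ⟩
      e + Σ₁ (a + b) (λ _ → 0)               ≡⟨ cong (e +_) (Σ₁-0 (a + b)) ⟩
      e + 0                                  ≡⟨ +-identityʳ e ⟩
      e                                      ∎
      where open ≤-Reasoning

    ν-C-≤′ : ∀ a b c d e → (∀ l → e < l → at l a b ≤ at l c d) → ν ((a + b) C a) ≤ e + ν ((c + d) C c)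
    ν-C-≤′ a b c d e le = begin
      ν ((a + b) C a)                        ≡⟨ kummer L a b (≤-<-trans (m≤m+n (a + b) (c + d)) (n<p^n L)) ⟩
      Σ₁ L (λ l → at l a b)                  ≤⟨ Σ₁-bound L e _ _ (λ l → carryAt-≤1 (p ^ l) {{m^n≢0 p l}} a b) le ⟩
      e + Σ₁ L (λ l → at l c d)              ≡⟨ cong (e +_) (kummer L c d (≤-<-trans (m≤n+m (c + d) (a + b)) (n<p^n L))) ⟨
      e + ν ((c + d) C c)                    ∎
      where
      open ≤-Reasoning
      L = (a + b) + (c + d)

  -- ⌊log x⌋ to the base p₁ + 1, with fuel f; the value at x = 0 is 0.
  lgF : ℕ → ℕ → ℕ → ℕ
  lgF p₁ zero    x = 0
  lgF p₁ (suc f) x with x / suc p₁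
  ... | zero  = 0
  ... | suc y = suc (lgF p₁ f (suc y))

  module Log (p₂ : ℕ) where
    open Digits p₂

    lg : ℕ → ℕ
    lg x = lgF p₁ x x

    <-pow : ∀ f x → x ≤ f → x < p ^ suc (lgF p₁ f x)
    <-pow zero    zero _ = m^n>0 p 1
    <-pow (suc f) x x≤ with x / p in eq
    ... | zero  = subst (x <_) (sym (*-identityʳ p)) (subst (_< p) (sym (trans (m≡m%n+[m/n]*n x p) (trans (cong (λ z → x % p + z * p) eq) (+-identityʳ _)))) (m%n<n x p))
    ... | suc y = begin-strict
      x                                ≡⟨ trans (m≡m%n+[m/n]*n x p) (cong (λ z → x % p + z * p) eq) ⟩
      x % p + suc y * p                <⟨ +-monoˡ-< (suc y * p) (m%n<n x p) ⟩
      suc (suc y) * p                  ≤⟨ *-monoˡ-≤ p (<-pow f (suc y) (≤-pred (<-≤-trans y< x≤))) ⟩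
      p ^ suc (lgF p₁ f (suc y)) * p   ≡⟨ *-comm (p ^ suc (lgF p₁ f (suc y))) p ⟩
      p ^ suc (suc (lgF p₁ f (suc y))) ∎
      where
      open ≤-Reasoning
      y< : suc y < x
      y< = subst (_< x) eq (m/n<m x p {{≢-nonZero λ x0 → case (trans (sym eq) (cong (_/ p) x0))}} 1<p)
        where
        case : suc y ≡ 0 → ⊥
        case ()

    pow-≤ : ∀ f x → 0 < x → p ^ lgF p₁ f x ≤ x
    pow-≤ zero    x 0<x = 0<x
    pow-≤ (suc f) x 0<x with x / p in eq
    ... | zero  = 0<x
    ... | suc y = begin
      p * p ^ lgF p₁ f (suc y)  ≤⟨ *-monoʳ-≤ p (pow-≤ f (suc y) (s≤s z≤n)) ⟩
      p * suc y                 ≡⟨ trans (*-comm p (suc y)) (cong (_* p) (sym eq)) ⟩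
      x / p * p                 ≤⟨ m/n*n≤m x p ⟩
      x                         ∎
      where open ≤-Reasoning

    lg-< : ∀ x l → lg x < l → x < p ^ l
    lg-< x l lt = <-≤-trans (<-pow x x ≤-refl) (^-monoʳ-≤ p lt)

    lg-≥ : ∀ x l → 0 < x → p ^ l ≤ x → l ≤ lg x
    lg-≥ x l 0<x le = ≮⇒≥ λ lt → <⇒≱ (lg-< x l lt) le

    lg-pow : ∀ x → 0 < x → p ^ lg x ≤ x
    lg-pow x 0<x = pow-≤ x x 0<x

  ∤⇒coprime : ∀ {p x} → Prime p → ¬ p ∣ x → Coprime p x
  ∤⇒coprime {p} pp p∤x {d} (d∣p , d∣x) with prime⇒irreducible pp d∣p
  ... | inj₁ d≡1 = d≡1
  ... | inj₂ refl = ⊥-elim (p∤x d∣x)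

  prime-∣-prime : ∀ {p r} → Prime p → Prime r → p ∣ r → p ≡ r
  prime-∣-prime pp pr p∣r with prime⇒irreducible pr p∣r
  ... | inj₁ refl = ⊥-elim (prime≢1 pp)
    where
    prime≢1 : ¬ Prime 1
    prime≢1 ()
  ... | inj₂ e = e

  prime-factor : ∀ n → 1 < n → ∃ λ p → Prime p × p ∣ n
  prime-factor n 1<n with factorise n {{>-nonZero (<-trans (s≤s z≤n) 1<n)}}
  ... | record { factors = [] ; isFactorisation = e } = ⊥-elim (<-irrefl (sym e) 1<n)
  ... | record { factors = p ∷ ps ; isFactorisation = e ; factorsPrime = pp Data.List.Relation.Unary.All.∷ _ } = p , pp , divides (product ps) (trans e (*-comm p (product ps)))

  -- A prime p dividing n also divides m and is cancelled from both. Powers of other primes are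
  -- coprime to p and survive; for p itself the hypothesis is used with the exponent raised by one.
  local-∣ : ∀ n m → n ≢ 0 → (∀ p e → Prime p → p ^ e ∣ n → p ^ e ∣ m) → n ∣ m
  local-∣ = <-rec _ go
    where
    go : ∀ n → (∀ {y} → y < n → ∀ m → y ≢ 0 → (∀ p e → Prime p → p ^ e ∣ y → p ^ e ∣ m) → y ∣ m) →
         ∀ m → n ≢ 0 → (∀ p e → Prime p → p ^ e ∣ n → p ^ e ∣ m) → n ∣ m
    go zero rec m n≢0 _ = ⊥-elim (n≢0 refl)
    go (suc zero) rec m _ _ = 1∣ m
    go n@(suc (suc _)) rec m n≢0 loc with prime-factor n (s≤s (s≤s z≤n))
    ... | p , pp , divides n′ en with subst (_∣ m) (^-identityʳ p) (loc p 1 pp (subst (_∣ n) (sym (^-identityʳ p)) (divides n′ en)))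
    ...   | divides m′ em = subst₂ _∣_ (sym en) (sym em) (*-monoˡ-∣ p (rec n′< m′ n′≢0 loc′))
      where
      instance
        p≢0 : NonZero p
        p≢0 = prime⇒nonZero pp
      1<p : 1 < p
      1<p = nonTrivial⇒n>1 p {{prime⇒nonTrivial pp}}
      n′≢0 : n′ ≢ 0
      n′≢0 z = n≢0 (trans en (cong (_* p) z))
      n′< : n′ < n
      n′< = subst (n′ <_) (sym en) (m<m*n n′ p {{≢-nonZero n′≢0}} 1<p)
      loc′ : ∀ r e → Prime r → r ^ e ∣ n′ → r ^ e ∣ m′
      loc′ r e pr d with p ∣? r ^ e
      ... | no p∤ = coprime-divisor (λ (x , y) → ∤⇒coprime pp p∤ (y , x)) (subst (r ^ e ∣_) (trans em (*-comm m′ p)) (loc r e pr (∣-trans d (divides p (trans en (*-comm n′ p))))))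
      ... | yes p∣re with p≡r e p∣re
        where
        p≡r : ∀ e → p ∣ r ^ e → p ≡ r
        p≡r zero    d1 = ⊥-elim (<⇒≱ 1<p (∣⇒≤ d1))
        p≡r (suc e) d with euclidsLemma r (r ^ e) pp d
        ... | inj₁ a = prime-∣-prime pp pr a
        ... | inj₂ b = p≡r e b
      ...   | refl = *-cancelˡ-∣ p (subst (p * p ^ e ∣_) (trans em (*-comm m′ p)) (loc p (suc e) pp
                 (subst (p * p ^ e ∣_) (trans (*-comm p n′) (sym en)) (*-monoʳ-∣ p d))))

-- The Boolean search over n, s and k.

module Search where
  open KummerBounds using (lgF)
  open import Data.Nat
  open import Data.Nat.DivMod hiding (_mod_)
  open import Data.Bool using (Bool; true; false; _∧_; _∨_; if_then_else_; not)
  open import Data.List using (List; _∷_; []; map)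
  open import Data.Product using (_×_; _,_)

  -- All primes below 275, as s + k ≤ 88 + 186.
  primes : List ℕ
  primes = 271 ∷ 269 ∷ 263 ∷ 257 ∷ 251 ∷ 241 ∷ 239 ∷ 233 ∷ 229 ∷ 227 ∷ 223 ∷ 211 ∷ 199 ∷ 197 ∷
     193 ∷ 191 ∷ 181 ∷ 179 ∷ 173 ∷ 167 ∷ 163 ∷ 157 ∷ 151 ∷ 149 ∷ 139 ∷ 137 ∷ 131 ∷ 127 ∷ 113 ∷
     109 ∷ 107 ∷ 103 ∷ 101 ∷ 97 ∷ 89 ∷ 83 ∷ 79 ∷ 73 ∷ 71 ∷ 67 ∷ 61 ∷ 59 ∷ 53 ∷ 47 ∷ 43 ∷ 41 ∷
     37 ∷ 31 ∷ 29 ∷ 23 ∷ 19 ∷ 17 ∷ 13 ∷ 11 ∷ 7 ∷ 5 ∷ 3 ∷ 2 ∷ []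

  -- remainder, with the junk value 0 for division by 0
  _mod_ : ℕ → ℕ → ℕ
  x mod zero  = 0
  x mod suc q = x % suc q

  lg′ : ℕ → ℕ → ℕ
  lg′ p x = lgF (pred p) x x

  -- The carries of n + s + c in base p₁ + 1, c being the incoming carry; nothing more can carry
  -- once s and c are 0. `carries-step` takes the new carry as an argument so that it is evaluated
  -- once.
  carries : ℕ → ℕ → ℕ → ℕ → ℕ → ℕ
  carries-step : ℕ → ℕ → ℕ → ℕ → ℕ → ℕ
  carries zero    p₁ n s       c       = 0
  carries (suc f) p₁ n zero    zero    = 0
  carries (suc f) p₁ n zero    (suc c) = carries-step f p₁ n zero ((n % suc p₁ + 0 + suc c) / suc p₁)
  carries (suc f) p₁ n (suc s) c       = carries-step f p₁ n (suc s) ((n % suc p₁ + suc s % suc p₁ + c) / suc p₁)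
  carries-step f p₁ n s c = c + carries f p₁ (n / suc p₁) (s / suc p₁) c

  -- The last two conditions of `small-slopes`: u stands for the last digit of n + s and c for a
  -- bound on the carries.
  flatTest : ℕ → ℕ → ℕ → ℕ → Bool
  flatTest p k u c = (k * c ≤ᵇ u) ∧ (k * suc c <ᵇ p)

  slopeTest : ℕ → ℕ → ℕ → ℕ → Bool
  slopeTest p n s k = (k <ᵇ p) ∧ (((n mod p) <ᵇ k) ∨ (p ≤ᵇ (s mod p) + k)) ∧ flatTest p k ((n + s) mod p) (carries (n + s) (pred p) n s 0)

  anyᵇ allᵇ : {A : Set} → (A → Bool) → List A → Bool
  anyᵇ f []       = false
  anyᵇ f (x ∷ xs) = f x ∨ anyᵇ f xs
  allᵇ f []       = true
  allᵇ f (x ∷ xs) = f x ∧ allᵇ f xs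

  keep : (ℕ → Bool) → List ℕ → List ℕ
  keep f []       = []
  keep f (x ∷ xs) = if f x then x ∷ keep f xs else keep f xs

  _⊔ᵇ_ : ℕ → ℕ → ℕ
  x ⊔ᵇ y = if x <ᵇ y then y else x

  -- For s < residueBound ps n k the residues of n modulo powers of the p ∈ ps rule out degree k.
  gap : ℕ → ℕ → ℕ → ℕ
  gap r r′ q = if r <ᵇ r′ then q ∸ r else 0

  -- The cut at 300 loses nothing: for q > 300 the inequality n mod q < k would make q divide some n
  -- - r with r < k, and `divides-all` rejects prime powers above 274 there. The fuel 8 in
  -- `residueBound` covers the powers of 2 up to 256.
  gaps : ℕ → ℕ → ℕ → ℕ → ℕ → ℕ
  gaps zero    p q n k = 0
  gaps (suc f) p q n k = if q ≤ᵇ 300 then gap (n mod q) (k mod q) q ⊔ᵇ gaps f p (q * p) n k else 0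

  residueBound : List ℕ → ℕ → ℕ → ℕ
  residueBound []       n k = 0
  residueBound (p ∷ ps) n k = gaps 8 p p n k ⊔ᵇ residueBound ps n k

  fall : ℕ → ℕ → ℕ
  fall n zero    = 1
  fall n (suc k) = fall n k * (n ∸ k)

  -- The part of lcm(1, ..., x) supported on the listed primes.
  prodPow : ℕ → List ℕ → ℕ
  prodPow x []       = 1
  prodPow x (p ∷ ps) = p ^ lg′ p x * prodPow x ps

  primesUpTo : ℕ → List ℕ
  primesUpTo x = keep (λ p → p ≤ᵇ x) primes

  bigL : ℕ → ℕ
  bigL x = prodPow x (primesUpTo x)

  -- Checks the leaf at every d · m ≤ N with m ∣ Π p^e.
  walk  : (ℕ → Bool) → ℕ → List (ℕ × ℕ) → ℕ → Bool
  walkᵉ : (ℕ → Bool) → ℕ → ℕ → ℕ → List (ℕ × ℕ) → ℕ → Bool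
  walkIf : (ℕ → Bool) → ℕ → ℕ → ℕ → List (ℕ × ℕ) → ℕ → Bool
  walk leaf N []             d = leaf d
  walk leaf N ((p , e) ∷ ps) d = walkᵉ leaf N p e ps d
  walkᵉ leaf N p zero    ps d = walk leaf N ps d
  walkᵉ leaf N p (suc e) ps d = walk leaf N ps d ∧ walkIf leaf N p e ps (d * p)
  walkIf leaf N p e ps d = if d ≤ᵇ N then walkᵉ leaf N p e ps d else true

  divides-all : ℕ → ℕ → ℕ → Bool
  divides-all L n zero    = true
  divides-all L n (suc r) = divides-all L n r ∧ ((L mod (n ∸ r)) ≡ᵇ 0)

  leaf₁ : List ℕ → List ℕ → (ℕ → Bool) → ℕ → ℕ → ℕ → ℕ → Bool
  leaf₁ qs ps exc L s k n = (n <ᵇ k + k) ∨ not (divides-all L n k) ∨ anyᵇ (λ p → slopeTest p n s k) ps ∨ (s <ᵇ residueBound qs n k) ∨ exc n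

  -- Rules out a prime p ∣ n − r with r < k, when n + s < p^(e+1) bounds the number of carries by e.
  excluded′ : ℕ → ℕ → ℕ → ℕ → ℕ → Bool
  excluded′ p k r u e = flatTest p k u (if r ≤ᵇ u then pred e else e)

  excluded : ℕ → ℕ → ℕ → ℕ → ℕ → Bool
  excluded p k s e r = (k <ᵇ p) ∧ excluded′ p k r ((r + s) mod p) e

  allBelow : (ℕ → Bool) → ℕ → Bool
  allBelow f zero    = true
  allBelow f (suc r) = allBelow f r ∧ f r

  -- A prime p > k dividing C(n,k) divides some n - r with r < k, so that n mod p = r. If every r is
  -- excluded, p does not divide C(n,k).
  useless : ℕ → ℕ → ℕ → ℕ → Bool
  useless k s p e = allBelow (excluded p k s e) k

  halve : ℕ → ℕ → ℕ → ℕ → ℕ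
  halve zero    B k N = N
  halve (suc f) B k N = if B <ᵇ fall (N / 2) k then halve f B k (N / 2) else N

  usefulPrimes : ℕ → ℕ → ℕ → List ℕ → List ℕ
  usefulPrimes k s N ps = keep (λ p → not (useless k s p (lg′ p (N + s)))) ps

  -- The case r = 0 for divisors of n itself. A prime power dividing n is at most s when k ≤ s,
  -- which gives the exponents; 2 is dropped for k = 1 because n is odd there.
  divisorPrimes : ℕ → ℕ → ℕ → List ℕ → List (ℕ × ℕ)
  divisorPrimes k s N ps = map (λ p → p , lg′ p s) (keep (λ p → not (((k ≡ᵇ 1) ∧ (p ≡ᵇ 2)) ∨ excluded p k s (lg′ p (N + s)) 0)) ps)

  -- Only proposes a starting bound, as `grow` does below; the comparison in `start` is what
  -- certifies it.
  double : ℕ → ℕ → ℕ → ℕ → ℕ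
  double zero    B k N = N
  double (suc f) B k N = if B <ᵇ fall N k then N else double f B k (N * 2)

  module Small (fuel : ℕ) (exc : ℕ → ℕ → ℕ → Bool) (s k : ℕ) (qs ps : List ℕ) (L : ℕ) where
    -- A bound N for n bounds the number of carries in n + s, which removes primes from C(n,k) and so
    -- improves the bound, until the divisors of n can be listed.
    descend  : ℕ → ℕ → Bool
    descend′ : ℕ → ℕ → ℕ → Bool
    descend zero    N = false
    descend (suc f) N = descend′ f N (halve fuel (k ! * prodPow (s + k) (usefulPrimes k s N ps)) k N)
    descend′ f N N′ = if N′ <ᵇ N then descend f N′ else walk (leaf₁ qs ps (λ n → exc n s k) L s k) N (divisorPrimes k s N ps) 1

    start : ℕ → Bool
    start N = (k ! * L <ᵇ fall N k) ∧ descend fuel N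

    check : Bool
    check = start (double fuel (k ! * L) k 1)

  small : ℕ → (ℕ → ℕ → ℕ → Bool) → ℕ → ℕ → List ℕ → List ℕ → Bool
  small fuel exc s k qs ps = Small.check fuel exc s k qs ps (prodPow (s + k) ps)

  allS : ℕ → ℕ → (ℕ → Bool) → Bool
  allS zero    s f = true
  allS (suc c) s f = f s ∧ allS c (suc s) f

  -- m is the residue bound of n, which does not involve s and is thus computed once for all s from
  -- a to a + c - 1.
  resolved : ℕ → ℕ → List ℕ → ℕ → ℕ → ℕ → Bool
  resolved c a ps k n m = allS c a (λ s → (s <ᵇ m) ∨ anyᵇ (λ p → slopeTest p n s k) ps)

  leaf₂ : ℕ → ℕ → List ℕ → List ℕ → ℕ → ℕ → ℕ → Bool
  leaf₂ c a qs ps L k n = (n <ᵇ k + k) ∨ not (divides-all L n k) ∨ resolved c a ps k n (residueBound qs n k)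

  grow : ℕ → ℕ → ℕ → ℕ → ℕ
  grow zero    B k N = N
  grow (suc f) B k N = if B <ᵇ fall N k then N else grow f B k (N + N / 8 + 1)

  -- With s replaced by 88, C(n,k) is at most L and at most B C(k+88, k), where B will be lcm(1,
  -- ..., 88). Both are multiplied by k!, and the smaller one starts the search.
  module Large (c a B k : ℕ) (qs ps : List ℕ) (L : ℕ) where
    start : ℕ → Bool
    start N = ((k ! * L <ᵇ fall N k) ∨ (B * fall (k + 88) k <ᵇ fall N k)) ∧ walk (leaf₂ c a qs ps L k) N (map (λ p → p , lg′ p (88 + k)) ps) 1
    bound : ℕ
    bound = if k ! * L <ᵇ B * fall (k + 88) k then k ! * L else B * fall (k + 88) k
    check : ℕ → Bool
    check fuel = start (grow fuel bound k (k + k))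

  large : ℕ → ℕ → ℕ → ℕ → ℕ → List ℕ → List ℕ → Bool
  large fuel c a B k qs ps = Large.check c a B k qs ps (prodPow (88 + k) ps) fuel

-- Soundness of the Boolean tests, completeness of the prime list and of the divisor walk.

module SearchLemmas where
  open DigitSums
  open Valuations
  open DumasLemma
  open CoefficientProfile
  open Factorisations
  open SlopeCriteria
  open KummerBounds
  open Search
  open import Data.Nat
  open import Data.Nat.Properties
  open import Data.Nat.DivMod hiding (_mod_)
  open import Data.Nat.Divisibility
  open import Data.Nat.Primality
  open import Data.Nat.Coprimality using (coprime-divisor)
  open import Data.Nat.Combinatorics using (_C_)
  open import Data.Nat.Tactic.RingSolver using (solve-∀)
  open import Data.Bool using (Bool; true; false; _∧_; _∨_; T)
  open import Data.List using (List; _∷_; [])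
  open import Data.List.Membership.Propositional using (_∈_)
  open import Data.List.Relation.Unary.Any using (here; there)
  open import Data.List.Relation.Unary.All as All using (All)
  open import Data.Product hiding (map)
  open import Data.Sum using (_⊎_; inj₁; inj₂)
  open import Data.Empty using (⊥; ⊥-elim)
  open import Data.Unit using (tt)
  open import Function using (case_of_)
  open import Relation.Nullary
  open import Relation.Nullary.Decidable using (toWitness)
  open import Relation.Binary.PropositionalEquality

  T⇐ : ∀ {b} → b ≡ true → T b
  T⇐ refl = tt

  T⇒ : ∀ {b} → T b → b ≡ true
  T⇒ {true} _ = refl

  ∧-split : ∀ a {b} → a ∧ b ≡ true → a ≡ true × b ≡ true
  ∧-split true e = refl , e

  ∨-split : ∀ a {b} → a ∨ b ≡ true → a ≡ true ⊎ b ≡ true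
  ∨-split true  e = inj₁ refl
  ∨-split false e = inj₂ e

  <ᵇ-sound : ∀ {m n} → (m <ᵇ n) ≡ true → m < n
  <ᵇ-sound {m} {n} e = <ᵇ⇒< m n (T⇐ e)

  ≤ᵇ-sound : ∀ {m n} → (m ≤ᵇ n) ≡ true → m ≤ n
  ≤ᵇ-sound {m} {n} e = ≤ᵇ⇒≤ m n (T⇐ e)

  <ᵇ-true : ∀ {m n} → m < n → (m <ᵇ n) ≡ true
  <ᵇ-true lt = T⇒ (<⇒<ᵇ lt)

  ≤ᵇ-true : ∀ {m n} → m ≤ n → (m ≤ᵇ n) ≡ true
  ≤ᵇ-true le = T⇒ (≤⇒≤ᵇ le)

  ≡ᵇ-sound : ∀ {m n} → (m ≡ᵇ n) ≡ true → m ≡ n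
  ≡ᵇ-sound {m} {n} e = ≡ᵇ⇒≡ m n (T⇐ e)

  false≢true : false ≡ true → ⊥
  false≢true ()

  any-sound : ∀ {A : Set} (f : A → Bool) xs → anyᵇ f xs ≡ true → ∃ λ x → x ∈ xs × f x ≡ true
  any-sound f (x ∷ xs) e with ∨-split (f x) e
  ... | inj₁ fx = x , here refl , fx
  ... | inj₂ r = let y , y∈ , fy = any-sound f xs r in y , there y∈ , fy

  all-sound : ∀ {A : Set} (f : A → Bool) xs → allᵇ f xs ≡ true → ∀ {x} → x ∈ xs → f x ≡ true
  all-sound f (x ∷ xs) e (here refl) = proj₁ (∧-split (f x) e)
  all-sound f (x ∷ xs) e (there x∈)  = all-sound f xs (proj₂ (∧-split (f x) e)) x∈

  allS-sound : ∀ c a f → allS c a f ≡ true → ∀ s → a ≤ s → s < a + c → f s ≡ true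
  allS-sound zero    a f e s a≤s s< = ⊥-elim (<⇒≱ s< (subst (_≤ s) (sym (+-identityʳ a)) a≤s))
  allS-sound (suc c) a f e s a≤s s< with ∧-split (f a) e | a ≟ s
  ... | fa , _ | yes refl = fa
  ... | _ , r  | no a≢s = allS-sound c (suc a) f r s (≤∧≢⇒< a≤s a≢s) (subst (s <_) (+-suc a c) s<)

  below-sound : ∀ f r → allBelow f r ≡ true → ∀ i → i < r → f i ≡ true
  below-sound f (suc r) e i (s≤s i≤r) with ∧-split (allBelow f r) e | i ≟ r
  ... | _ , fr | yes refl = fr
  ... | l , _  | no i≢r = below-sound f r l i (≤∧≢⇒< i≤r i≢r)

  keep-∈ : ∀ f {x} xs → x ∈ xs → f x ≡ true → x ∈ keep f xs
  keep-∈ f (x ∷ xs) (here refl) fx rewrite fx = here refl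
  keep-∈ f (y ∷ xs) (there x∈) fx with f y
  ... | true  = there (keep-∈ f xs x∈ fx)
  ... | false = keep-∈ f xs x∈ fx

  ∈-keep : ∀ f {x} xs → x ∈ keep f xs → x ∈ xs
  ∈-keep f (y ∷ xs) x∈ with f y
  ∈-keep f (y ∷ xs) (here refl) | true = here refl
  ∈-keep f (y ∷ xs) (there x∈)  | true = there (∈-keep f xs x∈)
  ∈-keep f (y ∷ xs) x∈          | false = there (∈-keep f xs x∈)

  data Two+ : ℕ → Set where
    two+ : ∀ p₂ → Two+ (suc (suc p₂))

  prime≥2 : ∀ {p} → Prime p → Two+ p
  prime≥2 {zero} ()
  prime≥2 {suc zero} ()
  prime≥2 {suc (suc p₂)} _ = two+ p₂

  mod-% : ∀ x q .{{_ : NonZero q}} → x mod q ≡ x % q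
  mod-% x (suc q) = refl

  all-prime : All Prime primes
  all-prime = toWitness {a? = All.all? prime? primes} tt

  primes-prime : ∀ {p} → p ∈ primes → Prime p
  primes-prime = All.lookup all-prime

  -- A composite number below 275 < 17² has a prime factor at most 13.
  smallPrimes : List ℕ
  smallPrimes = 2 ∷ 3 ∷ 5 ∷ 7 ∷ 11 ∷ 13 ∷ []

  listed : ℕ → Bool
  listed x = anyᵇ (x ≡ᵇ_) primes ∨ ((x <ᵇ 2) ∨ anyᵇ (λ d → (d <ᵇ x) ∧ ((x mod d) ≡ᵇ 0)) smallPrimes)

  prime-∈ : ∀ {p} → Prime p → p < 275 → p ∈ primes
  prime-∈ {p} pp p< with ∨-split (anyᵇ (p ≡ᵇ_) primes) (below-sound listed 275 refl p p<)
  ... | inj₁ e = let q , q∈ , eq = any-sound (p ≡ᵇ_) primes e in subst (_∈ primes) (sym (≡ᵇ-sound {p} eq)) q∈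
  ... | inj₂ e with ∨-split (p <ᵇ 2) e
  ...   | inj₁ p<2 = ⊥-elim (<⇒≱ (<ᵇ-sound {p} p<2) (nonTrivial⇒n>1 p {{prime⇒nonTrivial pp}}))
  ...   | inj₂ c with any-sound _ smallPrimes c
  ...     | d , d∈ , both = ⊥-elim (divisor d d∈ (proj₁ (∧-split (d <ᵇ p) both)) (proj₂ (∧-split (d <ᵇ p) both)))
    where
    proper : ∀ d → d ≢ 1 → (d <ᵇ p) ≡ true → d ∣ p → ⊥
    proper d d≢1 lt d∣p with prime⇒irreducible pp d∣p
    ... | inj₁ e = d≢1 e
    ... | inj₂ e = <⇒≢ (<ᵇ-sound {d} lt) e
    divisor : ∀ d → d ∈ smallPrimes → (d <ᵇ p) ≡ true → ((p mod d) ≡ᵇ 0) ≡ true → ⊥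
    divisor d (here refl) lt z = proper 2 (λ ()) lt (m%n≡0⇒n∣m p 2 (≡ᵇ-sound {p % 2} z))
    divisor d (there (here refl)) lt z = proper 3 (λ ()) lt (m%n≡0⇒n∣m p 3 (≡ᵇ-sound {p % 3} z))
    divisor d (there (there (here refl))) lt z = proper 5 (λ ()) lt (m%n≡0⇒n∣m p 5 (≡ᵇ-sound {p % 5} z))
    divisor d (there (there (there (here refl)))) lt z = proper 7 (λ ()) lt (m%n≡0⇒n∣m p 7 (≡ᵇ-sound {p % 7} z))
    divisor d (there (there (there (there (here refl))))) lt z = proper 11 (λ ()) lt (m%n≡0⇒n∣m p 11 (≡ᵇ-sound {p % 11} z))
    divisor d (there (there (there (there (there (here refl)))))) lt z = proper 13 (λ ()) lt (m%n≡0⇒n∣m p 13 (≡ᵇ-sound {p % 13} z))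

  upTo-∈ : ∀ {p x} → Prime p → p ≤ x → x < 275 → p ∈ primesUpTo x
  upTo-∈ {p} {x} pp p≤x x< = keep-∈ (_≤ᵇ x) primes (prime-∈ pp (≤-<-trans p≤x x<)) (≤ᵇ-true p≤x)

  upTo-prime : ∀ {p x} → p ∈ primesUpTo x → Prime p
  upTo-prime {p} {x} p∈ = primes-prime (∈-keep (_≤ᵇ x) primes p∈)

  prodPow-∣ : ∀ {p} x ps → p ∈ ps → p ^ lg′ p x ∣ prodPow x ps
  prodPow-∣ x (p ∷ ps) (here refl) = m∣m*n (prodPow x ps)
  prodPow-∣ x (q ∷ ps) (there p∈)  = ∣-trans (prodPow-∣ x ps p∈) (n∣m*n (q ^ lg′ q x))

  powers-∣ : ∀ {p e x} → Prime p → 0 < x → p ^ e ≤ x → p ^ e ∣ p ^ lg′ p x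
  powers-∣ {p} {e} {x} pp 0<x le with prime≥2 pp
  ... | two+ p₂ = Val.pow-∣ p₂ pp (Log.lg-≥ p₂ x e 0<x le)

  base-≤ : ∀ {p e x} → Prime p → e ≢ 0 → p ^ e ≤ x → p ≤ x
  base-≤ {p} {zero}  pp e≢0 le = ⊥-elim (e≢0 refl)
  base-≤ {p} {suc e} pp _   le = ≤-trans (m≤m*n p (p ^ e) {{m^n≢0 p e {{prime⇒nonZero pp}}}}) le

  ∣-prodPow : ∀ x n ps → n ≢ 0 → 0 < x → (∀ p e → Prime p → e ≢ 0 → p ^ e ∣ n → p ∈ ps × p ^ e ≤ x) → n ∣ prodPow x ps
  ∣-prodPow x n ps n≢0 0<x loc = local-∣ n (prodPow x ps) n≢0 go
    where
    go : ∀ p e → Prime p → p ^ e ∣ n → p ^ e ∣ prodPow x ps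
    go p zero    pp d = 1∣ _
    go p (suc e) pp d = let p∈ , le = loc p (suc e) pp (λ ()) d in ∣-trans (powers-∣ {e = suc e} pp 0<x le) (prodPow-∣ x ps p∈)

  prodPow≢0 : ∀ x ps → (∀ {p} → p ∈ ps → Prime p) → NonZero (prodPow x ps)
  prodPow≢0 x []       _   = _
  prodPow≢0 x (p ∷ ps) prm = m*n≢0 _ _ {{m^n≢0 p (lg′ p x) {{prime⇒nonZero (prm (here refl))}}}} {{prodPow≢0 x ps λ p∈ → prm (there p∈)}}

  Πᵉ : List (ℕ × ℕ) → ℕ
  Πᵉ []             = 1
  Πᵉ ((p , e) ∷ ps) = p ^ e * Πᵉ ps

  strip : ∀ {p m} e x → Prime p → ¬ p ∣ m → m ∣ p ^ e * x → m ∣ x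
  strip zero    x pp p∤m d = subst (_ ∣_) (+-identityʳ x) d
  strip {p} {m} (suc e) x pp p∤m d = strip e x pp p∤m (coprime-divisor (λ (a , b) → ∤⇒coprime pp p∤m (b , a)) (subst (m ∣_) (*-assoc p (p ^ e) x) d))

  module _ (leaf : ℕ → Bool) (N : ℕ) where
    -- If p does not divide m, the remaining powers of p are dropped from the product; otherwise one
    -- factor p moves from m to d.
    walk-sound : ∀ ps → (∀ {p e} → (p , e) ∈ ps → Prime p) → ∀ d m → 0 < m → m ∣ Πᵉ ps → d * m ≤ N → walk leaf N ps d ≡ true → leaf (d * m) ≡ true
    walkᵉ-sound : ∀ p e ps → Prime p → (∀ {p e} → (p , e) ∈ ps → Prime p) → ∀ d m → 0 < m → m ∣ p ^ e * Πᵉ ps → d * m ≤ N →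
      walkᵉ leaf N p e ps d ≡ true → leaf (d * m) ≡ true
    walk-sound [] prm d m 0<m m∣ dm≤ e = subst (λ z → leaf z ≡ true) (sym (trans (cong (d *_) (∣1⇒≡1 m∣)) (*-identityʳ d))) e
    walk-sound ((p , e) ∷ ps) prm d m 0<m m∣ dm≤ t = walkᵉ-sound p e ps (prm (here refl)) (λ x → prm (there x)) d m 0<m m∣ dm≤ t
    walkᵉ-sound p zero ps pp prm d m 0<m m∣ dm≤ t = walk-sound ps prm d m 0<m (subst (m ∣_) (+-identityʳ _) m∣) dm≤ t
    walkᵉ-sound p (suc e) ps pp prm d m 0<m m∣ dm≤ t with ∧-split (walk leaf N ps d) t | p ∣? m
    ... | stay , _ | no p∤m = walk-sound ps prm d m 0<m (strip (suc e) (Πᵉ ps) pp p∤m m∣) dm≤ stay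
    ... | _ , more | yes (divides m′ refl) = subst (λ z → leaf z ≡ true) (arr d p m′)
        (walkᵉ-sound p e ps pp prm (d * p) m′ 0<m′ m′∣ (subst (_≤ N) (sym (arr d p m′)) dm≤) (into more))
      where
      arr : ∀ d p m → d * p * m ≡ d * (m * p)
      arr = solve-∀
      0<m′ : 0 < m′
      0<m′ = n≢0⇒n>0 λ z → <-irrefl (sym (cong (_* p) z)) 0<m
      m′∣ : m′ ∣ p ^ e * Πᵉ ps
      m′∣ = *-cancelʳ-∣ p {{prime⇒nonZero pp}} (subst (m′ * p ∣_) (arr₂ p (p ^ e) (Πᵉ ps)) m∣)
        where
        arr₂ : ∀ p x y → p * x * y ≡ x * y * p
        arr₂ = solve-∀
      dp≤ : d * p ≤ N
      dp≤ = ≤-trans (m≤m*n (d * p) m′ {{>-nonZero 0<m′}}) (subst (_≤ N) (sym (arr d p m′)) dm≤)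
      into : walkIf leaf N p e ps (d * p) ≡ true → walkᵉ leaf N p e ps (d * p) ≡ true
      into t rewrite ≤ᵇ-true dp≤ = t

  fall-! : ∀ k m → fall (k + m) k * m ! ≡ (k + m) !
  fall-! zero    m = +-identityʳ (m !)
  fall-! (suc k) m = begin
    fall (suc k + m) k * (suc k + m ∸ k) * m !  ≡⟨ cong₂ (λ u v → fall u k * v * m !) (sym (+-suc k m)) (trans (cong (_∸ k) (sym (+-suc k m))) (m+n∸m≡n k (suc m))) ⟩
    fall (k + suc m) k * suc m * m !            ≡⟨ *-assoc (fall (k + suc m) k) (suc m) (m !) ⟩
    fall (k + suc m) k * suc m !                ≡⟨ fall-! k (suc m) ⟩
    (k + suc m) !                               ≡⟨ cong _! (+-suc k m) ⟩
    (suc k + m) !                               ∎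
    where open ≡-Reasoning

  fall-C : ∀ k m → fall (k + m) k ≡ k ! * ((k + m) C k)
  fall-C k m = *-cancelʳ-≡ _ _ (m !) {{m !≢0}} (trans (fall-! k m) (trans (sym (C-factorials k m)) (arr ((k + m) C k) (k !) (m !))))
    where
    arr : ∀ c a b → c * (a * b) ≡ a * c * b
    arr = solve-∀

  fall-mono : ∀ {m n} k → m ≤ n → fall m k ≤ fall n k
  fall-mono zero    le = ≤-refl
  fall-mono (suc k) le = *-mono-≤ (fall-mono k le) (∸-monoˡ-≤ k le)

  fall-prime : ∀ {p} n k → Prime p → p ∣ fall n k → ∃ λ r → r < k × p ∣ n ∸ r
  fall-prime n zero    pp d = ⊥-elim (<⇒≱ (nonTrivial⇒n>1 _ {{prime⇒nonTrivial pp}}) (∣⇒≤ d))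
  fall-prime n (suc k) pp d with euclidsLemma (fall n k) (n ∸ k) pp d
  ... | inj₁ x = let r , r< , e = fall-prime n k pp x in r , m<n⇒m<1+n r< , e
  ... | inj₂ x = k , ≤-refl , x

  fall-suc : ∀ m k → fall (suc m) (suc k) ≡ suc m * fall m k
  fall-suc m zero    = trans (+-identityʳ _) (sym (*-identityʳ (suc m)))
  fall-suc m (suc k) = trans (cong (_* (m ∸ k)) (fall-suc m k)) (*-assoc (suc m) (fall m k) (m ∸ k))

-- Consequences of the residue theorem and of the slope criterion for n and C(n,k).

module DegreeConstraints where
  open DigitSums
  open Valuations
  open DumasLemma
  open CoefficientProfile
  open Factorisations
  open SlopeCriteria
  open KummerBounds
  open Search
  open SearchLemmas
  open import Data.Nat
  open import Data.Nat.Properties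
  open import Data.Nat.DivMod hiding (_mod_)
  open import Data.Nat.Divisibility
  open import Data.Nat.Primality
  open import Data.Nat.Combinatorics using (_C_)
  open import Data.Nat.Tactic.RingSolver using (solve-∀)
  open import Data.Bool using (true; false; _∨_; if_then_else_)
  open import Data.List using (_∷_)
  open import Data.List.Membership.Propositional using (_∈_)
  open import Data.List.Relation.Unary.Any using (here; there)
  open import Data.Product hiding (map)
  open import Data.Sum using (_⊎_; inj₁; inj₂)
  open import Data.Empty using (⊥; ⊥-elim)
  open import Function using (case_of_)
  open import Relation.Nullary
  open import Relation.Binary.PropositionalEquality

  -- Each carry lowers the digit sum by p - 1. Fuel n + s + c suffices, since the sum left after a
  -- digit is split off is smaller.
  carries-exact : ∀ p₂ f n s c → let open Digits p₂ in n + s + c ≤ f → p₁ * carries f p₁ n s c + S (n + s + c) ≡ S n + S s + c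
  carries-exact p₂ zero zero zero zero _ = trans (+-identityʳ _) (*-zeroʳ (suc p₂))
  carries-exact p₂ (suc f) n s c le = cases s c le
    where
    open Digits p₂
    open ≡-Reasoning
    shrink : ∀ t w → t + w * p ≤ suc f → w ≤ f
    shrink t zero    _  = z≤n
    shrink t (suc w) le = ≤-pred (<-≤-trans (y<dy t (suc w) λ ()) le)
    step : ∀ s c → n + s + c ≤ suc f → p₁ * carries-step f p₁ n s ((n % p + s % p + c) / p) + S (n + s + c) ≡ S n + S s + c
    step s c le = begin
      p₁ * (c′ + r) + S (n + s + c)                         ≡⟨ cong (λ z → p₁ * (c′ + r) + S z) whole ⟩
      p₁ * (c′ + r) + S (t % p + (n / p + s / p + c′) * p)  ≡⟨ cong (p₁ * (c′ + r) +_) (S-digit (t % p) (n / p + s / p + c′) (m%n<n t p)) ⟩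
      p₁ * (c′ + r) + (t % p + S (n / p + s / p + c′))      ≡⟨ a₁ p₁ c′ r (t % p) (S (n / p + s / p + c′)) ⟩
      p₁ * c′ + t % p + (p₁ * r + S (n / p + s / p + c′))   ≡⟨ cong (p₁ * c′ + t % p +_) (carries-exact p₂ f (n / p) (s / p) c′ smaller) ⟩
      p₁ * c′ + t % p + (S (n / p) + S (s / p) + c′)        ≡⟨ a₂ p₁ c′ (t % p) (S (n / p)) (S (s / p)) ⟩
      (t % p + c′ * p) + (S (n / p) + S (s / p))            ≡⟨ cong (_+ (S (n / p) + S (s / p))) (sym (m≡m%n+[m/n]*n t p)) ⟩
      (n % p + s % p + c) + (S (n / p) + S (s / p))         ≡⟨ a₃ (n % p) (s % p) c (S (n / p)) (S (s / p)) ⟩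
      (n % p + S (n / p)) + (s % p + S (s / p)) + c         ≡⟨ cong₂ (λ u v → u + v + c) (sym (S-unfold n)) (sym (S-unfold s)) ⟩
      S n + S s + c                                         ∎
      where
      t = n % p + s % p + c
      c′ = t / p
      r = carries f p₁ (n / p) (s / p) c′
      a₁ : ∀ q c r t u → q * (c + r) + (t + u) ≡ q * c + t + (q * r + u)
      a₁ = solve-∀
      a₂ : ∀ q c t a b → q * c + t + (a + b + c) ≡ (t + c * suc q) + (a + b)
      a₂ = solve-∀
      a₃ : ∀ x y c a b → (x + y + c) + (a + b) ≡ (x + a) + (y + b) + c
      a₃ = solve-∀
      a₄ : ∀ x a y b c q → (x + a * q) + (y + b * q) + c ≡ (x + y + c) + (a + b) * q
      a₄ = solve-∀
      a₅ : ∀ t c d q → (t + c * q) + d * q ≡ t + (d + c) * q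
      a₅ = solve-∀
      whole : n + s + c ≡ t % p + (n / p + s / p + c′) * p
      whole = trans (cong₂ (λ u v → u + v + c) (m≡m%n+[m/n]*n n p) (m≡m%n+[m/n]*n s p))
        (trans (a₄ (n % p) (n / p) (s % p) (s / p) c p) (trans (cong (_+ (n / p + s / p) * p) (m≡m%n+[m/n]*n t p)) (a₅ (t % p) c′ (n / p + s / p) p)))
      smaller : n / p + s / p + c′ ≤ f
      smaller = shrink (t % p) (n / p + s / p + c′) (subst (_≤ suc f) whole le)
    cases : ∀ s c → n + s + c ≤ suc f → p₁ * carries (suc f) p₁ n s c + S (n + s + c) ≡ S n + S s + c
    cases zero zero le = trans (cong₂ (λ u v → u + S v) (*-zeroʳ p₁) (trans (+-identityʳ (n + 0)) (+-identityʳ n)))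
      (sym (trans (+-identityʳ (S n + 0)) (+-identityʳ (S n))))
    cases zero (suc c) le = step zero (suc c) le
    cases (suc s) c le = step (suc s) c le

  Σ₁-bound-pred : ∀ L e f → (∀ l → f l ≤ 1) → f 1 ≡ 0 → (∀ l → e < l → f l ≡ 0) → Σ₁ L f ≤ pred e
  Σ₁-bound-pred L e f f≤1 f1 f0 = go L
    where
    count : ∀ L → Σ₁ (suc L) f ≤ L
    count zero    = ≤-reflexive f1
    count (suc L) = ≤-trans (+-mono-≤ (count L) (f≤1 (suc (suc L)))) (≤-reflexive (+-comm L 1))
    go : ∀ L → Σ₁ L f ≤ pred e
    go zero = z≤n
    go (suc L) with e ≤? L
    ... | yes e≤L = ≤-trans (≤-reflexive (trans (cong (Σ₁ L f +_) (f0 (suc L) (s≤s e≤L))) (+-identityʳ _))) (go L)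
    ... | no  e≰L = ≤-trans (count L) (≤-pred (≤-trans (≰⇒> e≰L) (suc-pred-≤ e)))
      where
      suc-pred-≤ : ∀ e → e ≤ suc (pred e)
      suc-pred-≤ zero    = z≤n
      suc-pred-≤ (suc e) = ≤-refl

  module Facts {n s k : ℕ} (fac : Factors n s k) (1≤k : 1 ≤ k) where
    open Factors fac using (k≤n)

    residue-≤ : ∀ {p} → Prime p → ∀ a .{{_ : NonZero (p ^ a)}} → n % (p ^ a) + s < p ^ a → k % (p ^ a) ≤ n % (p ^ a)
    residue-≤ {p} pp a lt with prime≥2 pp
    ... | two+ p₂ = Residue.residue p₂ pp s k a (n % p ^ a) (n / p ^ a) lt (subst (λ z → Factors z s k) (m≡m%n+[m/n]*n n (p ^ a)) fac)

    -- If q = p^a exceeded both r + s and k, then n mod q = r would meet the condition of the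
    -- residue theorem, and k = k mod q ≤ r would contradict r < k.
    power-≤ : ∀ {p} → Prime p → ∀ a r → r < k → p ^ a ∣ n ∸ r → p ^ a ≤ r + s ⊎ p ^ a ≤ k
    power-≤ {p} pp a r r<k (divides t eq) with p ^ a ≤? k
    ... | yes le = inj₂ le
    ... | no  q≰k = inj₁ (≮⇒≥ λ lt → <⇒≱ r<k (subst₂ _≤_ (m<n⇒m%n≡m k<q) n%q (residue-≤ pp a (subst (λ z → z + s < q) (sym n%q) lt))))
      where
      q = p ^ a
      instance
        q≢0 : NonZero q
        q≢0 = m^n≢0 p a {{prime⇒nonZero pp}}
      k<q = ≰⇒> q≰k
      n%q : n % q ≡ r
      n%q = trans (cong (_% q) (trans (sym (m+[n∸m]≡n (≤-trans (<⇒≤ r<k) k≤n))) (cong (r +_) eq))) (trans ([m+kn]%n≡m%n r t q) (m<n⇒m%n≡m (<-trans r<k k<q)))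

    power-≤-s+k : ∀ {p} → Prime p → ∀ a r → r < k → p ^ a ∣ n ∸ r → p ^ a ≤ s + k
    power-≤-s+k pp a r r<k d with power-≤ pp a r r<k d
    ... | inj₁ le = ≤-trans le (≤-trans (+-monoˡ-≤ s (<⇒≤ r<k)) (≤-reflexive (+-comm k s)))
    ... | inj₂ le = ≤-trans le (m≤n+m k s)

    n≡ : k + (n ∸ k) ≡ n
    n≡ = m+[n∸m]≡n k≤n

    module At (p₂ : ℕ) (pp : Prime (suc (suc p₂))) where
      open Kummer p₂ pp public
      open Log p₂ public
      open Profile p₂ s using (κ; κ-eq) public

      -- A carry at q in k + (n - k) means n mod q < k mod q, which the residue theorem forbids
      -- unless n mod q + s ≥ q. Here `S` is an upper bound for s, not the digit sum.
      borrow-bound : ∀ S l → s ≤ S → at l k (n ∸ k) ≡ 0 ⊎ p ^ l ≤ _%_ k (p ^ l) {{m^n≢0 p l}} + S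
      borrow-bound S l s≤S = decide (q ≤? k % q + (n ∸ k) % q)
        where
        q = p ^ l
        instance
          q≢0 : NonZero q
          q≢0 = m^n≢0 p l
        decide : Dec (q ≤ k % q + (n ∸ k) % q) → at l k (n ∸ k) ≡ 0 ⊎ q ≤ k % q + S
        decide (no  q≰) = inj₁ (carryAt-0 q k (n ∸ k) (≰⇒> q≰))
        decide (yes q≤) = inj₂ (≤-trans (≮⇒≥ λ lt → <⇒≱ n%<k% (residue-≤ pp l lt)) (+-mono-≤ (<⇒≤ n%<k%) s≤S))
          where
          c = k % q + (n ∸ k) % q ∸ q
          c+ : c + q ≡ k % q + (n ∸ k) % q
          c+ = m∸n+n≡m q≤
          c<k% : c < k % q
          c<k% = +-cancelʳ-< q c (k % q) (subst (_< k % q + q) (sym c+) (+-monoʳ-< (k % q) (m%n<n (n ∸ k) q)))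
          n%q : n % q ≡ c
          n%q = trans (cong (_% q) (sym n≡)) (trans (%-distribˡ-+ k (n ∸ k) q) (trans (cong (_% q) (sym c+))
            (trans ([m+n]%n≡m%n c q) (m<n⇒m%n≡m (<-trans c<k% (m%n<n k q))))))
          n%<k% : n % q < k % q
          n%<k% = subst (_< k % q) (sym n%q) c<k%

      -- Only levels with p^l ≤ S + k can carry, so C(n,k) divides lcm(1, ..., S + k).
      ν-nCk : ∀ S → s ≤ S → ν (n C k) ≤ lg (S + k)
      ν-nCk S s≤S = subst (λ z → ν (z C k) ≤ lg (S + k)) n≡ (ν-C-≤ k (n ∸ k) (lg (S + k)) none)
        where
        none : ∀ l → lg (S + k) < l → at l k (n ∸ k) ≡ 0
        none l lt with borrow-bound S l s≤S
        ... | inj₁ z = z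
        ... | inj₂ le = ⊥-elim (<⇒≱ (lg-< (S + k) l lt) (≤-trans le (≤-trans (+-monoˡ-≤ S (m%n≤m k (p ^ l) {{m^n≢0 p l}})) (≤-reflexive (+-comm k S)))))

      -- At a level q > S a carry in k + (n - k) forces q ≤ k mod q + S, hence a carry in k + S at
      -- the same level; the levels up to S contribute at most `lg S`. For large k this is the
      -- stronger bound, the first factor being independent of k.
      ν-nCk′ : ∀ S → s ≤ S → ν (n C k) ≤ lg S + ν ((k + S) C k)
      ν-nCk′ S s≤S = subst (λ z → ν (z C k) ≤ lg S + ν ((k + S) C k)) n≡ (ν-C-≤′ k (n ∸ k) k S (lg S) le)
        where
        le : ∀ l → lg S < l → at l k (n ∸ k) ≤ at l k S
        le l lt with borrow-bound S l s≤S
        ... | inj₁ z = subst (_≤ at l k S) (sym z) z≤n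
        ... | inj₂ q≤ = subst (at l k (n ∸ k) ≤_) (sym one) (carryAt-≤1 (p ^ l) {{m^n≢0 p l}} k (n ∸ k))
          where
          instance
            q≢0 : NonZero (p ^ l)
            q≢0 = m^n≢0 p l
          one : at l k S ≡ 1
          one with p ^ l ≤? k % (p ^ l) + S % (p ^ l)
          ... | yes _ = refl
          ... | no q≰ = ⊥-elim (q≰ (subst (λ z → p ^ l ≤ k % (p ^ l) + z) (sym (m<n⇒m%n≡m (lg-< S l lt))) q≤))

      κ-ν : κ n ≡ p₁ * ν ((n + s) C n)
      κ-ν = +-cancelʳ-≡ (S (s + n)) _ _ (trans (κ-eq n) (sym (trans (cong (λ z → p₁ * ν ((n + s) C n) + S z) (+-comm s n)) (trans (ν-C n s) (+-comm (S n) (S s))))))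

      κ-carries : κ n ≡ p₁ * carries (n + s) p₁ n s 0
      κ-carries = +-cancelʳ-≡ (S (s + n)) _ _ (trans (κ-eq n) (sym (trans (cong (λ z → p₁ * carries (n + s) p₁ n s 0 + S z) (trans (+-comm s n) (sym (+-identityʳ (n + s)))))
        (trans (carries-exact p₂ (n + s) n s 0 (≤-reflexive (+-identityʳ (n + s)))) (trans (+-identityʳ (S n + S s)) (+-comm (S n) (S s)))))))

      at-high : ∀ N l → n ≤ N → lg (N + s) < l → at l n s ≡ 0
      at-high N l n≤N lt = carryAt-0 (p ^ l) n s (≤-<-trans (+-mono-≤ (m%n≤m n (p ^ l)) (m%n≤m s (p ^ l))) (≤-<-trans (+-monoˡ-≤ s n≤N) (lg-< (N + s) l lt)))
        where
        instance
          q≢0 : NonZero (p ^ l)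
          q≢0 = m^n≢0 p l

      κ-bound : ∀ N → n ≤ N → κ n ≤ p₁ * lg (N + s)
      κ-bound N n≤N = ≤-trans (≤-reflexive κ-ν) (*-monoʳ-≤ p₁ (ν-C-≤ n s (lg (N + s)) λ l lt → at-high N l n≤N lt))

      κ-bound-pred : ∀ N → n ≤ N → n % p + s % p < p → κ n ≤ p₁ * pred (lg (N + s))
      κ-bound-pred N n≤N lt = ≤-trans (≤-reflexive κ-ν) (*-monoʳ-≤ p₁ (≤-trans (≤-reflexive (kummer (n + s) n s (n<p^n (n + s))))
        (Σ₁-bound-pred (n + s) (lg (N + s)) _ (λ l → carryAt-≤1 (p ^ l) {{m^n≢0 p l}} n s)
          (carryAt-0 (p ^ 1) {{m^n≢0 p 1}} n s (subst (λ q → (nz : NonZero q) → _%_ n q {{nz}} + _%_ s q {{nz}} < q) (sym (*-identityʳ p)) (λ _ → lt) (m^n≢0 p 1)))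
          λ l lt → at-high N l n≤N lt)))

    flat-sound : ∀ p₂ → Prime (suc (suc p₂)) → ∀ c → k < suc (suc p₂) → (n % suc (suc p₂) < k ⊎ suc (suc p₂) ≤ s % suc (suc p₂) + k) →
      Profile.κ p₂ s n ≤ suc p₂ * c → flatTest (suc (suc p₂)) k ((n + s) % suc (suc p₂)) c ≡ true → ⊥
    flat-sound p₂ pp c k<p early κ≤ t = let a , b = ∧-split (k * c ≤ᵇ (n + s) % suc (suc p₂)) t in
      Criteria.small-slopes p₂ pp fac c 1≤k k<p early κ≤ (≤ᵇ-sound a) (<ᵇ-sound b)

    slope-sound : ∀ {p} → Prime p → slopeTest p n s k ≡ true → ⊥
    slope-sound pp t with prime≥2 pp
    ... | two+ p₂ with ∧-split (k <ᵇ suc (suc p₂)) t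
    ...   | k<p , t₁ with ∧-split ((n % suc (suc p₂) <ᵇ k) ∨ (suc (suc p₂) ≤ᵇ s % suc (suc p₂) + k)) t₁
    ...     | early , flat = flat-sound p₂ pp (carries (n + s) (suc p₂) n s 0) (<ᵇ-sound k<p)
        (early′ (∨-split (n % suc (suc p₂) <ᵇ k) early)) (≤-reflexive (At.κ-carries p₂ pp)) flat
      where
      early′ : (n % suc (suc p₂) <ᵇ k) ≡ true ⊎ (suc (suc p₂) ≤ᵇ s % suc (suc p₂) + k) ≡ true → n % suc (suc p₂) < k ⊎ suc (suc p₂) ≤ s % suc (suc p₂) + k
      early′ (inj₁ a) = inj₁ (<ᵇ-sound a)
      early′ (inj₂ b) = inj₂ (≤ᵇ-sound b)

    excluded-sound : ∀ {p} → Prime p → ∀ N r → n ≤ N → r < k → n mod p ≡ r → excluded p k s (lg′ p (N + s)) r ≡ true → ⊥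
    excluded-sound pp N r n≤N r<k n%p t with prime≥2 pp
    ... | two+ p₂ with ∧-split (k <ᵇ suc (suc p₂)) t
    ...   | k<p , flat = go (r ≤ᵇ u) refl
      where
      p = suc (suc p₂)
      u = (r + s) % p
      e = lg′ p (N + s)
      u≡ : u ≡ (n + s) % p
      u≡ = trans (%-distribˡ-+ r s p) (trans (cong (λ z → (z + s % p) % p) (trans (m<n⇒m%n≡m (<-trans r<k (<ᵇ-sound k<p))) (sym n%p))) (sym (%-distribˡ-+ n s p)))
      early : n % p < k ⊎ p ≤ s % p + k
      early = inj₁ (subst (_< k) (sym n%p) r<k)
      go : ∀ b → (r ≤ᵇ u) ≡ b → ⊥
      -- u is the last digit of n + s and r that of n. From r ≤ u the last digits add without a
      -- carry, so at most e - 1 carries remain.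
      go true eq = flat-sound p₂ pp (pred e) (<ᵇ-sound k<p) early (At.κ-bound-pred p₂ pp N n≤N no-carry)
        (subst (λ z → flatTest p k z (pred e) ≡ true) u≡ (subst (λ b → flatTest p k u (if b then pred e else e) ≡ true) eq flat))
        where
        no-carry : n % p + s % p < p
        no-carry = ≰⇒> λ p≤ → <⇒≱ (+-cancelʳ-< p u r (subst (_< r + p) (sym (u+ p≤)) (+-monoʳ-< r (m%n<n s p)))) (≤ᵇ-sound eq)
          where
          u+ : p ≤ n % p + s % p → u + p ≡ r + s % p
          u+ p≤ = trans (cong (_+ p) (trans u≡ (trans (%-distribˡ-+ n s p) (trans (cong (_% p) (sym (m∸n+n≡m p≤))) (trans ([m+n]%n≡m%n (n % p + s % p ∸ p) p)
             (m<n⇒m%n≡m (+-cancelʳ-< p _ p (subst (_< p + p) (sym (m∸n+n≡m p≤)) (+-mono-< (m%n<n n p) (m%n<n s p))))))))))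
             (trans (m∸n+n≡m p≤) (cong (_+ s % p) n%p))
      go false eq = flat-sound p₂ pp e (<ᵇ-sound k<p) early (At.κ-bound p₂ pp N n≤N)
        (subst (λ z → flatTest p k z e ≡ true) u≡ (subst (λ b → flatTest p k u (if b then pred e else e) ≡ true) eq flat))

    max-split : ∀ x y → s < x ⊔ᵇ y → s < x ⊎ s < y
    max-split x y lt with x <ᵇ y
    ... | true  = inj₂ lt
    ... | false = inj₁ lt

    gap-sound : ∀ {p} → Prime p → ∀ a → s < gap (n mod (p ^ a)) (k mod (p ^ a)) (p ^ a) → ⊥
    gap-sound {p} pp a lt = go (n % q <ᵇ k % q) refl (subst₂ (λ u v → s < gap u v q) (mod-% n q) (mod-% k q) lt)
      where
      q = p ^ a
      instance
        q≢0 : NonZero q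
        q≢0 = m^n≢0 p a {{prime⇒nonZero pp}}
      shift : ∀ m o n → m < n ∸ o → m + o < n
      shift m o n lt = <-≤-trans (+-monoˡ-< o lt) (≤-reflexive (m∸n+n≡m o≤n))
        where
        o≤n : o ≤ n
        o≤n = ≮⇒≥ λ n<o → case subst (m <_) (m≤n⇒m∸n≡0 (<⇒≤ n<o)) lt of λ ()
      go : ∀ b → (n % q <ᵇ k % q) ≡ b → s < gap (n % q) (k % q) q → ⊥
      go true eq lt = <⇒≱ (<ᵇ-sound eq) (residue-≤ pp a (subst (_< q) (+-comm s (n % q)) (shift s (n % q) q
          (subst (λ b → s < (if b then q ∸ n % q else 0)) eq lt))))
      go false eq lt = case subst (λ b → s < (if b then q ∸ n % q else 0)) eq lt of λ ()

    gaps-sound : ∀ {p} → Prime p → ∀ f a q → q ≡ p ^ a → s < gaps f p q n k → ⊥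
    gaps-sound {p} pp zero    a q _ ()
    gaps-sound {p} pp (suc f) a q refl lt with q ≤ᵇ 300
    ... | false = case lt of λ ()
    ... | true with max-split (gap (n mod q) (k mod q) q) (gaps f p (q * p) n k) lt
    ...   | inj₁ l = gap-sound pp a l
    ...   | inj₂ l = gaps-sound pp f (suc a) (q * p) (*-comm q p) l

    residueBound-sound : ∀ ps → (∀ {p} → p ∈ ps → Prime p) → s < residueBound ps n k → ⊥
    residueBound-sound (p ∷ ps) prm lt with max-split (gaps 8 p p n k) (residueBound ps n k) lt
    ... | inj₁ l = gaps-sound (prm (here refl)) 8 1 p (sym (*-identityʳ p)) l
    ... | inj₂ l = residueBound-sound ps (λ x → prm (there x)) l

-- Soundness of the searches, and the inequality for large degrees.

module SearchSoundness where
  open DigitSums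
  open Valuations
  open DumasLemma
  open CoefficientProfile
  open Factorisations
  open SlopeCriteria
  open KummerBounds
  open Search
  open SearchLemmas
  open DegreeConstraints
  open import Data.Nat
  open import Data.Nat.Properties
  open import Data.Nat.DivMod hiding (_mod_)
  open import Data.Nat.Divisibility
  open import Data.Nat.Primality
  open import Data.Nat.Combinatorics using (_C_)
  open import Data.Nat.Tactic.RingSolver using (solve-∀)
  open import Data.Bool using (Bool; true; false; _∧_; _∨_; not)
  open import Data.List using (List; _∷_; map)
  open import Data.List.Membership.Propositional using (_∈_)
  open import Data.List.Relation.Unary.Any using (here; there)
  open import Data.Product hiding (map)
  open import Data.Sum using (_⊎_; inj₁; inj₂)
  open import Data.Empty using (⊥; ⊥-elim)
  open import Function using (case_of_)
  open import Relation.Nullary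
  open import Relation.Binary.PropositionalEquality

  not-sound : ∀ {b} → not b ≡ true → b ≡ true → ⊥
  not-sound {true} () _

  halve-sound : ∀ f {B k n} N → fall n k ≤ B → n ≤ N → n ≤ halve f B k N
  halve-sound zero    N le n≤ = n≤
  halve-sound (suc f) {B} {k} {n} N le n≤ with B <ᵇ fall (N / 2) k in eq
  ... | false = n≤
  ... | true  = halve-sound f (N / 2) le (<⇒≤ (≰⇒> λ N≤n → <⇒≱ (<ᵇ-sound {B} eq) (≤-trans (fall-mono k N≤n) le)))

  below-fall : ∀ {B k n N} → fall n k ≤ B → B < fall N k → n ≤ N
  below-fall {k = k} le lt = <⇒≤ (≰⇒> λ N≤n → <⇒≱ lt (≤-trans (fall-mono k N≤n) le))

  divides-all-true : ∀ L n r → (∀ i → i < r → n ∸ i ∣ L × n ∸ i ≢ 0) → divides-all L n r ≡ true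
  divides-all-true L n zero    _ = refl
  divides-all-true L n (suc r) h = cong₂ _∧_ (divides-all-true L n r λ i i< → h i (m<n⇒m<1+n i<))
    (trans (cong (_≡ᵇ 0) (trans (mod-% L (n ∸ r) {{≢-nonZero (proj₂ (h r ≤-refl))}}) (n∣m⇒m%n≡0 L (n ∸ r) {{≢-nonZero (proj₂ (h r ≤-refl))}} (proj₁ (h r ≤-refl))))) refl)

  Πᵉ-∣ : ∀ x qs {p} → p ∈ qs → p ^ lg′ p x ∣ Πᵉ (map (λ p → p , lg′ p x) qs)
  Πᵉ-∣ x (q ∷ qs) (here refl) = m∣m*n _
  Πᵉ-∣ x (q ∷ qs) (there p∈)  = ∣-trans (Πᵉ-∣ x qs p∈) (n∣m*n (q ^ lg′ q x))

  map-prime : ∀ x qs → (∀ {p} → p ∈ qs → Prime p) → ∀ {p e} → (p , e) ∈ map (λ p → p , lg′ p x) qs → Prime p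
  map-prime x (q ∷ qs) prm (here refl) = prm (here refl)
  map-prime x (q ∷ qs) prm (there x∈)  = map-prime x qs (λ y → prm (there y)) x∈

  module Bounds {n s k : ℕ} (fac : Factors n s k) (1≤k : 1 ≤ k) (2k≤n : k + k ≤ n) where
    open Facts fac 1≤k
    open Factors fac using (k≤n)

    nCk≢0 : n C k ≢ 0
    nCk≢0 = subst (λ z → z C k ≢ 0) n≡ (C≢0 k (n ∸ k))

    fall-nCk : fall n k ≡ k ! * (n C k)
    fall-nCk = subst (λ z → fall z k ≡ k ! * (z C k)) n≡ (fall-C k (n ∸ k))

    fall-≤ : ∀ {M} .{{_ : NonZero M}} → n C k ∣ M → fall n k ≤ k ! * M
    fall-≤ d = ≤-trans (≤-reflexive fall-nCk) (*-monoʳ-≤ (k !) (∣⇒≤ d))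

    C-power : ∀ S → s ≤ S → ∀ {p} e → Prime p → p ^ e ∣ n C k → p ^ e ≤ S + k
    C-power S s≤S e pp d with prime≥2 pp
    ... | two+ p₂ = ≤-trans (^-monoʳ-≤ (suc (suc p₂)) (≤-trans (A.∣-ν {e} nCk≢0 d) (A.ν-nCk S s≤S))) (A.lg-pow (S + k) (≤-trans 1≤k (m≤n+m k S)))
      where module A = At p₂ pp

    n∸≢0 : ∀ {r} → r < k → n ∸ r ≢ 0
    n∸≢0 r<k = m>n⇒m∸n≢0 (<-≤-trans r<k k≤n)

    not-small : (n <ᵇ k + k) ≡ true → ⊥
    not-small e = <⇒≱ (<ᵇ-sound e) 2k≤n

    all-divide : ∀ S ps → s ≤ S → (∀ {p} → Prime p → p ≤ S + k → p ∈ ps) → divides-all (prodPow (S + k) ps) n k ≡ true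
    all-divide S ps s≤S complete = divides-all-true _ n k λ r r<k →
      ∣-prodPow (S + k) (n ∸ r) ps (n∸≢0 r<k) (≤-trans 1≤k (m≤n+m k S))
        (λ p e pp e≢0 d → let le = ≤-trans (power-≤-s+k pp e r r<k d) (+-monoˡ-≤ k s≤S) in complete pp (base-≤ {e = e} pp e≢0 le) , le)
      , n∸≢0 r<k

    module SmallSound (fuel : ℕ) (exc : ℕ → ℕ → ℕ → Bool) (qs ps : List ℕ) (qs-prime : ∀ {p} → p ∈ qs → Prime p) (complete : ∀ {p} → Prime p → p ≤ s + k → p ∈ ps) (sound : ∀ {p} → p ∈ ps → Prime p)
      (k≤s : k ≤ s) (odd : k ≡ 1 → ¬ 2 ∣ n) where
      x = s + k
      L = prodPow x ps
      0<x : 0 < x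
      0<x = ≤-trans 1≤k (m≤n+m k s)
      0<s : 0 < s
      0<s = ≤-trans 1≤k k≤s

      -- The bound N enters through the logarithm of N + s, which bounds the carries and so decides
      -- which primes can be excluded.
      useful-∣ : ∀ N → n ≤ N → n C k ∣ prodPow x (usefulPrimes k s N ps)
      useful-∣ N n≤N = ∣-prodPow x (n C k) _ nCk≢0 0<x λ p e pp e≢0 d →
        let le = C-power s ≤-refl e pp d in
        keep-∈ (λ p → not (useless k s p (lg′ p (N + s)))) ps (complete pp (base-≤ {e = e} pp e≢0 le)) (used p e pp e≢0 d) , le
        where
        used : ∀ p e → Prime p → e ≢ 0 → p ^ e ∣ n C k → not (useless k s p (lg′ p (N + s))) ≡ true
        used p zero    pp e≢0 d = ⊥-elim (e≢0 refl)
        used p (suc e) pp e≢0 d with useless k s p (lg′ p (N + s)) in eq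
        ... | false = refl
        ... | true with fall-prime n k pp (subst (p ∣_) (sym fall-nCk) (∣-trans (∣-trans (m∣m*n (p ^ e)) d) (n∣m*n (k !))))
        ...   | r , r<k , p∣ = ⊥-elim (excluded-sound pp N r n≤N r<k (residue p∣) (excl r r<k))
          where
          excl : ∀ r → r < k → excluded p k s (lg′ p (N + s)) r ≡ true
          excl = below-sound _ k eq
          k<p : k < p
          k<p = <ᵇ-sound (proj₁ (∧-split (k <ᵇ p) (excl r r<k)))
          residue : p ∣ n ∸ r → n mod p ≡ r
          residue (divides t e) = trans (mod-% n p {{prime⇒nonZero pp}}) (trans (cong (λ z → _%_ z p {{prime⇒nonZero pp}}) (trans (sym (m+[n∸m]≡n (≤-trans (<⇒≤ r<k) k≤n))) (cong (r +_) e)))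
               (trans ([m+kn]%n≡m%n r t p {{prime⇒nonZero pp}}) (m<n⇒m%n≡m {{prime⇒nonZero pp}} (<-trans r<k k<p))))

      divisor-∣ : ∀ N → n ≤ N → n ∣ Πᵉ (divisorPrimes k s N ps)
      divisor-∣ N n≤N = local-∣ n _ n≢0 go
        where
        n≢0 : n ≢ 0
        n≢0 z = <⇒≱ 1≤k (subst (k ≤_) z k≤n)
        test : ℕ → Bool
        test p = not (((k ≡ᵇ 1) ∧ (p ≡ᵇ 2)) ∨ excluded p k s (lg′ p (N + s)) 0)
        power-s : ∀ p e → Prime p → p ^ e ∣ n → p ^ e ≤ s
        power-s p e pp d with power-≤ pp e 0 1≤k d
        ... | inj₁ le = le
        ... | inj₂ le = ≤-trans le k≤s
        tested : ∀ p → Prime p → p ∣ n → test p ≡ true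
        tested p pp p∣n with ((k ≡ᵇ 1) ∧ (p ≡ᵇ 2)) ∨ excluded p k s (lg′ p (N + s)) 0 in eq
        ... | false = refl
        ... | true with ∨-split ((k ≡ᵇ 1) ∧ (p ≡ᵇ 2)) eq
        ...   | inj₁ both = let k1 , p2 = ∧-split (k ≡ᵇ 1) both in ⊥-elim (odd (≡ᵇ-sound k1) (subst (_∣ n) (≡ᵇ-sound {p} p2) p∣n))
        ...   | inj₂ ex = ⊥-elim (excluded-sound pp N 0 n≤N 1≤k (trans (mod-% n p {{prime⇒nonZero pp}}) (n∣m⇒m%n≡0 n p {{prime⇒nonZero pp}} p∣n)) ex)
        go : ∀ p e → Prime p → p ^ e ∣ n → p ^ e ∣ Πᵉ (divisorPrimes k s N ps)
        go p zero    pp d = 1∣ _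
        go p (suc e) pp d = ∣-trans (powers-∣ {e = suc e} pp 0<s le) (Πᵉ-∣ s (keep test ps) (keep-∈ test ps (complete pp p≤x) (tested p pp (∣-trans (m∣m*n (p ^ e)) d))))
          where
          le = power-s p (suc e) pp d
          p≤x : p ≤ x
          p≤x = ≤-trans (base-≤ {e = suc e} pp (λ ()) le) (m≤m+n s k)

      leaf-sound : leaf₁ qs ps (λ n → exc n s k) L s k n ≡ true → exc n s k ≡ true
      leaf-sound t with ∨-split (n <ᵇ k + k) t
      ... | inj₁ a = ⊥-elim (not-small a)
      ... | inj₂ t₁ with ∨-split (not (divides-all L n k)) t₁
      ...   | inj₁ b = ⊥-elim (not-sound b (all-divide s ps ≤-refl complete))
      ...   | inj₂ t₂ with ∨-split (anyᵇ (λ p → slopeTest p n s k) ps) t₂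
      ...     | inj₁ c = let p , p∈ , st = any-sound _ ps c in ⊥-elim (slope-sound (sound p∈) st)
      ...     | inj₂ t₃ with ∨-split (s <ᵇ residueBound qs n k) t₃
      ...       | inj₁ d = ⊥-elim (residueBound-sound qs qs-prime (<ᵇ-sound {s} d))
      ...       | inj₂ e = e

      open Small fuel exc s k qs ps L

      divisor-prime : ∀ N {p e} → (p , e) ∈ divisorPrimes k s N ps → Prime p
      divisor-prime N = map-prime s (keep (λ p → not (((k ≡ᵇ 1) ∧ (p ≡ᵇ 2)) ∨ excluded p k s (lg′ p (N + s)) 0)) ps) λ p∈ → sound (∈-keep _ ps p∈)

      descend-sound : ∀ f N → n ≤ N → descend f N ≡ true → exc n s k ≡ true
      descend-sound zero    N n≤N ()
      descend-sound (suc f) N n≤N t = go (halve fuel (k ! * M) k N) (halve-sound fuel N (fall-≤ {{M≢0}} (useful-∣ N n≤N)) n≤N) t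
        where
        M = prodPow x (usefulPrimes k s N ps)
        M≢0 : NonZero M
        M≢0 = prodPow≢0 x _ λ p∈ → sound (∈-keep _ ps p∈)
        go : ∀ N′ → n ≤ N′ → descend′ f N N′ ≡ true → exc n s k ≡ true
        go N′ n≤N′ t with N′ <ᵇ N
        ... | true  = descend-sound f N′ n≤N′ t
        ... | false = leaf-sound (subst (λ z → leaf₁ qs ps (λ n → exc n s k) L s k z ≡ true) (*-identityˡ n)
              (walk-sound _ N (divisorPrimes k s N ps) (divisor-prime N) 1 n (≤-trans 1≤k k≤n) (divisor-∣ N n≤N) (subst (_≤ N) (sym (*-identityˡ n)) n≤N) t))

      start-sound : ∀ N → start N ≡ true → exc n s k ≡ true
      start-sound N t with ∧-split (k ! * L <ᵇ fall N k) t
      ... | lt , d = descend-sound fuel N (below-fall {k = k} (fall-≤ {{prodPow≢0 x ps sound}} L∣) (<ᵇ-sound lt)) d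
        where
        L∣ : n C k ∣ L
        L∣ = ∣-prodPow x (n C k) ps nCk≢0 0<x λ p e pp e≢0 d → let le = C-power s ≤-refl e pp d in complete pp (base-≤ {e = e} pp e≢0 le) , le

      small-sound : small fuel exc s k qs ps ≡ true → exc n s k ≡ true
      small-sound = start-sound (double fuel (k ! * L) k 1)

    fall-≤-88 : s ≤ 88 → ∀ qs → (∀ {p} → Prime p → p ≤ 88 → p ∈ qs) → (∀ {p} → p ∈ qs → Prime p) → fall n k ≤ prodPow 88 qs * fall (k + 88) k
    fall-≤-88 s≤88 qs complete sound = ≤-trans (fall-≤ {{M≢0}} C∣) (≤-reflexive (trans (arr (k !) L₈₈ ((k + 88) C k)) (cong (L₈₈ *_) (sym (fall-C k 88)))))
      where
      L₈₈ = prodPow 88 qs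
      L₈₈≢0 : NonZero L₈₈
      L₈₈≢0 = prodPow≢0 88 qs sound
      M≢0 : NonZero (L₈₈ * ((k + 88) C k))
      M≢0 = m*n≢0 L₈₈ _ {{L₈₈≢0}} {{≢-nonZero (C≢0 k 88)}}
      arr : ∀ a b c → a * (b * c) ≡ b * (a * c)
      arr = solve-∀
      C∣ : n C k ∣ L₈₈ * ((k + 88) C k)
      C∣ = local-∣ (n C k) _ nCk≢0 go
        where
        go : ∀ p e → Prime p → p ^ e ∣ n C k → p ^ e ∣ L₈₈ * ((k + 88) C k)
        go p e pp d with prime≥2 pp
        ... | two+ p₂ = ∣-trans (A.pow-∣ (≤-trans (A.∣-ν {e} nCk≢0 d) (A.ν-nCk′ 88 s≤88)))
              (subst (_∣ L₈₈ * ((k + 88) C k)) (sym (^-distribˡ-+-* (suc (suc p₂)) (A.lg 88) (A.ν ((k + 88) C k)))) (*-pres-∣ low (A.ν-∣ (C≢0 k 88) ≤-refl)))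
          where
          module A = At p₂ pp
          low : suc (suc p₂) ^ A.lg 88 ∣ L₈₈
          low with A.lg 88 in eq
          ... | zero  = 1∣ _
          ... | suc l = subst (λ z → suc (suc p₂) ^ z ∣ L₈₈) eq (prodPow-∣ 88 qs (complete pp (base-≤ {e = A.lg 88} pp (λ z → case trans (sym z) eq of λ ()) (A.lg-pow 88 (s≤s z≤n)))))

    module LargeSound (fuel c a B : ℕ) (qs ps : List ℕ) (qs-prime : ∀ {p} → p ∈ qs → Prime p) (complete : ∀ {p} → Prime p → p ≤ 88 + k → p ∈ ps) (sound : ∀ {p} → p ∈ ps → Prime p)
      (a≤s : a ≤ s) (s< : s < a + c) (s≤88 : s ≤ 88) (fall≤B : fall n k ≤ B * fall (k + 88) k) where
      x = 88 + k
      L = prodPow x ps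
      0<x : 0 < x
      0<x = s≤s z≤n

      leaf-false : leaf₂ c a qs ps L k n ≡ true → ⊥
      leaf-false t with ∨-split (n <ᵇ k + k) t
      ... | inj₁ a = not-small a
      ... | inj₂ t₁ with ∨-split (not (divides-all L n k)) t₁
      ...   | inj₁ b = not-sound b (all-divide 88 ps s≤88 complete)
      ...   | inj₂ t₂ with ∨-split (s <ᵇ residueBound qs n k) (allS-sound c a _ t₂ s a≤s s<)
      ...     | inj₁ c = residueBound-sound qs qs-prime (<ᵇ-sound {s} c)
      ...     | inj₂ d = let p , p∈ , st = any-sound _ ps d in slope-sound (sound p∈) st

      open Large c a B k qs ps L

      n∣ : n ∣ Πᵉ (map (λ p → p , lg′ p x) ps)
      n∣ = local-∣ n _ (λ z → <⇒≱ 1≤k (subst (k ≤_) z k≤n)) go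
        where
        go : ∀ p e → Prime p → p ^ e ∣ n → p ^ e ∣ Πᵉ (map (λ p → p , lg′ p x) ps)
        go p zero    pp d = 1∣ _
        go p (suc e) pp d = ∣-trans (powers-∣ {e = suc e} pp 0<x le) (Πᵉ-∣ x ps (complete pp (base-≤ {e = suc e} pp (λ ()) le)))
          where
          le : p ^ suc e ≤ x
          le = ≤-trans (power-≤-s+k pp (suc e) 0 1≤k d) (+-monoˡ-≤ k s≤88)

      start-false : ∀ N → start N ≡ true → ⊥
      start-false N t with ∧-split ((k ! * L <ᵇ fall N k) ∨ (B * fall (k + 88) k <ᵇ fall N k)) t
      ... | lt , w = leaf-false (subst (λ z → leaf₂ c a qs ps L k z ≡ true) (*-identityˡ n)
            (walk-sound _ N _ (map-prime x ps sound) 1 n (≤-trans 1≤k k≤n) n∣ (subst (_≤ N) (sym (*-identityˡ n)) (n≤N (∨-split (k ! * L <ᵇ fall N k) lt))) w))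
        where
        L∣ : n C k ∣ L
        L∣ = ∣-prodPow x (n C k) ps nCk≢0 0<x λ p e pp e≢0 d → let le = C-power 88 s≤88 e pp d in complete pp (base-≤ {e = e} pp e≢0 le) , le
        n≤N : (k ! * L <ᵇ fall N k) ≡ true ⊎ (B * fall (k + 88) k <ᵇ fall N k) ≡ true → n ≤ N
        n≤N (inj₁ a) = below-fall {k = k} (fall-≤ {{prodPow≢0 x ps sound}} L∣) (<ᵇ-sound a)
        n≤N (inj₂ b) = below-fall {k = k} fall≤B (<ᵇ-sound b)

      large-sound : large fuel c a B k qs ps ≡ true → ⊥
      large-sound = start-false (grow fuel bound k (k + k))

  -- For n ≥ 2k this contradicts `fall-≤-88`: it says B C(k+88, k) < C(2k, k), with k! multiplied
  -- out.
  Exceeds : ℕ → ℕ → Set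
  Exceeds B k = B * fall (k + 88) k < fall (k + k) k

  -- Passing to k + 1 multiplies the left side by k + 89 and the right side by at least 2k + 2.
  exceeds-suc : ∀ B k → 89 ≤ k → Exceeds B k → Exceeds B (suc k)
  exceeds-suc B k 89≤k ih = begin-strict
      B * fall (suc (k + 88)) (suc k)       ≡⟨ cong (B *_) (fall-suc (k + 88) k) ⟩
      B * (suc (k + 88) * fall (k + 88) k)  ≡⟨ arr B (suc (k + 88)) (fall (k + 88) k) ⟩
      suc (k + 88) * (B * fall (k + 88) k)  <⟨ *-monoʳ-< (suc (k + 88)) ih ⟩
      suc (k + 88) * fall (k + k) k         ≤⟨ *-mono-≤ (s≤s (+-monoʳ-≤ k (≤-trans (≤-trans (n≤1+n 88) 89≤k) (n≤1+n k)))) (fall-mono k (+-monoʳ-≤ k (n≤1+n k))) ⟩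
      suc (k + suc k) * fall (k + suc k) k  ≡⟨ fall-suc (k + suc k) k ⟨
      fall (suc k + suc k) (suc k)          ∎
    where
    open ≤-Reasoning
    arr : ∀ a b c → a * (b * c) ≡ b * (a * c)
    arr = solve-∀

  exceeds-+ : ∀ B k j → 89 ≤ k → Exceeds B k → Exceeds B (j + k)
  exceeds-+ B k zero    89≤k h = h
  exceeds-+ B k (suc j) 89≤k h = exceeds-suc B (j + k) (≤-trans 89≤k (m≤n+m k j)) (exceeds-+ B k j 89≤k h)

  exceedsᵇ : ℕ → ℕ → Bool
  exceedsᵇ B k = B * fall (k + 88) k <ᵇ fall (k + k) k

  exceeds-from : ∀ B k₀ k → 89 ≤ k₀ → exceedsᵇ B k₀ ≡ true → k₀ ≤ k → Exceeds B k
  exceeds-from B k₀ k 89≤ t k₀≤k = subst (Exceeds B) (m∸n+n≡m k₀≤k) (exceeds-+ B k₀ (k ∸ k₀) 89≤ (<ᵇ-sound t))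

-- Individual cases: special slopes and quadratic factors modulo a small number.

module Exceptions where
  open DigitSums
  open Valuations
  open DumasLemma
  open CoefficientProfile
  open Factorisations
  open SlopeCriteria
  open KummerBounds
  open Search
  open SearchLemmas
  open DegreeConstraints
  open SearchSoundness using (not-sound)
  open LaguerreExpansion using (coef)
  open LinearFactors using (conv-coef)
  open ClearingDenominators using (swap-factors; conv-single)
  open import Data.Integer as ℤ using (ℤ; ∣_∣; 0ℤ; 1ℤ)
  import Data.Integer.Properties as ℤ
  import Data.Integer.DivMod as ℤ
  import Data.Integer.Divisibility.Signed as ℤᵈ
  import Data.Integer.Tactic.RingSolver as ℤR
  open import Data.Nat
  open import Data.Nat.Properties
  open import Data.Nat.DivMod hiding (_mod_)
  open import Data.Nat.Divisibility
  open import Data.Nat.Primality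
  open import Data.Nat.Tactic.RingSolver using (solve-∀)
  open import Data.Bool using (Bool; true; false; _∧_; _∨_; if_then_else_; not; T)
  open import Data.List using (List; _∷_; [])
  open import Data.Product hiding (map)
  open import Data.Sum using (inj₁; inj₂)
  open import Data.Empty using (⊥; ⊥-elim)
  open import Function using (case_of_)
  open import Relation.Nullary
  open import Relation.Binary.PropositionalEquality
  open import Relation.Binary.Definitions using (tri<; tri≈; tri>)

  -- The pairs (n, s) and degrees k that resist the uniform tests.  `slopes` gives p − 2 and two slopes
  -- A, β and A′, β′ with their breaks φ and φ′; `quadratic` gives a modulus for which g₁ has no quadratic factor.
  data Exception : Set where
    slopes    : (n s k p₂ A β φ A′ β′ φ′ : ℕ) → Exception
    quadratic : (n s k ℓ : ℕ) → Exception

  matches : ℕ → ℕ → ℕ → Exception → Bool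
  matches n s k (slopes n′ s′ k′ _ _ _ _ _ _ _) = (n ≡ᵇ n′) ∧ (s ≡ᵇ s′) ∧ (k ≡ᵇ k′)
  matches n s k (quadratic n′ s′ k′ _)          = (n ≡ᵇ n′) ∧ (s ≡ᵇ s′) ∧ (k ≡ᵇ k′)

  weightAt : ℕ → ℕ → ℕ → ℕ → ℕ → ℕ → ℕ
  weightAt p₂ n s A β i = A * (i + Profile.T p₂ s n i) + β * (n ∸ i)

  minimal′ : (ℕ → ℕ) → ℕ → ℕ → ℕ → Bool
  minimal′ U n φ u = allBelow (λ i → if i <ᵇ φ then u <ᵇ U i else u ≤ᵇ U i) (suc n)

  minimal : (ℕ → ℕ) → ℕ → ℕ → Bool
  minimal U n φ = (φ ≤ᵇ n) ∧ minimal′ U n φ (U φ)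

  -- Rises below 8 are tabulated; the last conjunct says that a rise of 8 already has slope at least
  -- b′/a′, and so has every larger one.
  noRise : ℕ → ℕ → ℕ → ℕ → ℕ → Bool
  noRise a b a′ b′ zero    = true
  noRise a b a′ b′ (suc k) = noRise a b a′ b′ k ∧ (allBelow (λ ρ → not (b * suc k ≤ᵇ a * ρ) ∨ (b′ * suc k ≤ᵇ a′ * ρ)) 8 ∧ (b′ * suc k ≤ᵇ a′ * 8))

  -- Synthetic division of g₁ by x² - b x - c modulo ℓ, from the leading coefficient down. The state
  -- holds the last two coefficients of the quotient; after n + 1 steps both entries vanish exactly
  -- when the remainder does.
  runs : ℕ → ℕ → ℕ → ℕ → ℕ → ℕ → ℕ × ℕ
  runs ℓ n s b c zero    = 0 , 0
  runs ℓ n s b c (suc m) = step (runs ℓ n s b c m)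
    where
    step : ℕ × ℕ → ℕ × ℕ
    step (x , y) = (coef n s m + b * x + c * y) mod ℓ , x

  both-zero : ℕ × ℕ → Bool
  both-zero (x , y) = (x ≡ᵇ 0) ∧ (y ≡ᵇ 0)

  valid : Exception → Bool
  valid (slopes n s k p₂ A β φ A′ β′ φ′) =
    (0 <ᵇ A) ∧ (0 <ᵇ A′) ∧ (β * A′ ≤ᵇ β′ * A) ∧ (φ + (n ∸ k) <ᵇ φ′) ∧ noRise (A * suc p₂) β (A′ * suc p₂) β′ k ∧
    minimal (weightAt p₂ n s A β) n φ ∧ minimal (weightAt p₂ n s A′ β′) n φ′ ∧ anyᵇ (suc (suc p₂) ≡ᵇ_) primes
  valid (quadratic n s k ℓ) =
    (0 <ᵇ ℓ) ∧ ((k ≡ᵇ 2) ∨ (n ∸ k ≡ᵇ 2)) ∧ allBelow (λ b → allBelow (λ c → not (both-zero (runs ℓ n s b c (suc n)))) ℓ) ℓ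

  -- The entries are certificates: `valid` recomputes every minimum and every division. In the two
  -- quadratic entries with n = 3 it is the cofactor of the linear factor that is quadratic.
  exceptions : List Exception
  exceptions =
    slopes 3 15 1 0 3 5 0 1 2 3 ∷ slopes 15 15 1 1 9 8 0 1 2 15 ∷ slopes 45 15 1 1 9 8 0 1 2 45 ∷
    slopes 225 35 1 1 9 8 0 1 2 225 ∷ slopes 21 35 1 5 7 6 0 1 6 21 ∷ slopes 945 35 1 1 27 26 0 1 2 945 ∷
    slopes 9 48 1 1 9 10 0 1 2 9 ∷ slopes 225 55 1 1 9 8 0 1 2 225 ∷ slopes 27 63 1 0 24 25 0 1 2 27 ∷
    slopes 189 63 1 1 81 80 0 1 2 189 ∷ slopes 1323 63 1 1 81 80 0 1 2 1323 ∷ slopes 45 65 1 1 9 8 0 1 2 45 ∷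
    slopes 3 80 1 1 3 8 0 1 4 3 ∷ slopes 9 80 1 1 3 4 0 1 2 9 ∷ slopes 45 80 1 1 45 46 0 1 2 45 ∷
    slopes 75 80 1 1 1 1 0 1 2 75 ∷ slopes 225 80 1 1 81 80 0 1 2 225 ∷ slopes 675 80 1 1 81 80 0 1 2 675 ∷
    slopes 1377 85 1 1 81 80 0 1 2 1377 ∷ slopes 45 10 2 3 5 4 0 1 2 45 ∷ slopes 8 13 2 5 7 6 0 1 3 7 ∷
    slopes 6 14 2 0 5 6 1 2 3 6 ∷ slopes 18 16 2 15 17 16 0 1 8 17 ∷ slopes 16 19 2 3 5 4 0 1 2 15 ∷
    slopes 9 19 2 0 8 7 0 1 1 8 ∷ slopes 36 20 2 3 25 24 1 1 2 36 ∷ slopes 24 22 2 21 23 22 0 1 11 23 ∷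
    slopes 231 22 2 5 7 6 0 1 3 231 ∷ slopes 4 23 2 1 3 2 0 1 1 3 ∷ slopes 9 23 2 0 8 7 0 1 1 8 ∷
    slopes 16 24 2 1 15 16 1 1 2 16 ∷ slopes 9 26 2 1 9 10 0 1 2 9 ∷ slopes 16 34 2 0 16 15 0 1 1 16 ∷
    slopes 225 35 2 3 25 24 0 1 2 225 ∷ slopes 12 43 2 9 11 10 0 1 5 11 ∷ slopes 48 46 2 45 47 46 0 1 23 47 ∷
    slopes 4 47 2 0 4 5 0 2 3 4 ∷ slopes 8 48 2 0 8 7 0 1 1 8 ∷ slopes 9 48 2 0 8 7 1 1 1 9 ∷
    slopes 54 52 2 51 53 52 0 1 26 53 ∷ slopes 8 62 2 0 4 5 0 2 3 8 ∷ slopes 2145 66 2 3 5 4 0 1 2 2145 ∷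
    slopes 24 68 2 0 8 7 0 1 1 24 ∷ slopes 72 70 2 69 71 70 0 1 35 71 ∷ slopes 16 79 2 0 16 15 0 1 1 16 ∷
    slopes 6 79 2 0 6 7 0 2 3 6 ∷ slopes 3321 82 2 3 5 4 1 1 2 3321 ∷ slopes 8 13 3 5 7 6 0 1 2 7 ∷
    slopes 9 13 3 1 9 8 0 1 1 9 ∷ slopes 36 15 3 1 9 8 0 1 1 36 ∷ slopes 16 19 3 3 5 4 0 3 4 15 ∷
    slopes 18 33 3 0 16 15 2 1 1 18 ∷ slopes 16 47 3 0 16 15 0 1 1 16 ∷ slopes 6 47 3 0 6 7 0 3 4 6 ∷
    slopes 9 47 3 5 7 12 1 1 2 8 ∷ slopes 10 47 3 3 5 6 0 3 4 10 ∷ slopes 100 54 3 1 9 8 1 1 1 100 ∷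
    slopes 16 62 3 0 16 17 0 3 4 16 ∷ slopes 16 62 4 0 16 17 0 4 5 16 ∷ quadratic 3 26 1 5 ∷
    quadratic 3 53 1 13 ∷ quadratic 9 47 2 19 ∷ []

  exceptions-valid : allᵇ valid exceptions ≡ true
  exceptions-valid = refl

  excepted : ℕ → ℕ → ℕ → Bool
  excepted n s k = anyᵇ (matches n s k) exceptions

  noRise-sound : ∀ a b a′ b′ k → noRise a b a′ b′ k ≡ true → ∀ d ρ → 1 ≤ d → d ≤ k → b * d ≤ a * ρ → a′ * ρ < b′ * d → ⊥
  noRise-sound a b a′ b′ zero    t d ρ 1≤d d≤0 = ⊥-elim (<⇒≱ 1≤d d≤0)
  noRise-sound a b a′ b′ (suc k) t d ρ 1≤d d≤k le lt with ∧-split (noRise a b a′ b′ k) t | d ≟ suc k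
  ... | low , _ | no d≢ = noRise-sound a b a′ b′ k low d ρ 1≤d (≤-pred (≤∧≢⇒< d≤k d≢)) le lt
  ... | _ , top | yes refl with ∧-split (allBelow (λ ρ → not (b * suc k ≤ᵇ a * ρ) ∨ (b′ * suc k ≤ᵇ a′ * ρ)) 8) top | ρ <? 8
  ...   | _ , big | no ρ≮8 = <⇒≱ lt (≤-trans (≤ᵇ-sound big) (*-monoʳ-≤ a′ (≮⇒≥ ρ≮8)))
  ...   | table , _ | yes ρ<8 with ∨-split (not (b * suc k ≤ᵇ a * ρ)) (below-sound (λ ρ → not (b * suc k ≤ᵇ a * ρ) ∨ (b′ * suc k ≤ᵇ a′ * ρ)) 8 table ρ ρ<8)
  ...     | inj₁ x = not-sound x (≤ᵇ-true le)
  ...     | inj₂ x = <⇒≱ lt (≤ᵇ-sound x)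

  minimal-sound : ∀ U n φ → minimal U n φ ≡ true → φ ≤ n × (∀ i → i ≤ n → U φ ≤ U i × (i < φ → U φ < U i))
  minimal-sound U n φ t with ∧-split (φ ≤ᵇ n) t
  ... | le , mn = ≤ᵇ-sound le , λ i i≤n → at i (below-sound _ (suc n) mn i (s≤s i≤n))
    where
    at : ∀ i → (if i <ᵇ φ then U φ <ᵇ U i else U φ ≤ᵇ U i) ≡ true → U φ ≤ U i × (i < φ → U φ < U i)
    at i t with i <ᵇ φ in eq
    ... | true  = <⇒≤ (<ᵇ-sound {U φ} t) , λ _ → <ᵇ-sound t
    ... | false = ≤ᵇ-sound t , λ lt → ⊥-elim (false≢true (trans (sym eq) (<ᵇ-true lt)))

  slopes-sound : ∀ {n s k} p₂ A β φ A′ β′ φ′ → Factors n s k → valid (slopes n s k p₂ A β φ A′ β′ φ′) ≡ true → ⊥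
  slopes-sound {n} {s} {k} p₂ A β φ A′ β′ φ′ fac t
    with ∧-split (0 <ᵇ A) t
  ... | A>0 , t₁ with ∧-split (0 <ᵇ A′) t₁
  ... | A′>0 , t₂ with ∧-split (β * A′ ≤ᵇ β′ * A) t₂
  ... | order , t₃ with ∧-split (φ + (n ∸ k) <ᵇ φ′) t₃
  ... | long , t₄ with ∧-split (noRise (A * suc p₂) β (A′ * suc p₂) β′ k) t₄
  ... | rise , t₅ with ∧-split (minimal (weightAt p₂ n s A β) n φ) t₅
  ... | mn , t₆ with ∧-split (minimal (weightAt p₂ n s A′ β′) n φ′) t₆
  ... | mn′ , t₇ = <⇒≱ (<ᵇ-sound long) (Cr.two-slopes A β A′ β′ {{A≢0}} {{A′≢0}} φ φ′ (proj₁ M) (proj₁ M′)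
        (L.Slope.break A β {{A≢0}} φ (proj₁ M) (proj₂ M)) (L.Slope.break A′ β′ {{A′≢0}} φ′ (proj₁ M′) (proj₂ M′))
        (≤ᵇ-sound order) (noRise-sound (A * suc p₂) β (A′ * suc p₂) β′ k rise))
    where
    pp : Prime (suc (suc p₂))
    pp = let q , q∈ , e = any-sound (suc (suc p₂) ≡ᵇ_) primes t₇ in subst Prime (sym (≡ᵇ-sound {suc (suc p₂)} e)) (primes-prime q∈)
    module Cr = Criteria p₂ pp fac
    module L = Local p₂ pp fac
    A≢0 : NonZero A
    A≢0 = >-nonZero (<ᵇ-sound {0} A>0)
    A′≢0 : NonZero A′
    A′≢0 = >-nonZero (<ᵇ-sound {0} A′>0)
    M = minimal-sound (weightAt p₂ n s A β) n φ mn
    M′ = minimal-sound (weightAt p₂ n s A′ β′) n φ′ mn′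

  -- Gauss's lemma: g₁ is monic, so the leading coefficient of f has minimal valuation at every prime.
  leading-∣ : ∀ {n s k} (fac : Factors n s k) → let open Factors fac in ∀ j → ∣ F k ∣ ∣ ∣ F j ∣
  leading-∣ {n} {s} {k} fac j with F j ℤ.≟ 0ℤ
    where open Factors fac
  ... | yes z = subst (λ u → ∣ Factors.F fac k ∣ ∣ ∣ u ∣) (sym z) (∣ Factors.F fac k ∣ ∣0)
  ... | no Fj≢0 = local-∣ _ _ (λ e → F-top (ℤ.∣i∣≡0⇒i≡0 e)) go
    where
    open Factors fac
    go : ∀ p e → Prime p → p ^ e ∣ ∣ F k ∣ → p ^ e ∣ ∣ F j ∣
    go p e pp d with prime≥2 pp
    ... | two+ p₂ = L.ν-∣ (L.abs≢0 Fj≢0) (≤-trans (L.∣-ν {e} (L.abs≢0 F-top) d) ν≤)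
      where
      module L = Local p₂ pp fac
      -- At slope 0 the leading coefficient of the monic g₁ gives the break φ = 0. Then X + Y = n
      -- forces X = k, so the leading coefficient of f has the least valuation.
      module W = L.Slope 1 0
      least : ∀ i → i ≤ n → L.U 1 0 0 ≤ L.U 1 0 i × (i < 0 → L.U 1 0 0 < L.U 1 0 i)
      least i i≤n = subst₂ _≤_ (sym (simp 0 (L.T n 0))) (sym (simp i (L.T n i))) (≤-trans (≤-reflexive T0) Sn≤) , λ ()
        where
        simp : ∀ i t → 1 * (i + t) + 0 ≡ i + t
        simp i t = trans (+-identityʳ _) (*-identityˡ (i + t))
        T0 : L.T n 0 ≡ L.S n
        T0 = trans (cong (L.S n +_) (trans (cong (λ z → L.S s + 0 ∸ L.S z) (+-identityʳ s)) (trans (cong (_∸ L.S s) (+-identityʳ (L.S s))) (n∸n≡0 (L.S s))))) (+-identityʳ (L.S n))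
        Sn≤ : L.S n ≤ i + L.T n i
        Sn≤ = ≤-trans (subst (λ z → L.S z ≤ L.S i + L.S (n ∸ i)) (m+[n∸m]≡n i≤n) (L.S-sub i (n ∸ i))) (+-mono-≤ (L.S≤id i) (m≤m+n (L.S (n ∸ i)) (L.κ i)))
      B = W.break 0 z≤n least
      module B = W.Break B
      X≡k : B.X ≡ k
      X≡k = ≤-antisym B.X≤k (+-cancelʳ-≤ (n ∸ k) _ _ (≤-trans (≤-reflexive (trans (m+[n∸m]≡n k≤n) (sym B.X+Y))) (+-monoʳ-≤ B.X B.Y≤)))
      ν≤ : L.νℤ (F k) ≤ L.νℤ (F j)
      ν≤ = *-cancelˡ-≤ (1 * suc p₂) {{m*n≢0 1 (suc p₂)}} (subst₂ _≤_ (+-identityʳ _) (+-identityʳ _) (subst (λ z → W.w F z ≤ W.w F j) X≡k (W.Arg.least B.argF j Fj≢0)))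

  module Quadratic {n s : ℕ} (fac : Factors n s 2) where
    open Factors fac

    f : ℕ → ℤ
    f j = ℤᵈ._∣_.quotient (ℤᵈ.∣ᵤ⇒∣ {F 2} {F j} (leading-∣ fac j))

    f-eq : ∀ j → F j ≡ f j ℤ.* F 2
    f-eq j = ℤᵈ._∣_.equality (ℤᵈ.∣ᵤ⇒∣ {F 2} {F j} (leading-∣ fac j))

    top = H (n ∸ 2)

    h : ℕ → ℤ
    h j = ℤᵈ._∣_.quotient (ℤᵈ.∣ᵤ⇒∣ {top} {H j} (leading-∣ (swap-factors fac) j))

    h-eq : ∀ j → H j ≡ h j ℤ.* top
    h-eq j = ℤᵈ._∣_.equality (ℤᵈ.∣ᵤ⇒∣ {top} {H j} (leading-∣ (swap-factors fac) j))

    -- With `kh j` standing for h (j - 2) the recurrence of the division runs down to j = 1 and j =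
    -- 0, where the value 0 expresses that the remainder vanishes.
    shift : (ℕ → ℤ) → ℕ → ℤ
    shift z (suc (suc m)) = z m
    shift z _             = 0ℤ

    three : ∀ j → conv F H j ≡ F 0 ℤ.* shift H (suc (suc j)) ℤ.+ F 1 ℤ.* shift H (suc j) ℤ.+ F 2 ℤ.* shift H j
    three zero          = arr (F 0) (H 0) (F 1) (F 2)
      where
      arr : ∀ a x b c → a ℤ.* x ≡ a ℤ.* x ℤ.+ b ℤ.* 0ℤ ℤ.+ c ℤ.* 0ℤ
      arr = ℤR.solve-∀
    three (suc zero)    = arr (F 0 ℤ.* H 1 ℤ.+ F 1 ℤ.* H 0) (F 2)
      where
      arr : ∀ a c → a ≡ a ℤ.+ c ℤ.* 0ℤ
      arr = ℤR.solve-∀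
    three (suc (suc j)) = go j
      where
      go : ∀ l → convTo F H (suc (suc j)) (suc (suc l)) ≡ F 0 ℤ.* H (suc (suc j)) ℤ.+ F 1 ℤ.* H (suc j) ℤ.+ F 2 ℤ.* H j
      go zero    = refl
      go (suc l) = trans (cong₂ ℤ._+_ (go l) (trans (cong (ℤ._* H (j ∸ suc l)) (F-deg (suc (suc (suc l))) (s≤s (s≤s (s≤s z≤n))))) (ℤ.*-zeroˡ (H (j ∸ suc l))))) (ℤ.+-identityʳ _)

    kh : ℕ → ℤ
    kh = shift h

    shift-eq : ∀ m → shift H m ≡ kh m ℤ.* top
    shift-eq zero          = sym (ℤ.*-zeroˡ top)
    shift-eq (suc zero)    = sym (ℤ.*-zeroˡ top)
    shift-eq (suc (suc m)) = h-eq m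

    cancel : ∀ a b c → c ≢ 0ℤ → a ℤ.* c ≡ b ℤ.* c → a ≡ b
    cancel a b c c≢0 e = ℤ.*-cancelʳ-≡ a b c {{ℤ.≢-nonZero c≢0}} e

    f2 : f 2 ≡ 1ℤ
    f2 = cancel (f 2) 1ℤ (F 2) F-top (trans (sym (f-eq 2)) (sym (ℤ.*-identityˡ (F 2))))

    D≡ : D ≡ F 2 ℤ.* top
    D≡ = trans (trans (sym (ℤ.*-identityʳ D)) (sym (conv-coef fac 0 n refl))) (conv-single F H n n 2 k≤n outside)
      where
      outside : ∀ i → i ≤ n → i ≢ 2 → F i ℤ.* H (n ∸ i) ≡ 0ℤ
      outside i i≤n i≢2 with <-cmp i 2
      ... | tri≈ _ e _ = ⊥-elim (i≢2 e)
      ... | tri> _ _ 2<i = trans (cong (ℤ._* H (n ∸ i)) (F-deg i 2<i)) (ℤ.*-zeroˡ (H (n ∸ i)))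
      ... | tri< i<2 _ _ = trans (cong (F i ℤ.*_) (H-deg (n ∸ i) (∸-monoʳ-< i<2 k≤n))) (ℤ.*-zeroʳ (F i))

    -- The coefficient of x^j in g₁ = (x² + f₁ x + f₀) h, solved for the coefficient of h with the
    -- lowest index.
    recurrence : ∀ i j → i + j ≡ n → kh j ≡ ℤ.+ coef n s i ℤ.+ (ℤ.- f 1) ℤ.* kh (suc j) ℤ.+ (ℤ.- f 0) ℤ.* kh (suc (suc j))
    recurrence i j e = trans (arr₂ (f 0) (f 1) (kh j) (kh (suc j)) (kh (suc (suc j))))
      (cong (λ z → z ℤ.+ (ℤ.- f 1) ℤ.* kh (suc j) ℤ.+ (ℤ.- f 0) ℤ.* kh (suc (suc j))) total)
      where
      K₀ = kh j
      K₁ = kh (suc j)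
      K₂ = kh (suc (suc j))
      arr₂ : ∀ a b x y z → x ≡ (a ℤ.* z ℤ.+ b ℤ.* y ℤ.+ 1ℤ ℤ.* x) ℤ.+ (ℤ.- b) ℤ.* y ℤ.+ (ℤ.- a) ℤ.* z
      arr₂ = ℤR.solve-∀
      arr₃ : ∀ a b c t u x y z → a ℤ.* t ℤ.* (z ℤ.* u) ℤ.+ b ℤ.* t ℤ.* (y ℤ.* u) ℤ.+ c ℤ.* t ℤ.* (x ℤ.* u) ≡ (a ℤ.* z ℤ.+ b ℤ.* y ℤ.+ c ℤ.* x) ℤ.* (t ℤ.* u)
      arr₃ = ℤR.solve-∀
      total : f 0 ℤ.* K₂ ℤ.+ f 1 ℤ.* K₁ ℤ.+ 1ℤ ℤ.* K₀ ≡ ℤ.+ coef n s i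
      total = cancel _ _ D D≢0 (begin
        (f 0 ℤ.* K₂ ℤ.+ f 1 ℤ.* K₁ ℤ.+ 1ℤ ℤ.* K₀) ℤ.* D
          ≡⟨ cong₂ (λ u v → (f 0 ℤ.* K₂ ℤ.+ f 1 ℤ.* K₁ ℤ.+ u ℤ.* K₀) ℤ.* v) (sym f2) D≡ ⟩
        (f 0 ℤ.* K₂ ℤ.+ f 1 ℤ.* K₁ ℤ.+ f 2 ℤ.* K₀) ℤ.* (F 2 ℤ.* top)
          ≡⟨ arr₃ (f 0) (f 1) (f 2) (F 2) top K₀ K₁ K₂ ⟨
        f 0 ℤ.* F 2 ℤ.* (K₂ ℤ.* top) ℤ.+ f 1 ℤ.* F 2 ℤ.* (K₁ ℤ.* top) ℤ.+ f 2 ℤ.* F 2 ℤ.* (K₀ ℤ.* top)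
          ≡⟨ cong₂ ℤ._+_ (cong₂ ℤ._+_ (cong₂ ℤ._*_ (f-eq 0) (shift-eq (suc (suc j)))) (cong₂ ℤ._*_ (f-eq 1) (shift-eq (suc j)))) (cong₂ ℤ._*_ (f-eq 2) (shift-eq j)) ⟨
        F 0 ℤ.* shift H (suc (suc j)) ℤ.+ F 1 ℤ.* shift H (suc j) ℤ.+ F 2 ℤ.* shift H j
          ≡⟨ three j ⟨
        conv F H j              ≡⟨ conv-coef fac i j e ⟩
        D ℤ.* ℤ.+ coef n s i    ≡⟨ ℤ.*-comm D (ℤ.+ coef n s i) ⟩
        ℤ.+ coef n s i ℤ.* D    ∎)
        where open ≡-Reasoning

    h-zero : ∀ j → H j ≡ 0ℤ → h j ≡ 0ℤ
    h-zero j z = cancel (h j) 0ℤ top H-top (trans (sym (h-eq j)) (trans z (sym (ℤ.*-zeroˡ top))))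

    kh-top : kh (suc n) ≡ 0ℤ × kh (suc (suc n)) ≡ 0ℤ
    kh-top = go n k≤n refl , h-zero n (H-deg n (∸-monoʳ-< {n} {2} {0} (s≤s z≤n) k≤n))
      where
      go : ∀ m → 2 ≤ m → m ≡ n → kh (suc m) ≡ 0ℤ
      go (suc m) _ e = h-zero m (H-deg m (subst (λ z → z ∸ 2 < m) e (below m e)))
        where
        below : ∀ m → suc m ≡ n → suc m ∸ 2 < m
        below zero    e₀ = ⊥-elim (<⇒≱ (s≤s (s≤s z≤n)) (subst (2 ≤_) (sym e₀) k≤n))
        below (suc m) _  = ≤-refl

    module Mod (ℓ₁ : ℕ) where
      ℓ = suc ℓ₁

      _≈_ : ℤ → ℕ → Set
      z ≈ x = ℤ.+ ℓ ℤᵈ.∣ (z ℤ.- ℤ.+ x)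

      residue-of : ∀ z → ∃ λ x → x < ℓ × z ≈ x
      residue-of z = z ℤ.%ℕ ℓ , ℤ.n%ℕd<d z ℓ , ℤᵈ.divides (z ℤ./ℕ ℓ) (trans (cong (ℤ._- ℤ.+ (z ℤ.%ℕ ℓ)) (ℤ.a≡a%ℕn+[a/ℕn]*n z ℓ)) (arr (ℤ.+ (z ℤ.%ℕ ℓ)) (z ℤ./ℕ ℓ ℤ.* ℤ.+ ℓ)))
        where
        arr : ∀ r q → (r ℤ.+ q) ℤ.- r ≡ q
        arr = ℤR.solve-∀

      ≈-mod : ∀ {z} x → z ≈ x → z ≈ (x mod ℓ)
      ≈-mod {z} x (ℤᵈ.divides q e) = ℤᵈ.divides (q ℤ.+ ℤ.+ (x / ℓ)) (trans (arr z (ℤ.+ x) (ℤ.+ (x % ℓ)))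
        (trans (cong₂ ℤ._+_ e (trans (cong (λ t → ℤ.+ t ℤ.- ℤ.+ (x % ℓ)) (m≡m%n+[m/n]*n x ℓ)) (trans (cong (ℤ._- ℤ.+ (x % ℓ)) (trans (ℤ.pos-+ (x % ℓ) (x / ℓ * ℓ)) (cong (λ w → ℤ.+ (x % ℓ) ℤ.+ w) (ℤ.pos-* (x / ℓ) ℓ)))) (arr₂ (ℤ.+ (x % ℓ)) (ℤ.+ (x / ℓ) ℤ.* ℤ.+ ℓ)))))
          (sym (ℤ.*-distribʳ-+ (ℤ.+ ℓ) q (ℤ.+ (x / ℓ))))))
        where
        arr : ∀ z x r → z ℤ.- r ≡ (z ℤ.- x) ℤ.+ (x ℤ.- r)
        arr = ℤR.solve-∀
        arr₂ : ∀ r q → (r ℤ.+ q) ℤ.- r ≡ q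
        arr₂ = ℤR.solve-∀

      ≈-lin : ∀ a {b x y z b′ x′ y′ z′} → b ≈ b′ → x ≈ x′ → y ≈ y′ → z ≈ z′ → (ℤ.+ a ℤ.+ b ℤ.* x ℤ.+ y ℤ.* z) ≈ (a + b′ * x′ + y′ * z′)
      ≈-lin a {b} {x} {y} {z} {b′} {x′} {y′} {z′} (ℤᵈ.divides p e₁) (ℤᵈ.divides q e₂) (ℤᵈ.divides r e₃) (ℤᵈ.divides t e₄) =
        ℤᵈ.divides (p ℤ.* x ℤ.+ ℤ.+ b′ ℤ.* q ℤ.+ r ℤ.* z ℤ.+ ℤ.+ y′ ℤ.* t)
          (trans (cong (λ w → (ℤ.+ a ℤ.+ b ℤ.* x ℤ.+ y ℤ.* z) ℤ.- w) (trans (ℤ.pos-+ (a + b′ * x′) (y′ * z′)) (cong₂ ℤ._+_ (trans (ℤ.pos-+ a (b′ * x′)) (cong (λ w → ℤ.+ a ℤ.+ w) (ℤ.pos-* b′ x′))) (ℤ.pos-* y′ z′))))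
          (trans (arr (ℤ.+ a) b x y z (ℤ.+ b′) (ℤ.+ x′) (ℤ.+ y′) (ℤ.+ z′))
          (trans (cong₂ ℤ._+_ (cong₂ ℤ._+_ (cong₂ (λ u v → u ℤ.* x ℤ.+ ℤ.+ b′ ℤ.* v) e₁ e₂) (cong (ℤ._* z) e₃)) (cong (ℤ.+ y′ ℤ.*_) e₄))
            (arr₂ p q r t x z (ℤ.+ b′) (ℤ.+ y′) (ℤ.+ ℓ)))))
        where
        arr : ∀ a b x y z b′ x′ y′ z′ → (a ℤ.+ b ℤ.* x ℤ.+ y ℤ.* z) ℤ.- (a ℤ.+ b′ ℤ.* x′ ℤ.+ y′ ℤ.* z′) ≡ (b ℤ.- b′) ℤ.* x ℤ.+ b′ ℤ.* (x ℤ.- x′) ℤ.+ (y ℤ.- y′) ℤ.* z ℤ.+ y′ ℤ.* (z ℤ.- z′)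
        arr = ℤR.solve-∀
        arr₂ : ∀ p q r t x z b y l → (p ℤ.* l) ℤ.* x ℤ.+ b ℤ.* (q ℤ.* l) ℤ.+ (r ℤ.* l) ℤ.* z ℤ.+ y ℤ.* (t ℤ.* l) ≡ (p ℤ.* x ℤ.+ b ℤ.* q ℤ.+ r ℤ.* z ℤ.+ y ℤ.* t) ℤ.* l
        arr₂ = ℤR.solve-∀

      ≈-zero : ∀ {z} x → x < ℓ → z ≡ 0ℤ → z ≈ x → x ≡ 0
      ≈-zero x x<ℓ refl d with ℤᵈ.∣⇒∣ᵤ {ℤ.+ ℓ} d
      ... | d′ = n<1⇒n≡0′ x x<ℓ (subst (ℓ ∣_) (trans (cong ∣_∣ (ℤ.+-identityˡ (ℤ.- ℤ.+ x))) (ℤ.∣-i∣≡∣i∣ (ℤ.+ x))) d′)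
        where
        n<1⇒n≡0′ : ∀ x → x < ℓ → ℓ ∣ x → x ≡ 0
        n<1⇒n≡0′ zero    _ _ = refl
        n<1⇒n≡0′ (suc x) lt d = ⊥-elim (<⇒≱ lt (∣⇒≤ d))

      runs-sound : ∀ b c → (ℤ.- f 1) ≈ b → (ℤ.- f 0) ≈ c → ∀ m j → m + j ≡ suc n →
        kh j ≈ proj₁ (runs ℓ n s b c m) × kh (suc j) ≈ proj₂ (runs ℓ n s b c m) × proj₁ (runs ℓ n s b c m) < ℓ × proj₂ (runs ℓ n s b c m) < ℓ
      runs-sound b c b≈ c≈ zero j refl = zero≈ (proj₁ kh-top) , zero≈ (proj₂ kh-top) , s≤s z≤n , s≤s z≤n
        where
        zero≈ : ∀ {z} → z ≡ 0ℤ → z ≈ 0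
        zero≈ refl = ℤᵈ.divides 0ℤ (sym (ℤ.*-zeroˡ (ℤ.+ ℓ)))
      runs-sound b c b≈ c≈ (suc m) j e with runs-sound b c b≈ c≈ m (suc j) (trans (+-suc m j) e)
      ... | x≈ , y≈ , x< , y< = ≈-mod {kh j} t (subst (λ z → z ≈ t) (sym (recurrence m j (suc-injective e)))
            (≈-lin (coef n s m) {ℤ.- f 1} {kh (suc j)} {ℤ.- f 0} {kh (suc (suc j))} {b} {x} {c} {y} b≈ x≈ c≈ y≈)) , x≈ , m%n<n t ℓ , x<
        where
        x = proj₁ (runs ℓ n s b c m)
        y = proj₂ (runs ℓ n s b c m)
        t = coef n s m + b * x + c * y

      survives : ℕ → ℕ → Bool
      survives b c = not (both-zero (runs ℓ n s b c (suc n)))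

      no-factor : allBelow (λ b → allBelow (survives b) ℓ) ℓ ≡ true → ⊥
      no-factor t = go (residue-of (ℤ.- f 1)) (residue-of (ℤ.- f 0))
        where
        go : (∃ λ b → b < ℓ × (ℤ.- f 1) ≈ b) → (∃ λ c → c < ℓ × (ℤ.- f 0) ≈ c) → ⊥
        go (b , b< , b≈) (c , c< , c≈) = not-sound {both-zero (runs ℓ n s b c (suc n))}
          (below-sound (survives b) ℓ (below-sound (λ b → allBelow (survives b) ℓ) ℓ t b b<) c c<)
          (cong₂ _∧_ (cong (_≡ᵇ 0) (≈-zero {kh 0} x (proj₁ (proj₂ (proj₂ r))) refl (proj₁ r)))
                     (cong (_≡ᵇ 0) (≈-zero {kh 1} y (proj₂ (proj₂ (proj₂ r))) refl (proj₁ (proj₂ r)))))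
          where
          r = runs-sound b c b≈ c≈ (suc n) 0 (+-identityʳ (suc n))
          x = proj₁ (runs ℓ n s b c (suc n))
          y = proj₂ (runs ℓ n s b c (suc n))

  quadratic-sound : ∀ {n s k} ℓ → Factors n s k → valid (quadratic n s k ℓ) ≡ true → ⊥
  quadratic-sound {n} {s} {k} zero fac ()
  quadratic-sound {n} {s} {k} (suc ℓ₁) fac t with ∧-split ((k ≡ᵇ 2) ∨ (n ∸ k ≡ᵇ 2)) t
  ... | degree , none with ∨-split (k ≡ᵇ 2) degree
  ...   | inj₁ k2 = Quadratic.Mod.no-factor (subst (Factors n s) (≡ᵇ-sound {k} k2) fac) ℓ₁ none
  ...   | inj₂ k2 = Quadratic.Mod.no-factor (subst (Factors n s) (≡ᵇ-sound {n ∸ k} k2) (swap-factors fac)) ℓ₁ none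

  same : ∀ {n s k n′ s′ k′} → ((n ≡ᵇ n′) ∧ (s ≡ᵇ s′) ∧ (k ≡ᵇ k′)) ≡ true → Factors n s k → Factors n′ s′ k′
  same {n} {s} {k} {n′} {s′} {k′} m fac = let a , bc = ∧-split (n ≡ᵇ n′) m ; b , c = ∧-split (s ≡ᵇ s′) bc in
    subst (λ n → Factors n s′ k′) (≡ᵇ-sound {n} a) (subst (λ s → Factors n s k′) (≡ᵇ-sound {s} b) (subst (Factors n s) (≡ᵇ-sound {k} c) fac))

  exception-sound : ∀ {n s k} → Factors n s k → ∀ e → matches n s k e ≡ true → valid e ≡ true → ⊥
  exception-sound fac (slopes n′ s′ k′ p₂ A β φ A′ β′ φ′) m v = slopes-sound p₂ A β φ A′ β′ φ′ (same m fac) v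
  exception-sound fac (quadratic n′ s′ k′ ℓ) m v = quadratic-sound ℓ (same m fac) v

  excepted-sound : ∀ {n s k} → Factors n s k → ∀ es → allᵇ valid es ≡ true → anyᵇ (matches n s k) es ≡ true → ⊥
  excepted-sound {n} {s} {k} fac es v t with any-sound (matches n s k) es t
  ... | e , e∈ , m = exception-sound fac e m (all-sound valid es v e∈)

-- Running the searches and assembling irreducibility.

open import Data.Rational using () renaming (_*_ to _*ℚ_)
open DigitSums
open Valuations
open DumasLemma
open CoefficientProfile
open Factorisations
open SlopeCriteria
open Search
open SearchLemmas
open DegreeConstraints
open SearchSoundness
open Exceptions
open LinearFactors using (no-linear-factor)
open ClearingDenominators
import Data.Integer as ℤ
import Data.Integer.Properties as ℤ
import Data.Rational.Properties as ℚ
open import Data.Nat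
open import Data.Nat.Properties
open import Data.Nat.DivMod hiding (_mod_)
open import Data.Nat.Divisibility
open import Data.Nat.Primality
open import Data.Bool using (true)
open import Data.Product hiding (map)
open import Data.Sum using ([_,_]′)
open import Data.Empty using (⊥)
open import Relation.Nullary
open import Relation.Binary.PropositionalEquality

-- Eighty values of s, from 9 to 88; 200 is fuel for the halving and descent of the bound.
small-1 : allS 80 9 (λ s → small 200 excepted s 1 primes (primesUpTo (s + 1))) ≡ true
small-1 = refl

small-2 : allS 80 9 (λ s → small 200 excepted s 2 primes (primesUpTo (s + 2))) ≡ true
small-2 = refl

small-3 : allS 80 9 (λ s → small 200 excepted s 3 primes (primesUpTo (s + 3))) ≡ true
small-3 = refl

small-4 : allS 80 9 (λ s → small 200 excepted s 4 primes (primesUpTo (s + 4))) ≡ true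
small-4 = refl

small-5 : allS 80 9 (λ s → small 200 excepted s 5 primes (primesUpTo (s + 5))) ≡ true
small-5 = refl

-- The 181 degrees from 6 to 186, each for all eighty values of s at once. No exceptional pairs
-- occur in this range.
large-6-186 : allS 181 6 (λ k → large 400 80 9 (bigL 88) k primes (primesUpTo (88 + k))) ≡ true
large-6-186 = refl

exceeds-187 : exceedsᵇ (bigL 88) 187 ≡ true
exceeds-187 = refl

module _ {n s : ℕ} (9≤s : 9 ≤ s) (s≤88 : s ≤ 88) where

  no-small-factor : ∀ k → 1 ≤ k → k ≤ 5 → k + k ≤ n → Factors n s k → (k ≡ 1 → ¬ 2 ∣ n) →
    allS 80 9 (λ s → small 200 excepted s k primes (primesUpTo (s + k))) ≡ true → ⊥
  no-small-factor k 1≤k k≤5 2k≤n fac odd check = excepted-sound fac exceptions exceptions-valid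
    (Bounds.SmallSound.small-sound fac 1≤k 2k≤n 200 excepted primes (primesUpTo (s + k)) primes-prime (λ pp le → upTo-∈ pp le x<) (λ {p} → upTo-prime {p} {s + k})
      -- Here k ≤ 5 ≤ 9 ≤ s, so prime powers dividing n are bounded by s.
      (≤-trans k≤5 (≤-trans (m≤m+n 5 4) 9≤s)) odd
      (allS-sound 80 9 (λ s → small 200 excepted s k primes (primesUpTo (s + k))) check s 9≤s (s≤s s≤88)))
    where
    x< : s + k < 275
    x< = s≤s (≤-trans (+-mono-≤ s≤88 k≤5) (m≤m+n 93 181))

  no-large-factor : ∀ k → 6 ≤ k → k + k ≤ n → Factors n s k → ⊥
  no-large-factor k 6≤k 2k≤n fac with k ≤? 186
  ... | no k≰ = <⇒≱ (exceeds-from (bigL 88) 187 k (m≤m+n 89 98) exceeds-187 (≰⇒> k≰)) (≤-trans (fall-mono k 2k≤n) fall≤)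
    where
    fall≤ : fall n k ≤ bigL 88 * fall (k + 88) k
    fall≤ = Bounds.fall-≤-88 fac (≤-trans (s≤s z≤n) 6≤k) 2k≤n s≤88 (primesUpTo 88) (λ pp le → upTo-∈ pp le (m≤m+n 89 186)) (λ {p} → upTo-prime {p} {88})
  ... | yes k≤186 = Bounds.LargeSound.large-sound fac (≤-trans (s≤s z≤n) 6≤k) 2k≤n 400 80 9 (bigL 88) primes (primesUpTo (88 + k)) primes-prime
      (λ pp le → upTo-∈ pp le (s≤s (+-monoʳ-≤ 88 k≤186))) (λ {p} → upTo-prime {p} {88 + k}) 9≤s (s≤s s≤88) s≤88
      (Bounds.fall-≤-88 fac (≤-trans (s≤s z≤n) 6≤k) 2k≤n s≤88 (primesUpTo 88) (λ pp le → upTo-∈ pp le (m≤m+n 89 186)) (λ {p} → upTo-prime {p} {88}))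
      (allS-sound 181 6 (λ k → large 400 80 9 (bigL 88) k primes (primesUpTo (88 + k))) large-6-186 k 6≤k (s≤s k≤186))

  no-factor : ∀ k → 1 ≤ k → k + k ≤ n → Factors n s k → ⊥
  no-factor 1 _ 2k≤n fac with 2 ∣? n
  ... | yes (divides m e) = no-linear-factor m (n≢0⇒n>0 λ { refl → <⇒≱ (s≤s z≤n) (subst (2 ≤_) e 2k≤n) })
          (subst (λ z → Factors z s 1) (trans e (trans (*-comm m 2) (cong (m +_) (+-identityʳ m)))) fac)
  ... | no  odd = no-small-factor 1 (s≤s z≤n) (m≤m+n 1 4) 2k≤n fac (λ _ → odd) small-1
  no-factor 2 _ 2k≤n fac = no-small-factor 2 (s≤s z≤n) (m≤m+n 2 3) 2k≤n fac (λ ()) small-2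
  no-factor 3 _ 2k≤n fac = no-small-factor 3 (s≤s z≤n) (m≤m+n 3 2) 2k≤n fac (λ ()) small-3
  no-factor 4 _ 2k≤n fac = no-small-factor 4 (s≤s z≤n) (m≤m+n 4 1) 2k≤n fac (λ ()) small-4
  no-factor 5 _ 2k≤n fac = no-small-factor 5 (s≤s z≤n) ≤-refl 2k≤n fac (λ ()) small-5
  no-factor k@(suc (suc (suc (suc (suc (suc k′)))))) _ 2k≤n fac = no-large-factor k (m≤m+n 6 k′) 2k≤n fac

g₁-nonconstant : ∀ n s → 1 ≤ n → NonConstant (g₁ n s)
g₁-nonconstant n s 1≤n = n , 1≤n , λ z → *≢0 (fact≢0 n) (C≢0 0 s) (ℤ.+-injective (ι-injective
  (trans (sym (g₁-coeff n s 0 n refl)) (trans (cong (λ c → c *ℚ ι (ℤ.+ (n !))) z) (trans (ℚ.*-zeroˡ (ι (ℤ.+ (n !)))) (sym ι-0))))))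

theorem1 : (n s : ℕ) → 1 ≤ n → 9 ≤ s → s ≤ 88 → IrreducibleOverℚ (g₁ n s)
theorem1 n s 1≤n 9≤s s≤88 = g₁-nonconstant n s 1≤n , λ f h prod (nf , nh) →
  let k , 1≤k , 1≤n∸k , fac = factors n s f h prod nf nh in
  [ (λ k≤ → no-factor 9≤s s≤88 k 1≤k (≤-trans (+-monoʳ-≤ k k≤) (≤-reflexive (m+[n∸m]≡n (Factors.k≤n fac)))) fac)
  , (λ k≥ → no-factor 9≤s s≤88 (n ∸ k) 1≤n∸k (≤-trans (+-monoˡ-≤ (n ∸ k) k≥) (≤-reflexive (m+[n∸m]≡n (Factors.k≤n fac)))) (swap-factors fac))
  ]′ (≤-total k (n ∸ k))
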